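{- Let $\omega_a:\Lambda(x\|a)\to\Lambda(x\|a')$ be the $\mathbb Q[a]$-linear ring isomorphism with $\omega_a:e_k(x\|a)\mapsto h_k(x\|a')$ for $k=1,2,\dots$. Then for every partition $\lambda$ $$\omega_a:s_\lambda(x\|a)\mapsto s_{\lambda'}(x\|a'),$$ where $\lambda'$ is the conjugate partition.
   Context: Let $a=(a_i)_{i\in\mathbb Z}$ be a sequence of commuting indeterminates and $\mathbb Q[a]$ the polynomial ring in the $a_i$. Let $a'$ be the sequence with $(a')_i=-a_{ -i+1}$, $i\in\mathbb Z$; $\mathbb Q[a']$ is identified with $\mathbb Q[a]$ by replacing each $(a')_i$ with $-a_{ -i+1}$. The ring $\Lambda(x\|a)$: its elements are sequences $P=(P_0,P_1,P_2,\dots)$, where $P_n$ is a symmetric polynomial in $x_1,\dots,x_n$ with coefficients in $\mathbb Q[a]$, the total degrees of the $P_n$ in the $x_i$ are bounded, and $P_n(x_1,\dots,x_{n-1},a_n)=P_{n-1}(x_1,\dots,x_{n-1})$ for all $n\geqslant 1$; multiplication is componentwise. $\Lambda(x\|a')$ is the same construction with $a'$ in place of $a$. Double Schur functions: for a partition $\lambda$ with $\ell(\lambda)\leqslant n$, $$s_\lambda(x_1,\dots,x_n\|a)=\frac{\det\big[(x_i\|a)^{\lambda_j+n-j}\big]_{i,j=1}^n}{\prod_{1\leqslant i<j\leqslant n}(x_i-x_j)},\qquad (x_i\|a)^r=(x_i-a_n)(x_i-a_{n-1})\cdots(x_i-a_{n-r+1}),\ (x_i\|a)^0=1,$$ and $0$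 if $\ell(\lambda)>n$. This sequence is $s_\lambda(x\|a)\in\Lambda(x\|a)$. Put $e_k(x\|a)=s_{(1^k)}(x\|a)$ and $h_k(x\|a)=s_{(k)}(x\|a)$. Each of the families $(e_k(x\|a))_{k\geqslant 1}$, $(h_k(x\|a))_{k\geqslant 1}$ is a set of algebraically independent generators of $\Lambda(x\|a)$ over $\mathbb Q[a]$, so $\omega_a$ is well defined. -}

module Defs where

open import Level using (Level; 0ℓ)
open import Algebra.Bundles using (CommutativeRing)
import Algebra.Solver.Ring.NaturalCoefficients.Default as Solver
open import Data.Bool.Base using (true; false; if_then_else_)
open import Data.Nat.Base as ℕ using (ℕ; zero; suc; z≤n; s≤s)
import Data.Nat.ListAction as ℕ using (sum)
import Data.Nat.Properties as ℕ
open import Data.Integer.Base as ℤ using (ℤ; +_; 1ℤ)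
import Data.Rational.Base as ℚ
import Data.Rational.Properties as ℚ
open import Data.Fin.Base as Fin using (Fin; zero; suc; toℕ; fromℕ; inject₁; punchIn; punchOut)
open import Data.Fin.Properties as Fin using (_<?_; _≟_; punchIn-punchOut)
open import Data.Fin.Permutation as Perm using (Permutation′; _⟨$⟩ʳ_)
import Data.Fin.Permutation.Components as PC
open import Data.Fin.Permutation.Transposition.List using (TranspositionList; eval; decompose; eval-decompose)
import Data.Fin.Relation.Unary.Top as Top
open import Data.List.Base as List using (List; []; _∷_; _++_; length)
import Data.List.Properties as List
open import Data.List.Membership.Propositional using (_∈_)
import Data.List.Membership.Propositional.Properties as Membership
open import Data.List.Relation.Unary.All as All using (All; []; _∷_)
import Data.List.Relation.Unary.All.Properties as All
open import Data.List.Relation.Unary.AllPairs using ([]; _∷_)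
open import Data.List.Relation.Unary.Linked as Linked using (Linked; []; [-]; _∷_)
import Data.List.Relation.Unary.Linked.Properties as Linked
open import Data.List.Relation.Unary.Unique.Propositional using (Unique)
import Data.List.Relation.Unary.Unique.Propositional.Properties as Unique
open import Data.Product.Base using (Σ; ∃; _×_; _,_; _,′_; proj₁; proj₂)
import Data.Vec.Functional as Vector
open import Function.Base using (_∘_; case_of_)
open import Relation.Binary.Definitions using (DecidableEquality; tri<; tri≈; tri>)
open import Relation.Binary.PropositionalEquality as ≡ using (_≡_; _≢_; _≗_)
import Relation.Binary.Reasoning.Setoid as SetoidReasoning
open import Relation.Nullary using (¬_; yes; no; contradiction; does)

private
  variable
    X Y Z : Set

-- The polynomial ring R[X], presented as the free commutative R-algebra on X:
-- arithmetical expressions modulo the equations of commutative R-algebras.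
module Polynomial (R : CommutativeRing 0ℓ 0ℓ) where

  private module R = CommutativeRing R

  infixl 6 _⊕_
  infixl 7 _⊗_
  infix  8 ⊖_
  infix  4 _≃_

  data Poly (X : Set) : Set where
    con : R.Carrier → Poly X
    var : X → Poly X
    _⊕_ : Poly X → Poly X → Poly X
    _⊗_ : Poly X → Poly X → Poly X
    ⊖_  : Poly X → Poly X

  data _≃_ {X : Set} : Poly X → Poly X → Set where
    ≃-refl       : ∀ {p} → p ≃ p
    ≃-sym        : ∀ {p q} → p ≃ q → q ≃ p
    ≃-trans      : ∀ {p q r} → p ≃ q → q ≃ r → p ≃ r
    ⊕-cong       : ∀ {p q r s} → p ≃ q → r ≃ s → p ⊕ r ≃ q ⊕ s
    ⊗-cong       : ∀ {p q r s} → p ≃ q → r ≃ s → p ⊗ r ≃ q ⊗ s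
    ⊖-cong       : ∀ {p q} → p ≃ q → ⊖ p ≃ ⊖ q
    ⊕-assoc      : ∀ p q r → (p ⊕ q) ⊕ r ≃ p ⊕ (q ⊕ r)
    ⊕-comm       : ∀ p q → p ⊕ q ≃ q ⊕ p
    ⊕-identityˡ  : ∀ p → con R.0# ⊕ p ≃ p
    ⊖-inverseˡ   : ∀ p → ⊖ p ⊕ p ≃ con R.0#
    ⊗-assoc      : ∀ p q r → (p ⊗ q) ⊗ r ≃ p ⊗ (q ⊗ r)
    ⊗-comm       : ∀ p q → p ⊗ q ≃ q ⊗ p
    ⊗-identityˡ  : ∀ p → con R.1# ⊗ p ≃ p
    ⊗-distribˡ-⊕ : ∀ p q r → p ⊗ (q ⊕ r) ≃ p ⊗ q ⊕ p ⊗ r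
    con-cong     : ∀ {a b} → a R.≈ b → con a ≃ con b
    con-+        : ∀ a b → con (a R.+ b) ≃ con a ⊕ con b
    con-*        : ∀ a b → con (a R.* b) ≃ con a ⊗ con b

  polyRing : Set → CommutativeRing 0ℓ 0ℓ
  polyRing X = record
    { Carrier = Poly X
    ; _≈_ = _≃_
    ; _+_ = _⊕_
    ; _*_ = _⊗_
    ; -_  = ⊖_
    ; 0#  = con R.0#
    ; 1#  = con R.1#
    ; isCommutativeRing = record
      { isRing = record
        { +-isAbelianGroup = record
          { isGroup = record
            { isMonoid = record
              { isSemigroup = record
                { isMagma = record
                  { isEquivalence = record
                    { refl = ≃-refl ; sym = ≃-sym ; trans = ≃-trans }
                  ; ∙-cong = ⊕-cong
                  }
                ; assoc = ⊕-assoc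
                }
              ; identity = ⊕-identityˡ
                         , λ p → ≃-trans (⊕-comm p _) (⊕-identityˡ p)
              }
            ; inverse = ⊖-inverseˡ , λ p → ≃-trans (⊕-comm p _) (⊖-inverseˡ p)
            ; ⁻¹-cong = ⊖-cong
            }
          ; comm = ⊕-comm
          }
        ; *-cong = ⊗-cong
        ; *-assoc = ⊗-assoc
        ; *-identity = ⊗-identityˡ
                     , λ p → ≃-trans (⊗-comm p _) (⊗-identityˡ p)
        ; distrib = ⊗-distribˡ-⊕ , λ p q r →
            ≃-trans (⊗-comm _ p)
              (≃-trans (⊗-distribˡ-⊕ p q r) (⊕-cong (⊗-comm p q) (⊗-comm p r)))
        }
      ; *-comm = ⊗-comm
      }
    }

  subst : (X → Poly Y) → Poly X → Poly Y
  subst θ (con a) = con a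
  subst θ (var x) = θ x
  subst θ (p ⊕ q) = subst θ p ⊕ subst θ q
  subst θ (p ⊗ q) = subst θ p ⊗ subst θ q
  subst θ (⊖ p)   = ⊖ subst θ p

  rename : (X → Y) → Poly X → Poly Y
  rename f = subst (var ∘ f)

  -- Total degree at most d: some expression for the polynomial has formal
  -- degree at most d.
  data Degree≤ {X : Set} : ℕ → Poly X → Set where
    deg-con  : ∀ {d a} → Degree≤ d (con a)
    deg-var  : ∀ {d x} → Degree≤ (suc d) (var x)
    deg-⊕    : ∀ {d p q} → Degree≤ d p → Degree≤ d q → Degree≤ d (p ⊕ q)
    deg-⊗    : ∀ {d d₁ d₂ p q} → Degree≤ d₁ p → Degree≤ d₂ q →
               d₁ ℕ.+ d₂ ℕ.≤ d → Degree≤ d (p ⊗ q)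
    deg-⊖    : ∀ {d p} → Degree≤ d p → Degree≤ d (⊖ p)
    deg-resp : ∀ {d p q} → p ≃ q → Degree≤ d p → Degree≤ d q

  deg-weaken : ∀ {d e} {p : Poly X} → d ℕ.≤ e → Degree≤ d p → Degree≤ e p
  deg-weaken d≤e       deg-con          = deg-con
  deg-weaken (s≤s d≤e) deg-var          = deg-var
  deg-weaken d≤e       (deg-⊕ u v)      = deg-⊕ (deg-weaken d≤e u) (deg-weaken d≤e v)
  deg-weaken d≤e       (deg-⊗ u v le)   = deg-⊗ u v (ℕ.≤-trans le d≤e)
  deg-weaken d≤e       (deg-⊖ u)        = deg-⊖ (deg-weaken d≤e u)
  deg-weaken d≤e       (deg-resp p≃q u) = deg-resp p≃q (deg-weaken d≤e u)

  subst-cong : (θ : X → Poly Y) {p q : Poly X} → p ≃ q → subst θ p ≃ subst θ q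
  subst-cong θ ≃-refl               = ≃-refl
  subst-cong θ (≃-sym e)            = ≃-sym (subst-cong θ e)
  subst-cong θ (≃-trans e f)        = ≃-trans (subst-cong θ e) (subst-cong θ f)
  subst-cong θ (⊕-cong e f)         = ⊕-cong (subst-cong θ e) (subst-cong θ f)
  subst-cong θ (⊗-cong e f)         = ⊗-cong (subst-cong θ e) (subst-cong θ f)
  subst-cong θ (⊖-cong e)           = ⊖-cong (subst-cong θ e)
  subst-cong θ (⊕-assoc p q r)      = ⊕-assoc _ _ _
  subst-cong θ (⊕-comm p q)         = ⊕-comm _ _
  subst-cong θ (⊕-identityˡ p)      = ⊕-identityˡ _
  subst-cong θ (⊖-inverseˡ p)       = ⊖-inverseˡ _
  subst-cong θ (⊗-assoc p q r)      = ⊗-assoc _ _ _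
  subst-cong θ (⊗-comm p q)         = ⊗-comm _ _
  subst-cong θ (⊗-identityˡ p)      = ⊗-identityˡ _
  subst-cong θ (⊗-distribˡ-⊕ p q r) = ⊗-distribˡ-⊕ _ _ _
  subst-cong θ (con-cong e)         = con-cong e
  subst-cong θ (con-+ a b)          = con-+ a b
  subst-cong θ (con-* a b)          = con-* a b

  subst-cong-env : {θ η : X → Poly Y} → (∀ x → θ x ≃ η x) →
                   (p : Poly X) → subst θ p ≃ subst η p
  subst-cong-env e (con a) = ≃-refl
  subst-cong-env e (var x) = e x
  subst-cong-env e (p ⊕ q) = ⊕-cong (subst-cong-env e p) (subst-cong-env e q)
  subst-cong-env e (p ⊗ q) = ⊗-cong (subst-cong-env e p) (subst-cong-env e q)
  subst-cong-env e (⊖ p)   = ⊖-cong (subst-cong-env e p)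

  subst-subst : (η : Y → Poly Z) (θ : X → Poly Y) (p : Poly X) →
                subst η (subst θ p) ≡ subst (subst η ∘ θ) p
  subst-subst η θ (con a) = ≡.refl
  subst-subst η θ (var x) = ≡.refl
  subst-subst η θ (p ⊕ q) = ≡.cong₂ _⊕_ (subst-subst η θ p) (subst-subst η θ q)
  subst-subst η θ (p ⊗ q) = ≡.cong₂ _⊗_ (subst-subst η θ p) (subst-subst η θ q)
  subst-subst η θ (⊖ p)   = ≡.cong ⊖_ (subst-subst η θ p)

  subst-var : (p : Poly X) → subst var p ≡ p
  subst-var (con a) = ≡.refl
  subst-var (var x) = ≡.refl
  subst-var (p ⊕ q) = ≡.cong₂ _⊕_ (subst-var p) (subst-var q)
  subst-var (p ⊗ q) = ≡.cong₂ _⊗_ (subst-var p) (subst-var q)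
  subst-var (⊖ p)   = ≡.cong ⊖_ (subst-var p)

  -- u is not a zero divisor.
  Regular : Poly X → Set
  Regular {X} u = ∀ p → u ⊗ p ≃ con R.0# → p ≃ con R.0#

  module _ {X : Set} where
    open CommutativeRing (polyRing X) using (setoid; ring; zeroˡ; zeroʳ; +-group; +-identityʳ)
    open import Algebra.Properties.Ring ring using (-‿distribʳ-*)
    open import Algebra.Properties.Group +-group using (∙-cancelˡ; x∙y⁻¹≈ε⇒x≈y)
    open SetoidReasoning setoid

    regular-cancelˡ : ∀ {u p q : Poly X} → Regular u → u ⊗ p ≃ u ⊗ q → p ≃ q
    regular-cancelˡ {u} {p} {q} reg e = x∙y⁻¹≈ε⇒x≈y p q (reg (p ⊕ ⊖ q) (begin
      u ⊗ (p ⊕ ⊖ q)       ≈⟨ ⊗-distribˡ-⊕ _ _ _ ⟩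
      u ⊗ p ⊕ u ⊗ ⊖ q     ≈⟨ ⊕-cong e (≃-sym (-‿distribʳ-* u q)) ⟩
      u ⊗ q ⊕ ⊖ (u ⊗ q)   ≈⟨ ⊕-comm _ _ ⟩
      ⊖ (u ⊗ q) ⊕ u ⊗ q   ≈⟨ ⊖-inverseˡ _ ⟩
      con R.0#            ∎))

    regular-⊗ : ∀ {u v : Poly X} → Regular u → Regular v → Regular (u ⊗ v)
    regular-⊗ ru rv p e = rv p (ru _ (≃-trans (≃-sym (⊗-assoc _ _ p)) e))

    regular-1 : Regular {X} (con R.1#)
    regular-1 p e = ≃-trans (≃-sym (⊗-identityˡ p)) e

    regular-resp : ∀ {u v : Poly X} → u ≃ v → Regular u → Regular v
    regular-resp u≃v ru p e = ru p (≃-trans (⊗-cong u≃v ≃-refl) e)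

  -- The quotient of p - p|_{x ≔ t} by x - t, for t not involving x, is δ p;
  -- it exhibits the division by x - t of any p that vanishes at x ≔ t.
  module DividedDifference {X : Set} (_≟_ : DecidableEquality X) (x : X) (t : Poly X) where
    open CommutativeRing (polyRing X) using (setoid; ring; zeroˡ; zeroʳ; +-identityʳ; +-abelianGroup; *-identityʳ)
    open import Algebra.Properties.Ring ring using (-‿distribʳ-*; -0#≈0#)
    open import Algebra.Properties.AbelianGroup +-abelianGroup using (⁻¹-∙-comm)
    open SetoidReasoning setoid
    open Solver (CommutativeRing.commutativeSemiring (polyRing X)) using (solve; _:+_; _:*_; _:=_)

    point : X → Poly X
    point y with y ≟ x
    ... | yes _ = t
    ... | no  _ = var y

    at : Poly X → Poly X
    at = subst point

    δ : Poly X → Poly X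
    δ (con a) = con R.0#
    δ (var y) with y ≟ x
    ... | yes _ = con R.1#
    ... | no  _ = con R.0#
    δ (p ⊕ q) = δ p ⊕ δ q
    δ (p ⊗ q) = δ p ⊗ q ⊕ at p ⊗ δ q
    δ (⊖ p)   = ⊖ δ p

    u : Poly X
    u = var x ⊕ ⊖ t

    split : ∀ p → p ≃ at p ⊕ u ⊗ δ p
    split (con a) = ≃-sym (≃-trans (⊕-cong ≃-refl (zeroʳ u)) (+-identityʳ _))
    split (var y) with y ≟ x
    ... | yes ≡.refl = begin
      var y                         ≈⟨ +-identityʳ _ ⟨
      var y ⊕ con R.0#              ≈⟨ ⊕-cong ≃-refl (⊖-inverseˡ t) ⟨
      var y ⊕ (⊖ t ⊕ t)             ≈⟨ ⊕-assoc _ _ _ ⟨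
      u ⊕ t                         ≈⟨ ⊕-comm _ _ ⟩
      t ⊕ u                         ≈⟨ ⊕-cong ≃-refl (*-identityʳ u) ⟨
      t ⊕ u ⊗ con R.1#              ∎
    ... | no  _ = ≃-sym (≃-trans (⊕-cong ≃-refl (zeroʳ u)) (+-identityʳ _))
    split (p ⊕ q) = ≃-trans (⊕-cong (split p) (split q))
      (solve 5 (λ u p₀ p₁ q₀ q₁ → (p₀ :+ u :* p₁) :+ (q₀ :+ u :* q₁)
          := (p₀ :+ q₀) :+ u :* (p₁ :+ q₁)) ≃-refl u (at p) (δ p) (at q) (δ q))
    split (p ⊗ q) = begin
      p ⊗ q                                          ≈⟨ ⊗-cong (split p) ≃-refl ⟩
      (at p ⊕ u ⊗ δ p) ⊗ q
        ≈⟨ solve 4 (λ u p₀ p₁ q → (p₀ :+ u :* p₁) :* q := p₀ :* q :+ u :* (p₁ :* q))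
             ≃-refl u (at p) (δ p) q ⟩
      at p ⊗ q ⊕ u ⊗ (δ p ⊗ q)                       ≈⟨ ⊕-cong (⊗-cong ≃-refl (split q)) ≃-refl ⟩
      at p ⊗ (at q ⊕ u ⊗ δ q) ⊕ u ⊗ (δ p ⊗ q)
        ≈⟨ solve 6 (λ u p₀ p₁ q₀ q₁ q → p₀ :* (q₀ :+ u :* q₁) :+ u :* (p₁ :* q)
                      := p₀ :* q₀ :+ u :* (p₁ :* q :+ p₀ :* q₁)) ≃-refl u (at p) (δ p) (at q) (δ q) q ⟩
      at p ⊗ at q ⊕ u ⊗ (δ p ⊗ q ⊕ at p ⊗ δ q)       ∎
    split (⊖ p) = begin
      ⊖ p                          ≈⟨ ⊖-cong (split p) ⟩
      ⊖ (at p ⊕ u ⊗ δ p)           ≈⟨ ⁻¹-∙-comm _ _ ⟨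
      ⊖ at p ⊕ ⊖ (u ⊗ δ p)         ≈⟨ ⊕-cong ≃-refl (-‿distribʳ-* u (δ p)) ⟩
      ⊖ at p ⊕ u ⊗ ⊖ δ p           ∎

    δ-cong : ∀ {p q} → p ≃ q → δ p ≃ δ q
    δ-cong ≃-refl          = ≃-refl
    δ-cong (≃-sym e)       = ≃-sym (δ-cong e)
    δ-cong (≃-trans e f)   = ≃-trans (δ-cong e) (δ-cong f)
    δ-cong (⊕-cong e f)    = ⊕-cong (δ-cong e) (δ-cong f)
    δ-cong (⊗-cong e f)    = ⊕-cong (⊗-cong (δ-cong e) f) (⊗-cong (subst-cong point e) (δ-cong f))
    δ-cong (⊖-cong e)      = ⊖-cong (δ-cong e)
    δ-cong (⊕-assoc p q r) = ⊕-assoc _ _ _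
    δ-cong (⊕-comm p q)    = ⊕-comm _ _
    δ-cong (⊕-identityˡ p) = ⊕-identityˡ _
    δ-cong (⊖-inverseˡ p)  = ⊖-inverseˡ _
    δ-cong (⊗-assoc p q r) =
      solve 7 (λ p₀ p₁ q q₀ q₁ r r₁ → (p₁ :* q :+ p₀ :* q₁) :* r :+ p₀ :* q₀ :* r₁
          := p₁ :* (q :* r) :+ p₀ :* (q₁ :* r :+ q₀ :* r₁)) ≃-refl
        (at p) (δ p) q (at q) (δ q) r (δ r)
    δ-cong (⊗-comm p q)    = begin
      δ p ⊗ q ⊕ at p ⊗ δ q                   ≈⟨ ⊕-cong (⊗-cong ≃-refl (split q)) ≃-refl ⟩
      δ p ⊗ (at q ⊕ u ⊗ δ q) ⊕ at p ⊗ δ q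
        ≈⟨ solve 5 (λ u p₀ p₁ q₀ q₁ → p₁ :* (q₀ :+ u :* q₁) :+ p₀ :* q₁
                      := q₁ :* (p₀ :+ u :* p₁) :+ q₀ :* p₁) ≃-refl u (at p) (δ p) (at q) (δ q) ⟩
      δ q ⊗ (at p ⊕ u ⊗ δ p) ⊕ at q ⊗ δ p    ≈⟨ ⊕-cong (⊗-cong ≃-refl (split p)) ≃-refl ⟨
      δ q ⊗ p ⊕ at q ⊗ δ p                   ∎
    δ-cong (⊗-identityˡ p) = ≃-trans (⊕-cong (zeroˡ p) (⊗-identityˡ (δ p))) (⊕-identityˡ _)
    δ-cong (⊗-distribˡ-⊕ p q r) =
      solve 6 (λ p₀ p₁ q q₁ r r₁ → p₁ :* (q :+ r) :+ p₀ :* (q₁ :+ r₁)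
          := (p₁ :* q :+ p₀ :* q₁) :+ (p₁ :* r :+ p₀ :* r₁)) ≃-refl
        (at p) (δ p) q (δ q) r (δ r)
    δ-cong (con-cong e)    = ≃-refl
    δ-cong (con-+ a b)     = ≃-sym (⊕-identityˡ _)
    δ-cong (con-* a b)     = ≃-sym (≃-trans (⊕-cong (zeroˡ _) (zeroʳ _)) (⊕-identityˡ _))

    divide : ∀ p → at p ≃ con R.0# → p ≃ u ⊗ δ p
    divide p e = ≃-trans (split p) (≃-trans (⊕-cong e ≃-refl) (⊕-identityˡ _))

    module _ (at-t : at t ≃ t) (δ-t : δ t ≃ con R.0#) where

      δ-var : δ (var x) ≃ con R.1#
      δ-var with x ≟ x
      ... | yes _ = ≃-refl
      ... | no x≢x = contradiction ≡.refl x≢x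

      at-var : at (var x) ≃ t
      at-var with x ≟ x
      ... | yes _ = ≃-refl
      ... | no x≢x = contradiction ≡.refl x≢x

      regular : Regular u
      regular p e = begin
        p                            ≈⟨ ⊗-identityˡ p ⟨
        con R.1# ⊗ p                 ≈⟨ ⊗-cong δ-u ≃-refl ⟨
        δ u ⊗ p                      ≈⟨ +-identityʳ _ ⟨
        δ u ⊗ p ⊕ con R.0#           ≈⟨ ⊕-cong ≃-refl (≃-trans (⊗-cong at-u ≃-refl) (zeroˡ _)) ⟨
        δ u ⊗ p ⊕ at u ⊗ δ p         ≈⟨ δ-cong e ⟩
        con R.0#                     ∎
        where
        δ-u : δ u ≃ con R.1#
        δ-u = ≃-trans (⊕-cong δ-var (≃-trans (⊖-cong δ-t) -0#≈0#)) (+-identityʳ _)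
        at-u : at u ≃ con R.0#
        at-u = ≃-trans (⊕-cong at-var (⊖-cong at-t)) (≃-trans (⊕-comm _ _) (⊖-inverseˡ t))

    module _ (deg-t : Degree≤ 1 t) where

      deg-point : ∀ y → Degree≤ 1 (point y)
      deg-point y with y ≟ x
      ... | yes _ = deg-t
      ... | no  _ = deg-var

      deg-at : ∀ {d p} → Degree≤ d p → Degree≤ d (at p)
      deg-at deg-con          = deg-con
      deg-at (deg-var {x = y}) = deg-weaken (s≤s z≤n) (deg-point y)
      deg-at (deg-⊕ v w)      = deg-⊕ (deg-at v) (deg-at w)
      deg-at (deg-⊗ v w le)   = deg-⊗ (deg-at v) (deg-at w) le
      deg-at (deg-⊖ v)        = deg-⊖ (deg-at v)
      deg-at (deg-resp e v)   = deg-resp (subst-cong point e) (deg-at v)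

      δ-deg0 : ∀ {d p} → Degree≤ d p → d ≡ 0 → δ p ≃ con R.0#
      δ-deg0 deg-con        _  = ≃-refl
      δ-deg0 (deg-⊕ v w)    e  = ≃-trans (⊕-cong (δ-deg0 v e) (δ-deg0 w e)) (⊕-identityˡ _)
      δ-deg0 (deg-⊗ {d₁ = zero} {zero} v w le) e =
        ≃-trans (⊕-cong (≃-trans (⊗-cong (δ-deg0 v ≡.refl) ≃-refl) (zeroˡ _))
                        (≃-trans (⊗-cong ≃-refl (δ-deg0 w ≡.refl)) (zeroʳ _))) (⊕-identityˡ _)
      δ-deg0 (deg-⊗ {d₁ = zero} {suc _} v w ()) ≡.refl
      δ-deg0 (deg-⊗ {d₁ = suc _} v w ()) ≡.refl
      δ-deg0 (deg-⊖ v)      e  = ≃-trans (⊖-cong (δ-deg0 v e)) -0#≈0#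
      δ-deg0 (deg-resp p≃q v) e = ≃-trans (≃-sym (δ-cong p≃q)) (δ-deg0 v e)

      deg-δ : ∀ {d p} → Degree≤ (suc d) p → Degree≤ d (δ p)
      deg-δ deg-con = deg-con
      deg-δ (deg-var {x = y}) with y ≟ x
      ... | yes _ = deg-con
      ... | no  _ = deg-con
      deg-δ (deg-⊕ v w) = deg-⊕ (deg-δ v) (deg-δ w)
      deg-δ (deg-⊗ {d₁ = zero} {zero} v w le) = deg-resp (≃-sym
        (≃-trans (⊕-cong (≃-trans (⊗-cong (δ-deg0 v ≡.refl) ≃-refl) (zeroˡ _))
                 (≃-trans (⊗-cong ≃-refl (δ-deg0 w ≡.refl)) (zeroʳ _))) (⊕-identityˡ _)))
        (deg-con {a = R.0#})
      deg-δ (deg-⊗ {d₁ = zero} {suc d₂} v w (s≤s le)) = deg-resp (≃-sym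
        (≃-trans (⊕-cong (≃-trans (⊗-cong (δ-deg0 v ≡.refl) ≃-refl) (zeroˡ _)) ≃-refl)
                 (⊕-identityˡ _)))
        (deg-⊗ (deg-at v) (deg-δ w) le)
      deg-δ (deg-⊗ {d₁ = suc d₁} {zero} v w (s≤s le)) = deg-resp (≃-sym
        (≃-trans (⊕-cong ≃-refl (≃-trans (⊗-cong ≃-refl (δ-deg0 w ≡.refl)) (zeroʳ _)))
                 (+-identityʳ _)))
        (deg-⊗ (deg-δ v) w le)
      deg-δ (deg-⊗ {d₁ = suc d₁} {suc d₂} v w (s≤s le)) = deg-⊕
        (deg-⊗ (deg-δ v) w le)
        (deg-⊗ (deg-at v) (deg-δ w) (ℕ.≤-trans (ℕ.≤-reflexive (≡.sym (ℕ.+-suc d₁ d₂))) le))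
      deg-δ (deg-⊖ v) = deg-⊖ (deg-δ v)
      deg-δ (deg-resp e v) = deg-resp (δ-cong e) (deg-δ v)

adjacent : ∀ {n} → Fin n → Fin (suc n) → Fin (suc n)
adjacent zero    zero          = suc zero
adjacent zero    (suc zero)    = zero
adjacent zero    (suc (suc i)) = suc (suc i)
adjacent (suc k) zero          = zero
adjacent (suc k) (suc i)       = suc (adjacent k i)

adjacent-involutive : ∀ {n} (k : Fin n) i → adjacent k (adjacent k i) ≡ i
adjacent-involutive zero    zero          = ≡.refl
adjacent-involutive zero    (suc zero)    = ≡.refl
adjacent-involutive zero    (suc (suc i)) = ≡.refl
adjacent-involutive (suc k) zero          = ≡.refl
adjacent-involutive (suc k) (suc i)       = ≡.cong suc (adjacent-involutive k i)

lift : ∀ {n} → (Fin n → Fin n) → Fin (suc n) → Fin (suc n)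
lift f zero    = zero
lift f (suc i) = suc (f i)

-- Conjugates of adjacent transpositions, up to pointwise equality.
data Odd : ∀ {n} → (Fin n → Fin n) → Set where
  adj  : ∀ {n} (k : Fin n) → Odd (adjacent k)
  conj : ∀ {n} (k : Fin n) {f} → Odd f → Odd (adjacent k ∘ f ∘ adjacent k)
  resp : ∀ {n} {f g : Fin n → Fin n} → f ≗ g → Odd f → Odd g

lift-odd : ∀ {n} {f : Fin n → Fin n} → Odd f → Odd (lift f)
lift-odd (adj k)      = resp (λ { zero → ≡.refl ; (suc i) → ≡.refl }) (adj (suc k))
lift-odd (conj k o)   = resp (λ { zero → ≡.refl ; (suc i) → ≡.refl }) (conj (suc k) (lift-odd o))
lift-odd (resp f≗g o) = resp (λ { zero → ≡.refl ; (suc i) → ≡.cong suc (f≗g i) }) (lift-odd o)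

transpose-odd₀ : ∀ {n} (j : Fin n) → Odd (PC.transpose zero (suc j))
transpose-odd₀ zero =
  resp (λ { zero → ≡.refl ; (suc zero) → ≡.refl ; (suc (suc i)) → ≡.refl }) (adj zero)
transpose-odd₀ (suc j) = resp pointwise (conj zero (lift-odd (transpose-odd₀ j)))
  where
  pointwise : ∀ k → adjacent zero (lift (PC.transpose zero (suc j)) (adjacent zero k))
                    ≡ PC.transpose zero (suc (suc j)) k
  pointwise zero       = ≡.refl
  pointwise (suc zero) = ≡.refl
  pointwise (suc (suc k)) with does (k ≟ j)
  ... | true  = ≡.refl
  ... | false = ≡.refl

transpose-odd : ∀ {n} (i j : Fin n) → i ≢ j → Odd (PC.transpose i j)
transpose-odd zero    zero    i≢j = contradiction ≡.refl i≢j
transpose-odd zero    (suc j) _   = transpose-odd₀ j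
transpose-odd (suc i) zero    _   = resp pointwise (transpose-odd₀ i)
  where
  pointwise : PC.transpose zero (suc i) ≗ PC.transpose (suc i) zero
  pointwise zero = ≡.refl
  pointwise (suc k) with does (k ≟ i)
  ... | true  = ≡.refl
  ... | false = ≡.refl
transpose-odd (suc i) (suc j) i≢j =
  resp (λ { zero    → ≡.sym (Perm.lift₀-transpose i j zero)
          ; (suc k) → ≡.sym (Perm.lift₀-transpose i j (suc k)) })
       (lift-odd (transpose-odd i j (i≢j ∘ ≡.cong suc)))

punchIn-inject₁ : ∀ {n} (i : Fin (suc n)) (r : Fin n) →
                  punchIn (inject₁ i) (inject₁ r) ≡ inject₁ (punchIn i r)
punchIn-inject₁ zero    r       = ≡.refl
punchIn-inject₁ (suc i) zero    = ≡.refl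
punchIn-inject₁ (suc i) (suc r) = ≡.cong suc (punchIn-inject₁ i r)

punchIn-fromℕ : ∀ {n} (i : Fin (suc n)) → punchIn (inject₁ i) (fromℕ n) ≡ fromℕ (suc n)
punchIn-fromℕ zero            = ≡.refl
punchIn-fromℕ {suc n} (suc i) = ≡.cong suc (punchIn-fromℕ i)

module Determinant {c ℓ : Level} (R : CommutativeRing c ℓ) where
  open CommutativeRing R hiding (zero)
  open import Algebra.Properties.Semiring.Sum semiring
    using (sum; sum-syntax; sum-cong-≋; sum-init-last; sum-permute; sum-replicate-zero; *-distribˡ-sum)
  open import Algebra.Properties.CommutativeMonoid.Sum *-commutativeMonoid
    using () renaming (sum to product; sum-cong-≋ to product-cong;
                       sum-init-last to product-init-last; sum-permute to product-permute;
                       sum-remove to product-remove) public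
  open import Algebra.Properties.Ring ring using (-‿distribˡ-*; -‿distribʳ-*)
  open import Algebra.Properties.AbelianGroup +-abelianGroup
    using (⁻¹-∙-comm; ⁻¹-anti-homo‿-) renaming (⁻¹-involutive to -‿involutive; ε⁻¹≈ε to -0#≈0#)
  open import Algebra.Properties.CommutativeSemigroup *-commutativeSemigroup
    using (x∙yz≈y∙xz; interchange)
  open SetoidReasoning setoid

  Matrix : ℕ → Set c
  Matrix n = Fin n → Fin n → Carrier

  sign : ∀ {n} → Fin n → Carrier
  sign zero    = 1#
  sign (suc i) = - sign i

  minor : ∀ {n} → Fin (suc n) → Matrix (suc n) → Matrix n
  minor i M r c = M (punchIn i r) (suc c)

  -- Laplace expansion along the first column.
  det : ∀ {n} → Matrix n → Carrier
  det {zero}  M = 1#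
  det {suc n} M = ∑[ i < suc n ] (sign i * (M i zero * det (minor i M)))

  -- ∏_{i<j} (x_i - x_j)
  difference : ∀ {n} → (Fin n → Carrier) → Fin n → Fin n → Carrier
  difference x i j = if does (i <? j) then x i - x j else 1#

  vandermonde : ∀ {n} → (Fin n → Carrier) → Carrier
  vandermonde x = product (λ i → product (λ j → difference x i j))

  det-cong : ∀ {n} {M N : Matrix n} → (∀ r c → M r c ≈ N r c) → det M ≈ det N
  det-cong {zero}  e = refl
  det-cong {suc n} e = sum-cong-≋ λ i →
    *-cong (refl {sign i}) (*-cong (e i zero) (det-cong (λ r c → e (punchIn i r) (suc c))))

  sum-neg : ∀ {n} (t : Fin n → Carrier) → sum (λ i → - t i) ≈ - sum t
  sum-neg {zero}  t = sym -0#≈0#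
  sum-neg {suc n} t = trans (+-cong refl (sum-neg (t ∘ suc))) (⁻¹-∙-comm _ _)

  data MinorView : ∀ {n} → Fin n → Fin (suc n) → Set ℓ where
    moved : ∀ {n} {k : Fin n} {i} → sign (adjacent k i) ≈ - sign i →
            (∀ r → adjacent k (punchIn i r) ≡ punchIn (adjacent k i) r) → MinorView k i
    fixed : ∀ {n} {k : Fin (suc n)} {i} (k′ : Fin n) → adjacent k i ≡ i →
            (∀ r → adjacent k (punchIn i r) ≡ punchIn i (adjacent k′ r)) → MinorView k i

  minorView : ∀ {n} (k : Fin n) i → MinorView k i
  minorView zero zero = moved refl λ { zero → ≡.refl ; (suc r) → ≡.refl }
  minorView zero (suc zero) = moved (sym (-‿involutive _)) λ { zero → ≡.refl ; (suc r) → ≡.refl }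
  minorView {suc (suc n)} zero (suc (suc i)) = fixed zero ≡.refl
    λ { zero → ≡.refl ; (suc zero) → ≡.refl ; (suc (suc r)) → ≡.refl }
  minorView {suc n} (suc k) zero = fixed k ≡.refl λ r → ≡.refl
  minorView {suc n} (suc k) (suc i) with minorView k i
  ... | moved s e    = moved (-‿cong s) λ { zero → ≡.refl ; (suc r) → ≡.cong suc (e r) }
  ... | fixed k′ s e = fixed (suc k′) (≡.cong suc s)
    λ { zero → ≡.refl ; (suc r) → ≡.cong suc (e r) }

  det-adjacent : ∀ {n} (k : Fin n) (M : Matrix (suc n)) → det (M ∘ adjacent k) ≈ - det M
  det-adjacent {n} k M = begin
    sum (term (M ∘ adjacent k))            ≈⟨ sum-cong-≋ flips ⟩
    sum (λ i → - term M (adjacent k i))    ≈⟨ sum-permute (λ i → - term M i) π ⟨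
    sum (λ i → - term M i)                 ≈⟨ sum-neg (term M) ⟩
    - sum (term M)                         ∎
    where
    π : Permutation′ (suc n)
    π = Perm.permutation (adjacent k) (adjacent k) (adjacent-involutive k) (adjacent-involutive k)
    term : Matrix (suc n) → Fin (suc n) → Carrier
    term N i = sign i * (N i zero * det (minor i N))
    flips : ∀ i → term (M ∘ adjacent k) i ≈ - term M (adjacent k i)
    flips i with minorView k i
    ... | moved s e = begin
      sign i * (M (adjacent k i) zero * det (minor i (M ∘ adjacent k)))
        ≈⟨ *-cong (trans (sym (-‿involutive _)) (-‿cong (sym s)))
             (*-cong refl (det-cong λ r c → reflexive (≡.cong (λ a → M a (suc c)) (e r)))) ⟩
      - sign (adjacent k i) * (M (adjacent k i) zero * det (minor (adjacent k i) M))
        ≈⟨ -‿distribˡ-* _ _ ⟨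
      - term M (adjacent k i) ∎
    ... | fixed k′ s e = begin
      sign i * (M (adjacent k i) zero * det (minor i (M ∘ adjacent k)))
        ≈⟨ *-cong refl (*-cong (reflexive (≡.cong (λ a → M a zero) s))
             (trans (det-cong λ r c → reflexive (≡.cong (λ a → M a (suc c)) (e r)))
                    (det-adjacent k′ (minor i M)))) ⟩
      sign i * (M i zero * - det (minor i M))
        ≈⟨ *-cong refl (-‿distribʳ-* _ _) ⟨
      sign i * - (M i zero * det (minor i M))
        ≈⟨ -‿distribʳ-* _ _ ⟨
      - term M i
        ≈⟨ -‿cong (reflexive (≡.cong (term M) s)) ⟨
      - term M (adjacent k i) ∎

  det-odd : ∀ {n} {f : Fin n → Fin n} → Odd f → (M : Matrix n) → det (M ∘ f) ≈ - det M
  det-odd (adj k) M = det-adjacent k M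
  det-odd (conj k {f} o) M = begin
    det (M ∘ adjacent k ∘ f ∘ adjacent k)  ≈⟨ det-adjacent k (M ∘ adjacent k ∘ f) ⟩
    - det (M ∘ adjacent k ∘ f)             ≈⟨ -‿cong (det-odd o (M ∘ adjacent k)) ⟩
    - - det (M ∘ adjacent k)               ≈⟨ -‿cong (-‿cong (det-adjacent k M)) ⟩
    - - - det M                            ≈⟨ -‿involutive _ ⟩
    - det M                                ∎
  det-odd (resp f≗g o) M =
    trans (det-cong λ r c → reflexive (≡.cong (λ a → M a c) (≡.sym (f≗g r)))) (det-odd o M)

  det-scale : ∀ {n} (a : Fin n → Carrier) (M : Matrix n) →
              det (λ r c → a r * M r c) ≈ product a * det M
  det-scale {zero}  a M = sym (*-identityˡ 1#)
  det-scale {suc n} a M = trans (sum-cong-≋ scaled) (sym (*-distribˡ-sum (product a) term))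
    where
    term : Fin (suc n) → Carrier
    term i = sign i * (M i zero * det (minor i M))
    scaled : ∀ i → sign i * (a i * M i zero * det (minor i (λ r c → a r * M r c)))
                   ≈ product a * (sign i * (M i zero * det (minor i M)))
    scaled i = begin
      sign i * (a i * M i zero * det (minor i (λ r c → a r * M r c)))
        ≈⟨ *-cong refl (*-cong refl (det-scale (a ∘ punchIn i) (minor i M))) ⟩
      sign i * (a i * M i zero * (product (a ∘ punchIn i) * det (minor i M)))
        ≈⟨ *-cong refl (interchange _ _ _ _) ⟩
      sign i * (a i * product (a ∘ punchIn i) * (M i zero * det (minor i M)))
        ≈⟨ *-cong refl (*-cong (product-remove a) refl) ⟨
      sign i * (product a * (M i zero * det (minor i M)))
        ≈⟨ x∙yz≈y∙xz _ _ _ ⟩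
      product a * (sign i * (M i zero * det (minor i M))) ∎

  det-zero-row : ∀ {n} (k : Fin n) (M : Matrix n) → (∀ c → M k c ≈ 0#) → det M ≈ 0#
  det-zero-row {suc n} k M z = trans (sum-cong-≋ vanish) (sum-replicate-zero (suc n))
    where
    vanish : ∀ i → sign i * (M i zero * det (minor i M)) ≈ 0#
    vanish i with i ≟ k
    ... | yes ≡.refl = trans (*-cong refl (trans (*-cong (z zero) refl) (zeroˡ _))) (zeroʳ _)
    ... | no i≢k = trans (*-cong refl (trans (*-cong refl
            (det-zero-row (punchOut i≢k) (minor i M) λ c →
              trans (reflexive (≡.cong (λ a → M a (suc c)) (punchIn-punchOut i≢k))) (z (suc c))))
            (zeroʳ _))) (zeroʳ _)

  sign-inject₁ : ∀ {n} (i : Fin n) → sign (inject₁ i) ≡ sign i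
  sign-inject₁ zero    = ≡.refl
  sign-inject₁ (suc i) = ≡.cong -_ (sign-inject₁ i)

  det-last-row : ∀ {n} (M : Matrix (suc n)) → (∀ c → M (fromℕ n) (inject₁ c) ≈ 0#) →
                 M (fromℕ n) (fromℕ n) ≈ 1# →
                 det M ≈ det (λ r c → M (inject₁ r) (inject₁ c))
  det-last-row {zero} M z o = begin
    1# * (M zero zero * 1#) + 0#  ≈⟨ +-identityʳ _ ⟩
    1# * (M zero zero * 1#)       ≈⟨ *-identityˡ _ ⟩
    M zero zero * 1#              ≈⟨ *-identityʳ _ ⟩
    M zero zero                   ≈⟨ o ⟩
    1#                            ∎
  det-last-row {suc n} M z o = begin
    sum term                                      ≈⟨ sum-init-last term ⟩
    sum (term ∘ inject₁) + term (fromℕ (suc n))   ≈⟨ +-cong (sum-cong-≋ rest) last ⟩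
    det (λ r c → M (inject₁ r) (inject₁ c)) + 0#  ≈⟨ +-identityʳ _ ⟩
    det (λ r c → M (inject₁ r) (inject₁ c))       ∎
    where
    term : Fin (suc (suc n)) → Carrier
    term i = sign i * (M i zero * det (minor i M))
    last : term (fromℕ (suc n)) ≈ 0#
    last = trans (*-cong refl (trans (*-cong (z zero) refl) (zeroˡ _))) (zeroʳ _)
    rest : ∀ i → term (inject₁ i) ≈ sign i * (M (inject₁ i) zero *
                   det (minor i (λ r c → M (inject₁ r) (inject₁ c))))
    rest i = *-cong (reflexive (sign-inject₁ i)) (*-cong refl (trans
      (det-last-row (minor (inject₁ i) M)
        (λ c → trans (reflexive (≡.cong (λ a → M a (suc (inject₁ c))) (punchIn-fromℕ i))) (z (suc c)))
        (trans (reflexive (≡.cong (λ a → M a (fromℕ (suc n))) (punchIn-fromℕ i))) o))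
      (det-cong λ r c → reflexive (≡.cong (λ a → M a (suc (inject₁ c))) (punchIn-inject₁ i r)))))

  vandermonde-cong : ∀ {n} {x y : Fin n → Carrier} → (∀ i → x i ≈ y i) → vandermonde x ≈ vandermonde y
  vandermonde-cong {x = x} {y} e = product-cong λ i → product-cong λ j → factor i j
    where
    factor : ∀ i j → difference x i j ≈ difference y i j
    factor i j with does (i <? j)
    ... | true  = +-cong (e i) (-‿cong (e j))
    ... | false = refl

  vandermonde-suc : ∀ {n} (x : Fin (suc n) → Carrier) →
    vandermonde x ≈ product (λ j → x zero - x (suc j)) * vandermonde (x ∘ suc)
  vandermonde-suc x = *-cong (*-identityˡ _)
    (product-cong λ i → *-identityˡ (product (difference (x ∘ suc) i)))

  vandermonde-adjacent : ∀ {n} (k : Fin n) (x : Fin (suc n) → Carrier) →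
    vandermonde (x ∘ adjacent k) ≈ - vandermonde x
  vandermonde-adjacent {suc n} zero x = begin
    vandermonde (x ∘ adjacent zero)
      ≈⟨ expand (x ∘ adjacent zero) ⟩
    (x₁ - x₀) * product f₁ * (product f₀ * V)
      ≈⟨ *-cong (*-cong (⁻¹-anti-homo‿- x₀ x₁) refl) refl ⟨
    - (x₀ - x₁) * product f₁ * (product f₀ * V)
      ≈⟨ *-cong (-‿distribˡ-* _ _) refl ⟨
    - ((x₀ - x₁) * product f₁) * (product f₀ * V)
      ≈⟨ -‿distribˡ-* _ _ ⟨
    - ((x₀ - x₁) * product f₁ * (product f₀ * V))
      ≈⟨ -‿cong (trans (*-assoc _ _ _) (trans (*-cong refl (x∙yz≈y∙xz _ _ _)) (sym (*-assoc _ _ _)))) ⟩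
    - ((x₀ - x₁) * product f₀ * (product f₁ * V))
      ≈⟨ -‿cong (expand x) ⟨
    - vandermonde x ∎
    where
    x₀ = x zero
    x₁ = x (suc zero)
    f₀ f₁ : Fin n → Carrier
    f₀ j = x₀ - x (suc (suc j))
    f₁ j = x₁ - x (suc (suc j))
    V = vandermonde {n} (λ j → x (suc (suc j)))
    expand : ∀ (y : Fin (suc (suc n)) → Carrier) → vandermonde y ≈
      (y zero - y (suc zero)) * product (λ j → y zero - y (suc (suc j)))
        * (product (λ j → y (suc zero) - y (suc (suc j))) * vandermonde {n} (λ j → y (suc (suc j))))
    expand y = trans (vandermonde-suc y) (*-cong refl (vandermonde-suc (λ j → y (suc j))))
  vandermonde-adjacent {suc n} (suc k) x = begin
    vandermonde (x ∘ adjacent (suc k))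
      ≈⟨ vandermonde-suc (x ∘ adjacent (suc k)) ⟩
    product (f ∘ adjacent k) * vandermonde (x ∘ suc ∘ adjacent k)
      ≈⟨ *-cong (sym (product-permute f π)) (vandermonde-adjacent k (x ∘ suc)) ⟩
    product f * - vandermonde (x ∘ suc)
      ≈⟨ -‿distribʳ-* _ _ ⟨
    - (product f * vandermonde (x ∘ suc))
      ≈⟨ -‿cong (vandermonde-suc x) ⟨
    - vandermonde x ∎
    where
    f : Fin (suc n) → Carrier
    f j = x zero - x (suc j)
    π : Permutation′ (suc n)
    π = Perm.permutation (adjacent k) (adjacent k) (adjacent-involutive k) (adjacent-involutive k)

  vandermonde-odd : ∀ {n} {f : Fin n → Fin n} → Odd f → (x : Fin n → Carrier) →
                    vandermonde (x ∘ f) ≈ - vandermonde x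
  vandermonde-odd (adj k) x = vandermonde-adjacent k x
  vandermonde-odd (conj k {f} o) x = begin
    vandermonde (x ∘ adjacent k ∘ f ∘ adjacent k)  ≈⟨ vandermonde-adjacent k (x ∘ adjacent k ∘ f) ⟩
    - vandermonde (x ∘ adjacent k ∘ f)             ≈⟨ -‿cong (vandermonde-odd o (x ∘ adjacent k)) ⟩
    - - vandermonde (x ∘ adjacent k)               ≈⟨ -‿cong (-‿cong (vandermonde-adjacent k x)) ⟩
    - - - vandermonde x                            ≈⟨ -‿involutive _ ⟩
    - vandermonde x                                ∎
  vandermonde-odd (resp f≗g o) x =
    trans (vandermonde-cong λ i → reflexive (≡.cong x (≡.sym (f≗g i)))) (vandermonde-odd o x)

  vandermonde-last : ∀ {n} (x : Fin (suc n) → Carrier) →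
    vandermonde x ≈ product (λ i → x (inject₁ i) - x (fromℕ n)) * vandermonde (x ∘ inject₁)
  vandermonde-last {zero}  x = vandermonde-suc x
  vandermonde-last {suc n} x = begin
    vandermonde x
      ≈⟨ vandermonde-suc x ⟩
    product (λ j → x zero - x (suc j)) * vandermonde (x ∘ suc)
      ≈⟨ *-cong (product-init-last (λ j → x zero - x (suc j))) (vandermonde-last (x ∘ suc)) ⟩
    product (λ j → x zero - x (suc (inject₁ j))) * (x zero - x (suc (fromℕ n)))
      * (product (λ i → x (suc (inject₁ i)) - x (suc (fromℕ n))) * vandermonde (x ∘ suc ∘ inject₁))
      ≈⟨ *-cong (*-comm _ _) refl ⟩
    (x zero - x (suc (fromℕ n))) * product (λ j → x zero - x (suc (inject₁ j)))
      * (product (λ i → x (suc (inject₁ i)) - x (suc (fromℕ n))) * vandermonde (x ∘ suc ∘ inject₁))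
      ≈⟨ interchange _ _ _ _ ⟩
    product (λ i → x (inject₁ i) - x (fromℕ (suc n)))
      * (product (λ j → x zero - x (suc (inject₁ j))) * vandermonde (x ∘ suc ∘ inject₁))
      ≈⟨ *-cong refl (vandermonde-suc (x ∘ inject₁)) ⟨
    product (λ i → x (inject₁ i) - x (fromℕ (suc n))) * vandermonde (x ∘ inject₁) ∎

sumℕ : ∀ {n} → (Fin n → ℕ) → ℕ
sumℕ = Vector.foldr ℕ._+_ 0

transpose-same : ∀ {n} (i : Fin n) k → PC.transpose i i k ≡ k
transpose-same i k with k ≟ i
... | yes ≡.refl = ≡.refl
... | no  k≢i with k ≟ i
...   | yes k≡i = contradiction k≡i k≢i
...   | no  _   = ≡.refl

pairs : ∀ n → List (Fin n × Fin n)
pairs zero    = []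
pairs (suc n) = List.tabulate (λ j → zero , suc j) ++
                List.map (λ (i , j) → suc i , suc j) (pairs n)

pairs-< : ∀ n → All (λ (i , j) → i Fin.< j) (pairs n)
pairs-< zero    = []
pairs-< (suc n) = All.++⁺ (All.tabulate⁺ λ j → s≤s z≤n) (All.map⁺ (All.map s≤s (pairs-< n)))

pairs-unique : ∀ n → Unique (pairs n)
pairs-unique zero    = []
pairs-unique (suc n) = Unique.++⁺
  (Unique.tabulate⁺ λ { ≡.refl → ≡.refl })
  (Unique.map⁺ (λ { {_ , _} {_ , _} ≡.refl → ≡.refl }) (pairs-unique n))
  λ { (u , v) → disjoint (Membership.∈-tabulate⁻ u) (Membership.∈-map⁻ _ v) }
  where
  disjoint : ∀ {v : Fin (suc n) × Fin (suc n)} → Σ (Fin n) (λ j → v ≡ (zero , suc j)) →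
             Σ (Fin n × Fin n) (λ w → w ∈ pairs n × v ≡ (suc (proj₁ w) , suc (proj₂ w))) → _
  disjoint (_ , ≡.refl) (_ , _ , ())

-- Σ_j (n - j), for j = 1, …, n
length-pairs : ∀ n → length (pairs n) ≡ sumℕ {n} (λ j → n ℕ.∸ suc (Fin.toℕ j))
length-pairs zero    = ≡.refl
length-pairs (suc n) = ≡.trans (List.length-++ (List.tabulate {n = n} (λ j → zero {n} , suc j)))
  (≡.cong₂ ℕ._+_ (List.length-tabulate {n = n} (λ j → zero {n} , suc j))
    (≡.trans (List.length-map _ (pairs n)) (length-pairs n)))

module Alternants (R : CommutativeRing 0ℓ 0ℓ) (half : CommutativeRing.Carrier R)
  (half+half≈1 : CommutativeRing._≈_ R (CommutativeRing._+_ R half half) (CommutativeRing.1# R)) where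

  private module R = CommutativeRing R
  open Polynomial R
  module _ {X : Set} where
    open Determinant (polyRing X) public

  module _ {X Y : Set} (θ : X → Poly Y) where

    subst-sum : ∀ {n} (t : Fin n → Poly X) →
      subst θ (Vector.foldr _⊕_ (con R.0#) t) ≡ Vector.foldr _⊕_ (con R.0#) (subst θ ∘ t)
    subst-sum {zero}  t = ≡.refl
    subst-sum {suc n} t = ≡.cong (subst θ (t zero) ⊕_) (subst-sum (t ∘ suc))

    subst-product : ∀ {n} (t : Fin n → Poly X) → subst θ (product t) ≡ product (subst θ ∘ t)
    subst-product {zero}  t = ≡.refl
    subst-product {suc n} t = ≡.cong (subst θ (t zero) ⊗_) (subst-product (t ∘ suc))

    subst-sign : ∀ {n} (i : Fin n) → subst θ (sign i) ≡ sign i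
    subst-sign zero    = ≡.refl
    subst-sign (suc i) = ≡.cong ⊖_ (subst-sign i)

    open CommutativeRing (polyRing Y) using (reflexive)
    open import Algebra.Properties.Semiring.Sum (CommutativeRing.semiring (polyRing Y))
      using (sum-cong-≋)

    subst-det : ∀ {n} (M : Matrix n) → subst θ (det M) ≃ det (λ r c → subst θ (M r c))
    subst-det {zero}  M = ≃-refl
    subst-det {suc n} M = ≃-trans
      (reflexive (subst-sum (λ i → sign i ⊗ (M i zero ⊗ det (minor i M)))))
      (sum-cong-≋ λ i → ⊗-cong (reflexive (subst-sign i)) (⊗-cong (≃-refl {p = subst θ (M i zero)}) (subst-det (minor i M))))

    subst-vandermonde : ∀ {n} (x : Fin n → Poly X) →
      subst θ (vandermonde x) ≃ vandermonde (subst θ ∘ x)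
    subst-vandermonde x = ≃-trans (reflexive (subst-product (λ i → product (difference x i)))) (product-cong λ i →
      ≃-trans (reflexive (subst-product (difference x i))) (product-cong λ j → factor i j))
      where
      factor : ∀ i j → subst θ (difference x i j) ≃ difference (subst θ ∘ x) i j
      factor i j with does (i <? j)
      ... | true  = ≃-refl
      ... | false = ≃-refl

  module _ {X : Set} where

    deg-sum : ∀ {d n} {t : Fin n → Poly X} → (∀ i → Degree≤ d (t i)) →
              Degree≤ d (Vector.foldr _⊕_ (con R.0#) t)
    deg-sum {n = zero}  dt = deg-con
    deg-sum {n = suc n} dt = deg-⊕ (dt zero) (deg-sum (dt ∘ suc))

    deg-sign : ∀ {n} (i : Fin n) → Degree≤ {X} 0 (sign i)
    deg-sign zero    = deg-con
    deg-sign (suc i) = deg-⊖ (deg-sign i)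

    deg-det : ∀ {n} (d : Fin n → ℕ) {M : Matrix {X} n} → (∀ r c → Degree≤ (d c) (M r c)) →
              Degree≤ (sumℕ d) (det M)
    deg-det {zero}  d dM = deg-con
    deg-det {suc n} d dM = deg-sum λ i → deg-⊗ (deg-sign i)
      (deg-⊗ (dM i zero) (deg-det (d ∘ suc) λ r c → dM (Fin.punchIn i r) (suc c)) ℕ.≤-refl) ℕ.≤-refl

    halve : ∀ {p : Poly X} → p ≃ ⊖ p → p ≃ con R.0#
    halve {p} e = begin
      p                           ≈⟨ ⊗-identityˡ p ⟨
      con R.1# ⊗ p                ≈⟨ ⊗-cong (≃-trans (con-cong (R.sym half+half≈1)) (con-+ half half)) ≃-refl ⟩
      (con half ⊕ con half) ⊗ p   ≈⟨ ≃-trans (distribʳ p _ _) (≃-sym (⊗-distribˡ-⊕ _ p p)) ⟩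
      con half ⊗ (p ⊕ p)          ≈⟨ ⊗-cong ≃-refl (≃-trans (⊕-cong e ≃-refl) (⊖-inverseˡ p)) ⟩
      con half ⊗ con R.0#         ≈⟨ zeroʳ _ ⟩
      con R.0#                    ∎
      where
      open CommutativeRing (polyRing X) using (setoid; distribʳ; zeroʳ)
      open SetoidReasoning setoid

  module _ {X : Set} where
    open CommutativeRing (polyRing X) using (setoid; *-assoc; *-cong)
    open SetoidReasoning setoid

    differences : ∀ {n} → (Fin n → Poly X) → List (Fin n × Fin n) → Poly X
    differences x []             = con R.1#
    differences x ((i , j) ∷ ps) = (x i ⊕ ⊖ x j) ⊗ differences x ps

    differences-++ : ∀ {n} (x : Fin n → Poly X) ps qs →
      differences x (ps ++ qs) ≃ differences x ps ⊗ differences x qs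
    differences-++ x []       qs = ≃-sym (⊗-identityˡ _)
    differences-++ x (_ ∷ ps) qs =
      ≃-trans (⊗-cong ≃-refl (differences-++ x ps qs)) (≃-sym (⊗-assoc _ _ _))

    differences-map : ∀ {n} (x : Fin (suc n) → Poly X) ps →
      differences x (List.map (λ (i , j) → suc i , suc j) ps) ≡ differences (x ∘ suc) ps
    differences-map x []             = ≡.refl
    differences-map x ((i , j) ∷ ps) = ≡.cong ((x (suc i) ⊕ ⊖ x (suc j)) ⊗_) (differences-map x ps)

    differences-tabulate : ∀ {n m} (x : Fin (suc n) → Poly X) (f : Fin m → Fin n) →
      differences x (List.tabulate (λ j → zero , suc (f j))) ≡ product (λ j → x zero ⊕ ⊖ x (suc (f j)))
    differences-tabulate {m = zero}  x f = ≡.refl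
    differences-tabulate {m = suc m} x f =
      ≡.cong ((x zero ⊕ ⊖ x (suc (f zero))) ⊗_) (differences-tabulate x (f ∘ suc))

    differences-pairs : ∀ {n} (x : Fin n → Poly X) → differences x (pairs n) ≃ vandermonde x
    differences-pairs {zero}  x = ≃-refl
    differences-pairs {suc n} x = begin
      differences x (pairs (suc n))
        ≈⟨ differences-++ x (List.tabulate (λ j → zero , suc j)) _ ⟩
      differences x (List.tabulate (λ j → zero , suc j)) ⊗ differences x (List.map (λ (i , j) → suc i , suc j) (pairs n))
        ≡⟨ ≡.cong₂ _⊗_ (differences-tabulate x (λ j → j)) (differences-map x (pairs n)) ⟩
      product (λ j → x zero ⊕ ⊖ x (suc j)) ⊗ differences (x ∘ suc) (pairs n)
        ≈⟨ ⊗-cong ≃-refl (differences-pairs (x ∘ suc)) ⟩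
      product (λ j → x zero ⊕ ⊖ x (suc j)) ⊗ vandermonde (x ∘ suc)
        ≈⟨ vandermonde-suc x ⟨
      vandermonde x ∎

  module _ {n : ℕ} where
    open CommutativeRing (polyRing (Fin n)) using (ring; setoid; reflexive; *-assoc; *-comm; *-identityʳ; zeroʳ)
    open import Algebra.Properties.Ring ring using (-‿distribˡ-*; -‿distribʳ-*)
    open import Algebra.Properties.Group (CommutativeRing.+-group (polyRing (Fin n)))
      using (⁻¹-injective)
    open SetoidReasoning setoid
    open DividedDifference {Fin n} _≟_

    Symmetric : Poly (Fin n) → Set
    Symmetric p = ∀ (σ : Permutation′ n) → rename (σ ⟨$⟩ʳ_) p ≃ p

    Antisymmetric : Poly (Fin n) → Set
    Antisymmetric p = ∀ i j → i ≢ j → rename (PC.transpose i j) p ≃ ⊖ p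

    infixl 6 _─_
    _─_ : Fin n → Fin n → Poly (Fin n)
    i ─ j = var i ⊕ ⊖ var j

    ─-regular : ∀ {i j} → i ≢ j → Regular (i ─ j)
    ─-regular {i} {j} i≢j = regular i (var j) at-j δ-j
      where
      at-j : at i (var j) (var j) ≃ var j
      at-j with j ≟ i
      ... | yes j≡i = contradiction (≡.sym j≡i) i≢j
      ... | no _    = ≃-refl
      δ-j : δ i (var j) (var j) ≃ con R.0#
      δ-j with j ≟ i
      ... | yes j≡i = contradiction (≡.sym j≡i) i≢j
      ... | no _    = ≃-refl

    at-─-regular : ∀ {i j k l} → i Fin.< j → k Fin.< l → (i , j) ≢ (k , l) →
                   Regular (at k (var l) (i ─ j))
    at-─-regular {i} {j} {k} {l} i<j k<l ij≢kl with i ≟ k | j ≟ k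
    ... | yes ≡.refl | yes ≡.refl = contradiction i<j (ℕ.<-irrefl ≡.refl)
    ... | yes ≡.refl | no  _      = ─-regular λ { ≡.refl → ij≢kl ≡.refl }
    ... | no  _      | yes ≡.refl = ─-regular λ { ≡.refl → ℕ.<-asym i<j k<l }
    ... | no  _      | no  _      = ─-regular λ { ≡.refl → ℕ.<-irrefl ≡.refl i<j }

    Vanishes : Poly (Fin n) → Fin n × Fin n → Set
    Vanishes p (i , j) = at i (var j) p ≃ con R.0#

    antisymmetric-vanishes : ∀ {p} → Antisymmetric p → ∀ i j → i ≢ j → Vanishes p (i , j)
    antisymmetric-vanishes {p} anti i j i≢j = halve (begin
      subst pt p                                ≈⟨ subst-cong-env same p ⟨
      subst (pt ∘ PC.transpose i j) p           ≈⟨ reflexive (subst-subst pt (var ∘ PC.transpose i j) p) ⟨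
      subst pt (rename (PC.transpose i j) p)    ≈⟨ subst-cong pt (anti i j i≢j) ⟩
      ⊖ subst pt p                              ∎)
      where
      pt = point i (var j)
      pt-i : pt i ≃ var j
      pt-i with i ≟ i
      ... | yes _  = ≃-refl
      ... | no i≢i = contradiction ≡.refl i≢i
      pt-j : pt j ≃ var j
      pt-j with j ≟ i
      ... | yes _ = ≃-refl
      ... | no _  = ≃-refl
      same : ∀ k → pt (PC.transpose i j k) ≃ pt k
      same k with k ≟ i
      ... | yes ≡.refl = pt-j
      ... | no k≢i with k ≟ j
      ...   | yes ≡.refl = pt-i
      ...   | no  _ with k ≟ i
      ...     | yes k≡i = contradiction k≡i k≢i
      ...     | no _    = ≃-refl

    differences-regular : ∀ {ps : List (Fin n × Fin n)} → All (λ (i , j) → i Fin.< j) ps →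
                          Regular (differences var ps)
    differences-regular []          = regular-1
    differences-regular (i<j ∷ all) =
      regular-⊗ (─-regular λ { ≡.refl → ℕ.<-irrefl ≡.refl i<j }) (differences-regular all)

    vandermonde-regular : Regular (vandermonde {Fin n} {n} var)
    vandermonde-regular = regular-resp (differences-pairs var) (differences-regular (pairs-< n))

    -- degree: u is a product of k linear factors, so dividing lowers degrees by k.
    record Quotient (p u : Poly (Fin n)) (k : ℕ) : Set where
      field
        quotient : Poly (Fin n)
        exact    : p ≃ u ⊗ quotient
        degree   : ∀ {d} → Degree≤ (k ℕ.+ d) p → Degree≤ d quotient

    divideAll : ∀ {ps} → All (λ (i , j) → i Fin.< j) ps → Unique ps →
                ∀ {p} → All (Vanishes p) ps → Quotient p (differences var ps) (length ps)
    divideAll [] [] [] = record { exact = ≃-sym (⊗-identityˡ _) ; degree = λ dp → dp }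
    divideAll {(i , j) ∷ ps} (i<j ∷ lt) (ij∉ps ∷ uniq) {p} (v ∷ vs) = record
      { quotient = Q.quotient
      ; exact    = ≃-trans p≃uq (≃-trans (⊗-cong ≃-refl Q.exact) (≃-sym (⊗-assoc _ _ _)))
      ; degree   = λ dp → Q.degree (deg-δ i (var j) deg-var dp)
      }
      where
      q = δ i (var j) p
      p≃uq : p ≃ (i ─ j) ⊗ q
      p≃uq = divide i (var j) p v
      vanish : ∀ {kl} → Vanishes p kl × (proj₁ kl Fin.< proj₂ kl) × (i , j) ≢ kl → Vanishes q kl
      vanish {k , l} (vp , k<l , ij≢kl) =
        at-─-regular i<j k<l ij≢kl _ (≃-trans (≃-sym (subst-cong (point k (var l)) p≃uq)) vp)
      module Q = Quotient (divideAll lt uniq {q}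
        (All.map vanish (All.zip (vs , All.zip (lt , ij∉ps)))))

    alternant-quotient : ∀ {p} → Antisymmetric p → Quotient p (vandermonde var) (length (pairs n))
    alternant-quotient {p} anti = record
      { quotient = Q.quotient
      ; exact    = ≃-trans Q.exact (⊗-cong (differences-pairs var) ≃-refl)
      ; degree   = Q.degree
      }
      where
      vanishes : ∀ {ij} → proj₁ ij Fin.< proj₂ ij → Vanishes p ij
      vanishes {i , j} i<j = antisymmetric-vanishes anti i j λ { ≡.refl → ℕ.<-irrefl ≡.refl i<j }
      module Q = Quotient (divideAll (pairs-< n) (pairs-unique n) {p} (All.map vanishes (pairs-< n)))

    quotient-symmetric : ∀ {p q} → Antisymmetric p → p ≃ vandermonde var ⊗ q → Symmetric q
    quotient-symmetric {p} {q} anti e σ = begin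
      rename (σ ⟨$⟩ʳ_) q                  ≈⟨ subst-cong-env (λ k → reflexive (≡.cong var (≡.sym (eval-decompose σ k)))) q ⟩
      rename (eval (decompose σ) ⟨$⟩ʳ_) q ≈⟨ go (decompose σ) ⟩
      q                                   ∎
      where
      V = vandermonde {Fin n} {n} var
      swap : ∀ i j → rename (PC.transpose i j) q ≃ q
      swap i j with i ≟ j
      ... | yes ≡.refl = begin
        rename (PC.transpose i i) q  ≈⟨ subst-cong-env (λ k → reflexive (≡.cong var (transpose-same i k))) q ⟩
        subst var q                  ≡⟨ subst-var q ⟩
        q                            ∎
      ... | no i≢j = regular-cancelˡ vandermonde-regular (⁻¹-injective (begin
        ⊖ (V ⊗ τ q)     ≈⟨ -‿distribˡ-* V (τ q) ⟩
        ⊖ V ⊗ τ q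
          ≈⟨ ⊗-cong (≃-trans (subst-vandermonde (var ∘ PC.transpose i j) var)
                              (vandermonde-odd (transpose-odd i j i≢j) var)) ≃-refl ⟨
        τ V ⊗ τ q       ≈⟨ subst-cong _ e ⟨
        τ p             ≈⟨ anti i j i≢j ⟩
        ⊖ p             ≈⟨ ⊖-cong e ⟩
        ⊖ (V ⊗ q)       ∎))
        where
        τ : Poly (Fin n) → Poly (Fin n)
        τ = rename (PC.transpose i j)
      go : ∀ (ts : TranspositionList n) → rename (eval ts ⟨$⟩ʳ_) q ≃ q
      go []             = reflexive (subst-var q)
      go ((i , j) ∷ ts) = begin
        rename ((eval ts ⟨$⟩ʳ_) ∘ PC.transpose i j) q         ≡⟨ subst-subst (var ∘ (eval ts ⟨$⟩ʳ_)) (var ∘ PC.transpose i j) q ⟨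
        rename (eval ts ⟨$⟩ʳ_) (rename (PC.transpose i j) q)  ≈⟨ subst-cong _ (swap i j) ⟩
        rename (eval ts ⟨$⟩ʳ_) q                              ≈⟨ go ts ⟩
        q                                                     ∎

    alternant-antisymmetric : (f : Fin n → Poly (Fin n) → Poly (Fin n)) →
      (∀ c (θ : Fin n → Poly (Fin n)) p → subst θ (f c p) ≃ f c (subst θ p)) →
      Antisymmetric (det (λ r c → f c (var r)))
    alternant-antisymmetric f natural i j i≢j =
      ≃-trans (subst-det (var ∘ PC.transpose i j) (λ r c → f c (var r)))
        (≃-trans (det-cong λ r c → natural c _ (var r))
          (det-odd (transpose-odd i j i≢j) (λ r c → f c (var r))))

record Partition : Set where
  field
    parts      : List ℕ
    decreasing : Linked ℕ._≥_ parts
    positive   : All (0 ℕ.<_) parts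

open Partition

ℓ : Partition → ℕ
ℓ μ = length (parts μ)

nth : List ℕ → ℕ → ℕ
nth []       _       = 0
nth (m ∷ ms) zero    = m
nth (m ∷ ms) (suc i) = nth ms i

-- μ_{i+1}: indices start at 0, and the partition is padded with zeros.
part : Partition → ℕ → ℕ
part μ = nth (parts μ)

countAbove : List ℕ → ℕ → ℕ
countAbove ms j = length (List.filter (j ℕ.<?_) ms)

countAbove-accept : ∀ {m} ms {j} → j ℕ.< m → countAbove (m ∷ ms) j ≡ suc (countAbove ms j)
countAbove-accept ms j<m = ≡.cong length (List.filter-accept (_ ℕ.<?_) {xs = ms} j<m)

countAbove-reject : ∀ {m} ms {j} → ¬ j ℕ.< m → countAbove (m ∷ ms) j ≡ countAbove ms j
countAbove-reject ms j≮m = ≡.cong length (List.filter-reject (_ ℕ.<?_) {xs = ms} j≮m)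

countAbove-mono : ∀ ms j → countAbove ms (suc j) ℕ.≤ countAbove ms j
countAbove-mono []       j = z≤n
countAbove-mono (m ∷ ms) j = case (suc j ℕ.<? m) ,′ (j ℕ.<? m) of λ where
  (yes 1+j<m , yes j<m) → ≡.subst₂ ℕ._≤_ (≡.sym (countAbove-accept ms 1+j<m))
                            (≡.sym (countAbove-accept ms j<m)) (s≤s (countAbove-mono ms j))
  (yes 1+j<m , no  j≮m) → contradiction (ℕ.<-trans (ℕ.n<1+n j) 1+j<m) j≮m
  (no  1+j≮m , yes j<m) → ≡.subst₂ ℕ._≤_ (≡.sym (countAbove-reject ms 1+j≮m))
                            (≡.sym (countAbove-accept ms j<m)) (ℕ.m≤n⇒m≤1+n (countAbove-mono ms j))
  (no  1+j≮m , no  j≮m) → ≡.subst₂ ℕ._≤_ (≡.sym (countAbove-reject ms 1+j≮m))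
                            (≡.sym (countAbove-reject ms j≮m)) (countAbove-mono ms j)

countAbove-positive : ∀ ms {j} → j ℕ.< nth ms 0 → 0 ℕ.< countAbove ms j
countAbove-positive (m ∷ ms) j<m = ≡.subst (0 ℕ.<_) (≡.sym (countAbove-accept ms j<m)) (s≤s z≤n)

-- μ′_{j+1} = #{ i : μ_i > j } for 0 ≤ j < μ₁
conjugate : Partition → Partition
conjugate μ = record
  { parts      = List.applyUpTo (countAbove (parts μ)) (part μ 0)
  ; decreasing = Linked.applyUpTo⁺₂ _ (part μ 0) (countAbove-mono (parts μ))
  ; positive   = All.applyUpTo⁺₁ _ (part μ 0) (countAbove-positive (parts μ))
  }

column : ℕ → Partition
column k = record
  { parts      = List.replicate k 1
  ; decreasing = ones k
  ; positive   = All.replicate⁺ k (s≤s z≤n)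
  }
  where
  ones : ∀ k → Linked ℕ._≥_ (List.replicate k 1)
  ones zero          = []
  ones (suc zero)    = [-]
  ones (suc (suc k)) = ℕ.≤-refl ∷ ones (suc k)

row : ℕ → Partition
row zero    = record { parts = [] ; decreasing = [] ; positive = [] }
row (suc k) = record { parts = suc k ∷ [] ; decreasing = [-] ; positive = s≤s z≤n ∷ [] }

∸-toℕ : ∀ {n} (j : Fin n) → n ℕ.∸ toℕ j ≡ suc (n ℕ.∸ suc (toℕ j))
∸-toℕ {suc n} zero    = ≡.refl
∸-toℕ {suc n} (suc j) = ∸-toℕ j

nth-beyond : ∀ ms {i} → length ms ℕ.≤ i → nth ms i ≡ 0
nth-beyond []       _         = ≡.refl
nth-beyond (m ∷ ms) (s≤s len) = nth-beyond ms len

nth-positive : ∀ {ms i} → All (0 ℕ.<_) ms → i ℕ.< length ms → ∃ λ r → nth ms i ≡ suc r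
nth-positive {suc m ∷ ms} {zero}  _         _         = m , ≡.refl
nth-positive {m ∷ ms}     {suc i} (_ ∷ pos) (s≤s len) = nth-positive pos len

module ℚ-Poly = Polynomial ℚ.+-*-commutativeRing

ℚ[a] : CommutativeRing 0ℓ 0ℓ
ℚ[a] = ℚ-Poly.polyRing ℤ

private module ℚ[a] = CommutativeRing ℚ[a]

Sequence : Set
Sequence = ℤ → ℚ[a].Carrier

-- a′ is taken inside ℚ[a], under the identification of ℚ[a′] with ℚ[a].
a a′ : Sequence
a  i = ℚ-Poly.var i
a′ i = ℚ[a].- a (ℤ.- i ℤ.+ 1ℤ)

open Polynomial ℚ[a] public
open Alternants ℚ[a] (ℚ-Poly.con ℚ.½)
  (ℚ[a].sym (ℚ-Poly.con-+ ℚ.½ ℚ.½)) public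

-- (x_1, …, x_n) ▹ y = (x_1, …, x_n, y)
_▹_ : ∀ {n} {A : Set} → (Fin n → A) → A → Fin (suc n) → A
_▹_ {zero}  x y _       = y
_▹_ {suc n} x y zero    = x zero
_▹_ {suc n} x y (suc i) = ((x ∘ suc) ▹ y) i

▹-inject₁ : ∀ {n} {A : Set} (x : Fin n → A) y i → (x ▹ y) (inject₁ i) ≡ x i
▹-inject₁ x y zero    = ≡.refl
▹-inject₁ x y (suc i) = ▹-inject₁ (x ∘ suc) y i

▹-fromℕ : ∀ {n} {A : Set} (x : Fin n → A) y → (x ▹ y) (fromℕ n) ≡ y
▹-fromℕ {zero}  x y = ≡.refl
▹-fromℕ {suc n} x y = ▹-fromℕ (x ∘ suc) y

module _ (b : Sequence) where

  -- P(x_1, …, x_{n+1}) ↦ P(x_1, …, x_n, b_{n+1})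
  specialize : ∀ {n} → Poly (Fin (suc n)) → Poly (Fin n)
  specialize {n} = subst (var ▹ con (b (+ suc n)))

  record ΛElement : Set where
    field
      component : (n : ℕ) → Poly (Fin n)
      symmetric : ∀ n → Symmetric (component n)
      bounded   : ∃ λ d → ∀ n → Degree≤ d (component n)
      stable    : ∀ n → specialize (component (suc n)) ≃ component n

infix 4 _≋_
_≋_ : ∀ {b} → ΛElement b → ΛElement b → Set
P ≋ Q = ∀ n → ΛElement.component P n ≃ ΛElement.component Q n

module _ (b : Sequence) where

  open ΛElement

  Λ : CommutativeRing 0ℓ 0ℓ
  Λ = record
    { Carrier = ΛElement b
    ; _≈_ = _≋_
    ; _+_ = λ P Q → record
      { component = λ n → component P n ⊕ component Q n
      ; symmetric = λ n σ → ⊕-cong (symmetric P n σ) (symmetric Q n σ)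
      ; bounded   = let (d , p) = bounded P ; (e , q) = bounded Q in d ℕ.+ e , λ n →
          deg-⊕ (deg-weaken (ℕ.m≤m+n d e) (p n)) (deg-weaken (ℕ.m≤n+m e d) (q n))
      ; stable    = λ n → ⊕-cong (stable P n) (stable Q n)
      }
    ; _*_ = λ P Q → record
      { component = λ n → component P n ⊗ component Q n
      ; symmetric = λ n σ → ⊗-cong (symmetric P n σ) (symmetric Q n σ)
      ; bounded   = let (d , p) = bounded P ; (e , q) = bounded Q in d ℕ.+ e , λ n →
          deg-⊗ (p n) (q n) ℕ.≤-refl
      ; stable    = λ n → ⊗-cong (stable P n) (stable Q n)
      }
    ; -_ = λ P → record
      { component = λ n → ⊖ component P n
      ; symmetric = λ n σ → ⊖-cong (symmetric P n σ)
      ; bounded   = let (d , p) = bounded P in d , λ n → deg-⊖ (p n)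
      ; stable    = λ n → ⊖-cong (stable P n)
      }
    ; 0# = constant ℚ[a].0#
    ; 1# = constant ℚ[a].1#
    ; isCommutativeRing = record
      { isRing = record
        { +-isAbelianGroup = record
          { isGroup = record
            { isMonoid = record
              { isSemigroup = record
                { isMagma = record
                  { isEquivalence = record
                    { refl  = λ n → ≃-refl
                    ; sym   = λ e n → ≃-sym (e n)
                    ; trans = λ e f n → ≃-trans (e n) (f n)
                    }
                  ; ∙-cong = λ e f n → ⊕-cong (e n) (f n)
                  }
                ; assoc = λ P Q R n → ⊕-assoc _ _ _
                }
              ; identity = (λ P n → ⊕-identityˡ _) , λ P n → R.+-identityʳ _
              }
            ; inverse = (λ P n → ⊖-inverseˡ _) , λ P n → R.-‿inverseʳ _
            ; ⁻¹-cong = λ e n → ⊖-cong (e n)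
            }
          ; comm = λ P Q n → ⊕-comm _ _
          }
        ; *-cong     = λ e f n → ⊗-cong (e n) (f n)
        ; *-assoc    = λ P Q R n → ⊗-assoc _ _ _
        ; *-identity = (λ P n → ⊗-identityˡ _) , λ P n → R.*-identityʳ _
        ; distrib    = (λ P Q R n → ⊗-distribˡ-⊕ _ _ _) , λ P Q R n → R.distribʳ _ _ _
        }
      ; *-comm = λ P Q n → ⊗-comm _ _
      }
    }
    where
    constant : ℚ[a].Carrier → ΛElement b
    constant c = record
      { component = λ n → con c
      ; symmetric = λ n σ → ≃-refl
      ; bounded   = 0 , λ n → deg-con
      ; stable    = λ n → ≃-refl
      }
    module R {n : ℕ} = CommutativeRing (polyRing (Fin n))

  -- (p‖b)^r taken from index m downwards: (p - b_m)(p - b_{m-1}) ⋯ (p - b_{m-r+1})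
  power : ∀ {X} → ℤ → ℕ → Poly X → Poly X
  power m zero    p = con ℚ[a].1#
  power m (suc r) p = (p ⊕ ⊖ con (b m)) ⊗ power (ℤ.pred m) r p

  subst-power : ∀ {X Y} (θ : X → Poly Y) m r p → subst θ (power m r p) ≡ power m r (subst θ p)
  subst-power θ m zero    p = ≡.refl
  subst-power θ m (suc r) p = ≡.cong (_ ⊗_) (subst-power θ (ℤ.pred m) r p)

  deg-power : ∀ {X} {p : Poly X} → Degree≤ 1 p → ∀ m r → Degree≤ r (power m r p)
  deg-power dp m zero    = deg-con
  deg-power dp m (suc r) = deg-⊗ (deg-⊕ dp (deg-⊖ deg-con)) (deg-power dp (ℤ.pred m) r) ℕ.≤-refl

  exponent : Partition → (n : ℕ) → Fin n → ℕ
  exponent μ n j = part μ (toℕ j) ℕ.+ (n ℕ.∸ suc (toℕ j))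

  -- The entry (i , j) is (x_i‖b)^{μ_j + n - j}.
  schurMatrix : Partition → (n : ℕ) → Matrix n
  schurMatrix μ n i j = power (+ n) (exponent μ n j) (var i)

  schurMatrix-antisymmetric : ∀ μ n → Antisymmetric (det (schurMatrix μ n))
  schurMatrix-antisymmetric μ n =
    alternant-antisymmetric (λ j → power (+ n) (exponent μ n j))
      λ j θ p → CommutativeRing.reflexive (polyRing (Fin n)) (subst-power θ (+ n) (exponent μ n j) p)

  schurQuotient : ∀ μ n → Quotient (det (schurMatrix μ n)) (vandermonde var) (length (pairs n))
  schurQuotient μ n = alternant-quotient (schurMatrix-antisymmetric μ n)

  -- The quotient det / ∏_{i<j} (x_i - x_j) is determined by schurPoly-exact,
  -- since the denominator is not a zero divisor (vandermonde-regular).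
  schurPoly : Partition → (n : ℕ) → Poly (Fin n)
  schurPoly μ n with ℓ μ ℕ.≤? n
  ... | yes _ = Quotient.quotient (schurQuotient μ n)
  ... | no  _ = con ℚ[a].0#

  schurPoly-exact : ∀ μ n → ℓ μ ℕ.≤ n → det (schurMatrix μ n) ≃ vandermonde var ⊗ schurPoly μ n
  schurPoly-exact μ n ℓ≤n with ℓ μ ℕ.≤? n
  ... | yes _  = Quotient.exact (schurQuotient μ n)
  ... | no ℓ≰n = contradiction ℓ≤n ℓ≰n

  schurPoly-zero : ∀ μ n → n ℕ.< ℓ μ → schurPoly μ n ≡ con ℚ[a].0#
  schurPoly-zero μ n n<ℓ with ℓ μ ℕ.≤? n
  ... | yes ℓ≤n = contradiction ℓ≤n (ℕ.<⇒≱ n<ℓ)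
  ... | no  _   = ≡.refl

  schurPoly-symmetric : ∀ μ n → Symmetric (schurPoly μ n)
  schurPoly-symmetric μ n with ℓ μ ℕ.≤? n
  ... | yes _ = quotient-symmetric (schurMatrix-antisymmetric μ n) (Quotient.exact (schurQuotient μ n))
  ... | no  _ = λ σ → ≃-refl

  sum-parts : ∀ n ms → sumℕ {n} (λ j → nth ms (toℕ j)) ℕ.≤ ℕ.sum ms
  sum-parts zero    ms       = z≤n
  sum-parts (suc n) []       = sum-parts n []
  sum-parts (suc n) (m ∷ ms) = ℕ.+-monoʳ-≤ m (sum-parts n ms)

  sumℕ-+ : ∀ {n} (f g : Fin n → ℕ) → sumℕ (λ j → f j ℕ.+ g j) ≡ sumℕ f ℕ.+ sumℕ g
  sumℕ-+ = ∑-distrib-+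
    where open import Algebra.Properties.CommutativeMonoid.Sum ℕ.+-0-commutativeMonoid using (∑-distrib-+)

  sum-exponents : ∀ μ n → sumℕ (exponent μ n) ℕ.≤ length (pairs n) ℕ.+ ℕ.sum (parts μ)
  sum-exponents μ n = begin
    sumℕ (exponent μ n)                             ≡⟨ sumℕ-+ (λ j → part μ (toℕ j)) δ ⟩
    sumℕ {n} (λ j → part μ (toℕ j)) ℕ.+ sumℕ δ      ≤⟨ ℕ.+-monoˡ-≤ (sumℕ δ) (sum-parts n (parts μ)) ⟩
    ℕ.sum (parts μ) ℕ.+ sumℕ δ                   ≡⟨ ℕ.+-comm (ℕ.sum (parts μ)) (sumℕ δ) ⟩
    sumℕ δ ℕ.+ ℕ.sum (parts μ)                   ≡⟨ ≡.cong (ℕ._+ ℕ.sum (parts μ)) (length-pairs n) ⟨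
    length (pairs n) ℕ.+ ℕ.sum (parts μ)         ∎
    where
    open ℕ.≤-Reasoning
    δ : Fin n → ℕ
    δ j = n ℕ.∸ suc (toℕ j)

  schurPoly-degree : ∀ μ n → Degree≤ (ℕ.sum (parts μ)) (schurPoly μ n)
  schurPoly-degree μ n with ℓ μ ℕ.≤? n
  ... | yes _ = Quotient.degree (schurQuotient μ n) (deg-weaken (sum-exponents μ n)
                  (deg-det (exponent μ n) λ i j → deg-power deg-var (+ n) (exponent μ n j)))
  ... | no  _ = deg-con

  module _ (n : ℕ) where
    open CommutativeRing (polyRing (Fin n)) using (setoid; reflexive; zeroˡ; zeroʳ; -‿inverseʳ)
    open SetoidReasoning setoid
    open DividedDifference {Fin n} Fin._≟_ using () renaming (regular to linear-regular)

    private
      c : Poly (Fin n)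
      c = con (b (+ suc n))

      x̂ : Fin (suc n) → Poly (Fin n)
      x̂ = var ▹ c

      linear : Fin n → Poly (Fin n)
      linear i = var i ⊕ ⊖ c

      regular-product : ∀ {m} (f : Fin m → Poly (Fin n)) → (∀ i → Regular (f i)) → Regular (product f)
      regular-product {zero}  f r = regular-1
      regular-product {suc m} f r = regular-⊗ (r zero) (regular-product (f ∘ suc) (r ∘ suc))

      linears-regular : Regular (product linear)
      linears-regular = regular-product linear λ i → linear-regular i c ≃-refl ≃-refl

    specialize-vandermonde : specialize b (vandermonde var) ≃ product linear ⊗ vandermonde var
    specialize-vandermonde = begin
      specialize b (vandermonde var)   ≈⟨ subst-vandermonde x̂ var ⟩
      vandermonde x̂                  ≈⟨ vandermonde-last x̂ ⟩
      product (λ i → x̂ (inject₁ i) ⊕ ⊖ x̂ (fromℕ n)) ⊗ vandermonde (x̂ ∘ inject₁)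
        ≈⟨ ⊗-cong (product-cong λ i → ⊕-cong (reflexive (▹-inject₁ var c i)) (⊖-cong (reflexive (▹-fromℕ var c))))
                  (vandermonde-cong λ i → reflexive (▹-inject₁ var c i)) ⟩
      product linear ⊗ vandermonde var ∎

    specialize-vandermonde-regular : Regular (specialize b (vandermonde var))
    specialize-vandermonde-regular = regular-resp (≃-sym specialize-vandermonde)
      (regular-⊗ linears-regular vandermonde-regular)

    specializedMatrix : Partition → Matrix {Fin n} (suc n)
    specializedMatrix μ i j = power (+ suc n) (exponent μ (suc n) j) (x̂ i)

    specialize-det : ∀ μ → specialize b (det (schurMatrix μ (suc n))) ≃ det (specializedMatrix μ)
    specialize-det μ = ≃-trans (subst-det x̂ (schurMatrix μ (suc n)))
      (det-cong λ i j → reflexive (subst-power x̂ (+ suc n) (exponent μ (suc n) j) (var i)))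

    power-vanishes : ∀ r p → p ≃ c → power (+ suc n) (suc r) p ≃ con ℚ[a].0#
    power-vanishes r p e =
      ≃-trans (⊗-cong (≃-trans (⊕-cong e ≃-refl) (-‿inverseʳ c)) ≃-refl) (zeroˡ _)

    exponent-inject₁ : ∀ μ (j : Fin n) → exponent μ (suc n) (inject₁ j) ≡ suc (exponent μ n j)
    exponent-inject₁ μ j rewrite Fin.toℕ-inject₁ j =
      ≡.trans (≡.cong (part μ (toℕ j) ℕ.+_) (∸-toℕ j)) (ℕ.+-suc (part μ (toℕ j)) (n ℕ.∸ suc (toℕ j)))

    exponent-fromℕ : ∀ μ → exponent μ (suc n) (fromℕ n) ≡ part μ n
    exponent-fromℕ μ rewrite Fin.toℕ-fromℕ n =
      ≡.trans (≡.cong (part μ n ℕ.+_) (ℕ.n∸n≡0 n)) (ℕ.+-identityʳ _)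

    last-row-inject₁ : ∀ μ j → specializedMatrix μ (fromℕ n) (inject₁ j) ≃ con ℚ[a].0#
    last-row-inject₁ μ j rewrite exponent-inject₁ μ j =
      power-vanishes _ _ (reflexive (▹-fromℕ var c))

    corner : ∀ μ r → part μ n ≡ r → specializedMatrix μ (fromℕ n) (fromℕ n) ≡ power (+ suc n) r (x̂ (fromℕ n))
    corner μ r e = ≡.cong (λ k → power (+ suc n) k (x̂ (fromℕ n))) (≡.trans (exponent-fromℕ μ) e)

    specialize-det-short : ∀ μ → ℓ μ ℕ.≤ n →
      det (specializedMatrix μ) ≃ product linear ⊗ det (schurMatrix μ n)
    specialize-det-short μ ℓ≤n = begin
      det (specializedMatrix μ)
        ≈⟨ det-last-row (specializedMatrix μ) (last-row-inject₁ μ)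
             (reflexive (corner μ 0 (nth-beyond (parts μ) ℓ≤n))) ⟩
      det (λ i j → specializedMatrix μ (inject₁ i) (inject₁ j))
        ≈⟨ det-cong factor ⟩
      det (λ i j → linear i ⊗ schurMatrix μ n i j)
        ≈⟨ det-scale linear (schurMatrix μ n) ⟩
      product linear ⊗ det (schurMatrix μ n) ∎
      where
      factor : ∀ i j → specializedMatrix μ (inject₁ i) (inject₁ j) ≃ linear i ⊗ schurMatrix μ n i j
      factor i j rewrite exponent-inject₁ μ j | ▹-inject₁ var c i = ≃-refl

    specialize-det-exact : ∀ μ → ℓ μ ≡ suc n → det (specializedMatrix μ) ≃ con ℚ[a].0#
    specialize-det-exact μ ℓ≡1+n = det-zero-row (fromℕ n) (specializedMatrix μ) row-vanishes
      where
      positive-part : ∃ λ r → part μ n ≡ suc r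
      positive-part = nth-positive (positive μ) (ℕ.≤-reflexive (≡.sym ℓ≡1+n))
      corner-vanishes : specializedMatrix μ (fromℕ n) (fromℕ n) ≃ con ℚ[a].0#
      corner-vanishes = ≃-trans (reflexive (corner μ _ (proj₂ positive-part)))
        (power-vanishes _ _ (reflexive (▹-fromℕ var c)))
      row-vanishes : ∀ j → specializedMatrix μ (fromℕ n) j ≃ con ℚ[a].0#
      row-vanishes j with Top.view j
      ... | Top.‵fromℕ     = corner-vanishes
      ... | Top.‵inject₁ i = last-row-inject₁ μ i

    schurPoly-stable : ∀ μ → specialize b (schurPoly μ (suc n)) ≃ schurPoly μ n
    schurPoly-stable μ with ℕ.<-cmp (ℓ μ) (suc n)
    ... | tri< (s≤s ℓ≤n) _ _ = regular-cancelˡ specialize-vandermonde-regular (begin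
      specialize b (vandermonde var) ⊗ specialize b (schurPoly μ (suc n))
        ≈⟨ subst-cong x̂ (schurPoly-exact μ (suc n) (ℕ.m≤n⇒m≤1+n ℓ≤n)) ⟨
      specialize b (det (schurMatrix μ (suc n)))
        ≈⟨ ≃-trans (specialize-det μ) (specialize-det-short μ ℓ≤n) ⟩
      product linear ⊗ det (schurMatrix μ n)
        ≈⟨ ⊗-cong ≃-refl (schurPoly-exact μ n ℓ≤n) ⟩
      product linear ⊗ (vandermonde var ⊗ schurPoly μ n)
        ≈⟨ ⊗-assoc _ _ _ ⟨
      product linear ⊗ vandermonde var ⊗ schurPoly μ n
        ≈⟨ ⊗-cong specialize-vandermonde ≃-refl ⟨
      specialize b (vandermonde var) ⊗ schurPoly μ n ∎)
    ... | tri≈ _ ℓ≡1+n _ = ≃-trans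
      (specialize-vandermonde-regular _ (begin
        specialize b (vandermonde var) ⊗ specialize b (schurPoly μ (suc n))
          ≈⟨ subst-cong x̂ (schurPoly-exact μ (suc n) (ℕ.≤-reflexive ℓ≡1+n)) ⟨
        specialize b (det (schurMatrix μ (suc n)))
          ≈⟨ ≃-trans (specialize-det μ) (specialize-det-exact μ ℓ≡1+n) ⟩
        con ℚ[a].0# ∎))
      (reflexive (≡.sym (schurPoly-zero μ n (ℕ.≤-reflexive (≡.sym ℓ≡1+n)))))
    ... | tri> _ _ 1+n<ℓ = reflexive (≡.trans
      (≡.cong (specialize b) (schurPoly-zero μ (suc n) 1+n<ℓ))
      (≡.sym (schurPoly-zero μ n (ℕ.<-trans (ℕ.n<1+n n) 1+n<ℓ))))

  s : Partition → ΛElement b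
  s μ = record
    { component = schurPoly μ
    ; symmetric = schurPoly-symmetric μ
    ; bounded   = ℕ.sum (parts μ) , schurPoly-degree μ
    ; stable    = λ n → schurPoly-stable n μ
    }

  e h : ℕ → ΛElement b
  e k = s (column k)
  h k = s (row k)

module _ {b : Sequence} where

  open ΛElement

  infixr 7 _·_
  _·_ : ℚ[a].Carrier → ΛElement b → ΛElement b
  c · P = record
    { component = λ n → con c ⊗ component P n
    ; symmetric = λ n σ → ⊗-cong ≃-refl (symmetric P n σ)
    ; bounded   = let (d , p) = bounded P in d , λ n → deg-⊗ deg-con (p n) ℕ.≤-refl
    ; stable    = λ n → ⊗-cong ≃-refl (stable P n)
    }

{-# OPTIONS --safe #-}
-- Fix m ≥ λ₁, the number of variables on the side of a′, and consider the m × m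
-- determinant with entries L(z^i q_{r_j}(z)), where r_j = λ′_j + m - j, q_r(z) is
-- (z‖a′)^r in m variables, and L is the linear functional with L(q_r) = 0 for
-- r < m - 1 and L(q_{m-1+k}) = c_k, c_0 = 1.  Its entries are linear in the c_k with
-- coefficients in ℚ[a], so ω_a maps its value at c_k = e_k(x‖a) to its value at
-- c_k = h_k(x‖a′).  The theorem follows by identifying both values.
-- For c_k = h_k(y_1, …, y_m‖a′) the functional is L(f) = ∑_l f(y_l) / ∏_{k≠l} (y_l - y_k)
-- and the matrix is a product whose determinant is the alternant of s_{λ′}(y‖a′)
-- divided by the Vandermonde determinant.
-- For c_k = e_k(x_1, …, x_n‖a) the determinant is, up to signs, a maximal minor of the
-- coefficients of z^i ∏_l (z - x_l), 0 ≤ i < m, in the basis p_κ(z) = (z‖a)^κ,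
-- κ < n + m.  These rows are orthogonal to the rows (p_κ(x_l))_κ, whose maximal minors
-- are the alternants of the s_λ(x‖a), and complementary maximal minors of
-- orthogonal matrices are proportional.
module Submission where

open import Defs using (module Determinant; adjacent; lift; transpose-odd; countAbove; countAbove-accept; countAbove-reject; ∸-toℕ)
open import Algebra.Bundles using (CommutativeRing)
open import Algebra.Morphism.Structures using (module RingMorphisms)
import Algebra.Properties.AbelianGroup as AbelianGroupProperties
import Algebra.Properties.CommutativeSemigroup as CommutativeSemigroupProperties
import Algebra.Properties.Ring as RingProperties
import Algebra.Properties.Semiring.Sum as SemiringSum
import Algebra.Solver.Ring.NaturalCoefficients.Default as Solver
open import Data.Fin.Base as Fin using (Fin; zero; suc; toℕ; fromℕ; fromℕ<; inject₁; punchIn; punchOut; _↑ˡ_; _↑ʳ_)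
import Data.Fin.Permutation as Perm
import Data.Fin.Permutation.Components as PC
import Data.Fin.Properties as Fin
open import Data.Integer.Base as ℤ using (ℤ; +_; 1ℤ)
import Data.Integer.Properties as ℤ
open import Data.Integer.Solver using (module +-*-Solver)
open import Data.List.Base using ([]; _∷_; applyUpTo; length; replicate)
import Data.List.Properties as List
open import Data.List.Relation.Unary.Linked using (Linked; []; [-]; _∷_)
open import Data.Nat.Base as ℕ using (ℕ; zero; suc; z≤n; s≤s; _≤_)
import Data.Nat.Properties as ℕ
open import Data.Product.Base using (∃; ∃₂; _×_; _,_)
open import Data.Sum.Base using (_⊎_; inj₁; inj₂)
import Data.Vec.Functional as Vector
import Data.Vec.Functional.Properties as Vector
open import Function.Base using (_∘_)
open import Level using (Level)
open import Relation.Binary.PropositionalEquality as ≡ using (_≡_; _≢_)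
import Relation.Binary.Reasoning.Setoid as SetoidReasoning
open import Relation.Nullary using (yes; no; contradiction)

-- Determinants

module LinearAlgebra {c ℓ : Level} (R : CommutativeRing c ℓ)
  (halve : ∀ {x} → CommutativeRing._≈_ R x (CommutativeRing.-_ R x) → CommutativeRing._≈_ R x (CommutativeRing.0# R)) where

  open CommutativeRing R hiding (zero)
  open Determinant R
  open SemiringSum semiring
  open RingProperties ring using (-‿distribˡ-*)
  open CommutativeSemigroupProperties *-commutativeSemigroup using (x∙yz≈y∙xz)
  open Solver commutativeSemiring using (solve; _:=_; _:*_)
  open SetoidReasoning setoid

  sum-zero : ∀ {n} {t : Fin n → Carrier} → (∀ i → t i ≈ 0#) → sum t ≈ 0#
  sum-zero {n} e = trans (sum-cong-≋ e) (sum-replicate-zero n)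

  sum-↑ : ∀ n {m} (t : Fin (n ℕ.+ m) → Carrier) → sum t ≈ sum (λ i → t (i ↑ˡ m)) + sum (λ j → t (n ↑ʳ j))
  sum-↑ zero    t = sym (+-identityˡ _)
  sum-↑ (suc n) t = trans (+-cong refl (sum-↑ n (t ∘ suc))) (sym (+-assoc _ _ _))

  δ : ∀ {n} → Fin n → Fin n → Carrier
  δ zero    zero    = 1#
  δ zero    (suc j) = 0#
  δ (suc i) zero    = 0#
  δ (suc i) (suc j) = δ i j

  δ-refl : ∀ {n} (i : Fin n) → δ i i ≈ 1#
  δ-refl zero    = refl
  δ-refl (suc i) = δ-refl i

  δ-≢ : ∀ {n} {i j : Fin n} → i ≢ j → δ i j ≈ 0#
  δ-≢ {i = zero}  {zero}  i≢j = contradiction ≡.refl i≢j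
  δ-≢ {i = zero}  {suc j} i≢j = refl
  δ-≢ {i = suc i} {zero}  i≢j = refl
  δ-≢ {i = suc i} {suc j} i≢j = δ-≢ (i≢j ∘ ≡.cong suc)

  δ-sym : ∀ {n} (i j : Fin n) → δ i j ≡ δ j i
  δ-sym zero    zero    = ≡.refl
  δ-sym zero    (suc j) = ≡.refl
  δ-sym (suc i) zero    = ≡.refl
  δ-sym (suc i) (suc j) = δ-sym i j

  sum-δ : ∀ {n} (i : Fin n) (t : Fin n → Carrier) → sum (λ j → δ i j * t j) ≈ t i
  sum-δ {suc n} zero t = trans (+-cong (*-identityˡ _) (sum-zero {n} λ j → zeroˡ (t (suc j)))) (+-identityʳ _)
  sum-δ (suc i)      t = trans (+-cong (zeroˡ _) (sum-δ i (t ∘ suc))) (+-identityˡ _)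

  sum-δʳ : ∀ {n} (i : Fin n) (t : Fin n → Carrier) → sum (λ j → t j * δ j i) ≈ t i
  sum-δʳ i t = trans (sum-cong-≋ λ j → trans (*-comm _ _) (*-cong (reflexive (δ-sym j i)) refl)) (sum-δ i t)

  infixl 7 _⊡_
  _⊡_ : ∀ {n} → Matrix n → Matrix n → Matrix n
  (A ⊡ B) i j = sum (λ k → A i k * B k j)

  _ᵀ : ∀ {n} → Matrix n → Matrix n
  (M ᵀ) i j = M j i

  submatrix : ∀ {n} → Fin (suc n) → Fin (suc n) → Matrix (suc n) → Matrix n
  submatrix i j M r c = M (punchIn i r) (punchIn j c)

  -- `det` is defined by expansion along the first column. Expanding each `minor (suc i) M` along
  -- its first row gives a double sum in which rows and columns play symmetric roles, and exchanging
  -- the summations gives the other expansion. The term of the corner entry is common to both.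
  det-first-row : ∀ {n} (M : Matrix (suc n)) →
    det M ≈ ∑[ j < suc n ] (sign j * (M zero j * det (submatrix zero j M)))
  det-first-row {zero}  M = refl
  det-first-row {suc n} M = +-cong refl (begin
    sum (λ i → - sign i * (A i * det (minor (suc i) M)))
      ≈⟨ sum-cong-≋ (λ i → *-cong (refl { - sign i}) (*-cong (refl {A i}) (det-first-row (minor (suc i) M)))) ⟩
    sum (λ i → - sign i * (A i * sum (λ j → sign j * (B j * Z i j))))
      ≈⟨ sum-cong-≋ (λ i → inside (- sign i) (A i) (λ j → sign j * (B j * Z i j))) ⟩
    sum (λ i → sum (λ j → - sign i * (A i * (sign j * (B j * Z i j)))))
      ≈⟨ ∑-comm (λ i j → - sign i * (A i * (sign j * (B j * Z i j)))) ⟩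
    sum (λ j → sum (λ i → - sign i * (A i * (sign j * (B j * Z i j)))))
      ≈⟨ sum-cong-≋ (λ j → sum-cong-≋ λ i → exchange (sign i) (A i) (sign j) (B j) (Z i j)) ⟩
    sum (λ j → sum (λ i → - sign j * (B j * (sign i * (A i * Z i j)))))
      ≈⟨ sum-cong-≋ (λ j → inside (- sign j) (B j) (λ i → sign i * (A i * Z i j))) ⟨
    sum (λ j → - sign j * (B j * sum (λ i → sign i * (A i * Z i j)))) ∎)
    where
    A B : Fin (suc n) → Carrier
    A i = M (suc i) zero
    B j = M zero (suc j)
    Z : Fin (suc n) → Fin (suc n) → Carrier
    Z i j = det (λ r c → M (suc (punchIn i r)) (suc (punchIn j c)))
    inside : ∀ {p} x y (t : Fin p → Carrier) → x * (y * sum t) ≈ sum (λ i → x * (y * t i))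
    inside x y t = trans (*-cong refl (*-distribˡ-sum y t)) (*-distribˡ-sum x (λ i → y * t i))
    exchange : ∀ s a s′ b z → - s * (a * (s′ * (b * z))) ≈ - s′ * (b * (s * (a * z)))
    exchange s a s′ b z = begin
      - s * (a * (s′ * (b * z)))    ≈⟨ -‿distribˡ-* _ _ ⟨
      - (s * (a * (s′ * (b * z))))
        ≈⟨ -‿cong (solve 5 (λ s a s′ b z → s :* (a :* (s′ :* (b :* z))) := s′ :* (b :* (s :* (a :* z)))) refl s a s′ b z) ⟩
      - (s′ * (b * (s * (a * z))))  ≈⟨ -‿distribˡ-* _ _ ⟩
      - s′ * (b * (s * (a * z)))    ∎

  det-ᵀ : ∀ {n} (M : Matrix n) → det (M ᵀ) ≈ det M
  det-ᵀ {zero}  M = refl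
  det-ᵀ {suc n} M = trans
    (sum-cong-≋ {suc n} λ i → *-cong (refl {sign i}) (*-cong (refl {M zero i}) (det-ᵀ (submatrix zero i M))))
    (sym (det-first-row M))

  det-rows : ∀ {n} (M : Matrix n) (f g : Fin n → Fin n) → (∀ r → f r ≡ g r) → det (M ∘ f) ≈ det (M ∘ g)
  det-rows M f g e = det-cong {M = M ∘ f} {N = M ∘ g} λ r c → reflexive (≡.cong (λ i → M i c) (e r))

  det-scale-columns : ∀ {n} (a : Fin n → Carrier) (M : Matrix n) →
                      det (λ r c → a c * M r c) ≈ product a * det M
  det-scale-columns a M = begin
    det (λ r c → a c * M r c)  ≈⟨ det-ᵀ (λ r c → a c * M r c) ⟨
    det (λ r c → a r * M c r)  ≈⟨ det-scale a (M ᵀ) ⟩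
    product a * det (M ᵀ)      ≈⟨ *-cong refl (det-ᵀ M) ⟩
    product a * det M          ∎

  -- The first-row expansion reduces multilinearity to `k = zero`, where the row occurs linearly,
  -- and to the minors, in which the row has moved up by one.
  det-row-linear : ∀ {n p} (k : Fin n) (M : Matrix n) (N : Fin p → Matrix n) (x : Fin p → Carrier) →
    (∀ l r j → r ≢ k → N l r j ≈ M r j) → (∀ j → M k j ≈ sum (λ l → x l * N l k j)) →
    det M ≈ sum (λ l → x l * det (N l))
  det-row-linear {suc n} {p} k M N x same combination = begin
    det M
      ≈⟨ det-first-row M ⟩
    sum (λ j → sign j * (M zero j * det (submatrix zero j M)))
      ≈⟨ sum-cong-≋ (λ j → trans (*-cong refl (expand k j same combination)) (*-distribˡ-sum (sign j) (λ l → x l * T l j))) ⟩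
    sum (λ j → sum (λ l → sign j * (x l * T l j)))
      ≈⟨ ∑-comm (λ j l → sign j * (x l * T l j)) ⟩
    sum (λ l → sum (λ j → sign j * (x l * T l j)))
      ≈⟨ sum-cong-≋ (λ l → trans (sum-cong-≋ λ j → x∙yz≈y∙xz (sign j) (x l) (T l j))
           (trans (sym (*-distribˡ-sum (x l) (λ j → sign j * T l j))) (*-cong refl (sym (det-first-row (N l)))))) ⟩
    sum (λ l → x l * det (N l)) ∎
    where
    T : Fin p → Fin (suc n) → Carrier
    T l j = N l zero j * det (submatrix zero j (N l))
    expand : ∀ k j → (∀ l r j → r ≢ k → N l r j ≈ M r j) → (∀ j → M k j ≈ sum (λ l → x l * N l k j)) →
             M zero j * det (submatrix zero j M) ≈ sum (λ l → x l * T l j)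
    expand zero j same combination = begin
      M zero j * det (submatrix zero j M)
        ≈⟨ *-cong (combination j) refl ⟩
      sum (λ l → x l * N l zero j) * det (submatrix zero j M)
        ≈⟨ *-distribʳ-sum (det (submatrix zero j M)) (λ l → x l * N l zero j) ⟩
      sum (λ l → x l * N l zero j * det (submatrix zero j M))
        ≈⟨ sum-cong-≋ (λ l → trans (*-assoc _ _ _) (*-cong refl (*-cong refl
             (det-cong λ r c → sym (same l (suc r) (punchIn j c) λ ()))))) ⟩
      sum (λ l → x l * T l j) ∎
    expand (suc k) j same combination = begin
      M zero j * det (submatrix zero j M)
        ≈⟨ *-cong refl (det-row-linear k (submatrix zero j M) (λ l → submatrix zero j (N l)) x
             (λ l r c r≢k → same l (suc r) (punchIn j c) (r≢k ∘ Fin.suc-injective))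
             (λ c → combination (punchIn j c))) ⟩
      M zero j * sum (λ l → x l * det (submatrix zero j (N l)))
        ≈⟨ *-distribˡ-sum (M zero j) (λ l → x l * det (submatrix zero j (N l))) ⟩
      sum (λ l → M zero j * (x l * det (submatrix zero j (N l))))
        ≈⟨ sum-cong-≋ (λ l → trans (x∙yz≈y∙xz _ _ _) (*-cong refl (*-cong (sym (same l zero j λ ())) refl))) ⟩
      sum (λ l → x l * T l j) ∎

  -- Swapping the two rows changes nothing and also negates the determinant, so `halve` applies.
  det-equal-rows : ∀ {n} (M : Matrix n) {i j : Fin n} → i ≢ j → (∀ c → M i c ≈ M j c) → det M ≈ 0#
  det-equal-rows M {i} {j} i≢j e = halve (begin
    det M                         ≈⟨ det-cong (λ r c → sym (same r c)) ⟩
    det (M ∘ PC.transpose i j)    ≈⟨ det-odd (transpose-odd i j i≢j) M ⟩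
    - det M                       ∎)
    where
    same : ∀ r c → M (PC.transpose i j r) c ≈ M r c
    same r c with r Fin.≟ i
    ... | yes ≡.refl = sym (e c)
    ... | no _ with r Fin.≟ j
    ...   | yes ≡.refl = e c
    ...   | no _       = refl

  det-first-column : ∀ {n} (M : Matrix (suc n)) → (∀ i → M (suc i) zero ≈ 0#) →
                     det M ≈ M zero zero * det (minor zero M)
  det-first-column {n} M z = trans
    (+-cong (*-identityˡ _) (sum-zero {n} λ i →
      trans (*-cong (refl {sign (suc i)}) (trans (*-cong (z i) (refl {det (minor (suc i) M)})) (zeroˡ _))) (zeroʳ _)))
    (+-identityʳ _)

  det-unitriangular : ∀ {n} (M : Matrix n) → (∀ r c → c Fin.< r → M r c ≈ 0#) → (∀ r → M r r ≈ 1#) → det M ≈ 1#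
  det-unitriangular {zero}  M z o = refl
  det-unitriangular {suc n} M z o = begin
    det M                            ≈⟨ det-first-column M (λ i → z (suc i) zero (s≤s z≤n)) ⟩
    M zero zero * det (minor zero M) ≈⟨ *-cong (o zero) (det-unitriangular (minor zero M)
                                          (λ r c c<r → z (suc r) (suc c) (s≤s c<r)) (λ r → o (suc r))) ⟩
    1# * 1#                          ≈⟨ *-identityˡ 1# ⟩
    1#                               ∎

  det-δ : ∀ n → det (δ {n}) ≈ 1#
  det-δ n = det-unitriangular (δ {n}) (λ r c c<r → δ-≢ λ r≡c → ℕ.<⇒≢ c<r (≡.cong toℕ (≡.sym r≡c))) δ-refl

  punchIn-↑ˡ : ∀ {n} (i : Fin (suc n)) (r : Fin n) m → punchIn (i ↑ˡ m) (r ↑ˡ m) ≡ punchIn i r ↑ˡ m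
  punchIn-↑ˡ zero    r       m = ≡.refl
  punchIn-↑ˡ (suc i) zero    m = ≡.refl
  punchIn-↑ˡ (suc i) (suc r) m = ≡.cong suc (punchIn-↑ˡ i r m)

  punchIn-↑ʳ : ∀ {n} (i : Fin (suc n)) {m} (j : Fin m) → punchIn (i ↑ˡ m) (n ↑ʳ j) ≡ suc n ↑ʳ j
  punchIn-↑ʳ {n}     zero    j = ≡.refl
  punchIn-↑ʳ {suc n} (suc i) j = ≡.cong suc (punchIn-↑ʳ i j)

  sign-↑ˡ : ∀ {n} (i : Fin n) m → sign (i ↑ˡ m) ≡ sign i
  sign-↑ˡ zero    m = ≡.refl
  sign-↑ˡ (suc i) m = ≡.cong -_ (sign-↑ˡ i m)

  -- Only the upper rows contribute to the first-column expansion, and their minors keep the block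
  -- shape with the same lower right block.
  det-block : ∀ n {m} (M : Matrix (n ℕ.+ m)) → (∀ (i : Fin m) (j : Fin n) → M (n ↑ʳ i) (j ↑ˡ m) ≈ 0#) →
    det M ≈ det {n} (λ r c → M (r ↑ˡ m) (c ↑ˡ m)) * det {m} (λ r c → M (n ↑ʳ r) (n ↑ʳ c))
  det-block zero    M z = sym (*-identityˡ _)
  det-block (suc n) {m} M z = begin
    det M
      ≈⟨ sum-↑ (suc n) term ⟩
    sum (λ i → term (i ↑ˡ m)) + sum (λ j → term (suc n ↑ʳ j))
      ≈⟨ +-cong (sum-cong-≋ upper) (sum-zero λ j →
           trans (*-cong refl (trans (*-cong (z j zero) refl) (zeroˡ _))) (zeroʳ _)) ⟩
    sum (λ i → termA i * D) + 0#
      ≈⟨ +-identityʳ _ ⟩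
    sum (λ i → termA i * D)
      ≈⟨ *-distribʳ-sum D termA ⟨
    det A * D ∎
    where
    A : Matrix (suc n)
    A r c = M (r ↑ˡ m) (c ↑ˡ m)
    D = det {m} (λ r c → M (suc n ↑ʳ r) (suc n ↑ʳ c))
    term : Fin (suc n ℕ.+ m) → Carrier
    term i = sign i * (M i zero * det (minor i M))
    termA : Fin (suc n) → Carrier
    termA i = sign i * (A i zero * det (minor i A))
    entry : ∀ {i i′} c → i ≡ i′ → M i c ≈ M i′ c
    entry c ≡.refl = refl
    upper : ∀ i → term (i ↑ˡ m) ≈ termA i * D
    upper i = begin
      sign (i ↑ˡ m) * (M (i ↑ˡ m) zero * det (minor (i ↑ˡ m) M))
        ≈⟨ *-cong (reflexive (sign-↑ˡ i m)) (*-cong refl (trans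
             (det-block n (minor (i ↑ˡ m) M) λ r c → trans (entry _ (punchIn-↑ʳ i r)) (z r (suc c)))
             (*-cong (det-cong λ r c → entry _ (punchIn-↑ˡ i r m)) (det-cong λ r c → entry _ (punchIn-↑ʳ i r))))) ⟩
      sign i * (A i zero * (det (minor i A) * D))
        ≈⟨ trans (*-cong refl (sym (*-assoc _ _ _))) (sym (*-assoc _ _ _)) ⟩
      termA i * D ∎

  -- The sign of a permutation, encoded by its effect on all determinants.
  RowSign : ∀ {n} → (Fin n → Fin n) → Carrier → Set _
  RowSign {n} f ε = (M : Matrix n) → det (M ∘ f) ≈ ε * det M

  rowSign-lift : ∀ {n} {f : Fin n → Fin n} {ε} → RowSign f ε → RowSign (lift f) ε
  rowSign-lift {n} {f} {ε} s M = begin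
    det (M ∘ lift f)
      ≈⟨ det-first-row (M ∘ lift f) ⟩
    sum (λ j → sign j * (M zero j * det (submatrix zero j M ∘ f)))
      ≈⟨ sum-cong-≋ (λ j → trans (*-cong refl (*-cong refl (s (submatrix zero j M))))
           (solve 4 (λ p q e d → p :* (q :* (e :* d)) := e :* (p :* (q :* d))) refl
             (sign j) (M zero j) ε (det (submatrix zero j M)))) ⟩
    sum (λ j → ε * (sign j * (M zero j * det (submatrix zero j M))))
      ≈⟨ *-distribˡ-sum ε (λ j → sign j * (M zero j * det (submatrix zero j M))) ⟨
    ε * sum (λ j → sign j * (M zero j * det (submatrix zero j M)))
      ≈⟨ *-cong refl (det-first-row M) ⟨
    ε * det M ∎

  -- The cycle that moves row `k` to the front and keeps the order of the others.
  raise : ∀ {n} → Fin (suc n) → Fin (suc n) → Fin (suc n)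
  raise k zero    = k
  raise k (suc r) = punchIn k r

  rowSign-raise : ∀ {n} (k : Fin (suc n)) → RowSign (raise k) (sign k)
  rowSign-raise {n} zero M = trans (det-rows M (raise zero) (λ r → r) λ { zero → ≡.refl ; (suc r) → ≡.refl }) (sym (*-identityˡ _))
  rowSign-raise {suc n} (suc k) M = begin
    det (M ∘ raise (suc k))
      -- The cycle is one swap of the first two positions combined with a shorter cycle on the lower
      -- rows; each swap contributes one sign.
      ≈⟨ det-rows M (raise (suc k)) (lift (raise k) ∘ adjacent zero)
           (λ { zero → ≡.refl ; (suc zero) → ≡.refl ; (suc (suc r)) → ≡.refl }) ⟩
    det (M ∘ lift (raise k) ∘ adjacent zero)
      ≈⟨ det-adjacent zero (M ∘ lift (raise k)) ⟩
    - det (M ∘ lift (raise k))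
      ≈⟨ -‿cong (rowSign-lift {f = raise k} (rowSign-raise k) M) ⟩
    - (sign k * det M)
      ≈⟨ -‿distribˡ-* _ _ ⟩
    - sign k * det M ∎

  rowSign-insert : ∀ {n} (k : Fin (suc n)) {g : Fin n → Fin n} {ε} {f : Fin (suc n) → Fin (suc n)} →
    f zero ≡ k → (∀ r → f (suc r) ≡ punchIn k (g r)) → RowSign g ε → RowSign f (sign k * ε)
  rowSign-insert {n} k {g} {ε} {f} f₀ f₊ s M = begin
    det (M ∘ f)
      ≈⟨ det-rows M f (raise k ∘ lift g) (λ { zero → f₀ ; (suc r) → f₊ r }) ⟩
    det (M ∘ raise k ∘ lift g)  ≈⟨ rowSign-lift {f = g} s (M ∘ raise k) ⟩
    ε * det (M ∘ raise k)       ≈⟨ *-cong refl (rowSign-raise k M) ⟩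
    ε * (sign k * det M)        ≈⟨ x∙yz≈y∙xz _ _ _ ⟩
    sign k * (ε * det M)        ≈⟨ *-assoc _ _ _ ⟨
    sign k * ε * det M          ∎

  -- If the value `f zero` is not taken again, punching it out leaves a self-map of a smaller set,
  -- from which `f` arises by an insertion of known sign.
  collision⊎rowSign : ∀ {n} (f : Fin n → Fin n) →
    (∃₂ λ i j → i ≢ j × f i ≡ f j) ⊎ ∃ (RowSign f)
  collision⊎rowSign {zero}  f = inj₂ (1# , λ M → sym (*-identityˡ _))
  collision⊎rowSign {suc n} f with Fin.any? (λ r → f zero Fin.≟ f (suc r))
  ... | yes (r , e) = inj₁ (zero , suc r , (λ ()) , e)
  ... | no distinct with collision⊎rowSign (λ r → punchOut {i = f zero} {j = f (suc r)} (distinct ∘ (r ,_)))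
  ...   | inj₁ (i , j , i≢j , e) =
    inj₁ (suc i , suc j , i≢j ∘ Fin.suc-injective , Fin.punchOut-injective (distinct ∘ (i ,_)) (distinct ∘ (j ,_)) e)
  ...   | inj₂ (ε , s) = inj₂ (sign (f zero) * ε ,
    rowSign-insert (f zero) {f = f} ≡.refl (λ r → ≡.sym (Fin.punchIn-punchOut (distinct ∘ (r ,_)))) s)

  -- The product rule for a left factor made of unit rows: a collision makes both sides vanish, and
  -- otherwise both determinants carry the same sign.
  det-rearrange : ∀ {n} (f : Fin n → Fin n) (M : Matrix n) → det (M ∘ f) ≈ det (δ ∘ f) * det M
  det-rearrange {n} f M with collision⊎rowSign f
  ... | inj₁ (i , j , i≢j , e) = begin
    det (M ∘ f)          ≈⟨ det-equal-rows (M ∘ f) i≢j (λ c → reflexive (≡.cong (λ k → M k c) e)) ⟩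
    0#                   ≈⟨ zeroˡ _ ⟨
    0# * det M           ≈⟨ *-cong (det-equal-rows (δ ∘ f) i≢j (λ c → reflexive (≡.cong (λ k → δ k c) e))) refl ⟨
    det (δ ∘ f) * det M  ∎
  ... | inj₂ (ε , s) = begin
    det (M ∘ f)          ≈⟨ s M ⟩
    ε * det M            ≈⟨ *-cong (trans (*-cong (refl {ε}) (det-δ n)) (*-identityʳ ε)) refl ⟨
    ε * det (δ {n}) * det M ≈⟨ *-cong (s δ) refl ⟨
    det (δ ∘ f) * det M  ∎

  det-⊡ : ∀ {n} (A B : Matrix n) → det (A ⊡ B) ≈ det A * det B
  det-⊡ {n} A B = go n A λ r n≤r → contradiction (Fin.toℕ<n r) (ℕ.≤⇒≯ n≤r)
    where
    setRow : Fin n → Fin n → Matrix n → Matrix n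
    setRow k l A r with r Fin.≟ k
    ... | yes _ = δ l
    ... | no  _ = A r
    setRow-same : ∀ k l A → setRow k l A k ≡ δ l
    setRow-same k l A with k Fin.≟ k
    ... | yes _  = ≡.refl
    ... | no k≢k = contradiction ≡.refl k≢k
    setRow-other : ∀ k l A {r} → r ≢ k → setRow k l A r ≡ A r
    setRow-other k l A {r} r≢k with r Fin.≟ k
    ... | yes r≡k = contradiction r≡k r≢k
    ... | no _    = ≡.refl

    -- Induction on the number t of leading rows not yet replaced by unit rows.
    go : ∀ t A → (∀ r → t ℕ.≤ toℕ r → ∃ λ l → A r ≡ δ l) → det (A ⊡ B) ≈ det A * det B
    go zero A unit = begin
      det (A ⊡ B)          ≈⟨ det-cong (λ r c → trans (sum-cong-≋ λ k → *-cong (reflexive (row r k)) refl)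
                                                      (sum-δ (f r) (λ k → B k c))) ⟩
      det (B ∘ f)          ≈⟨ det-rearrange f B ⟩
      det (δ ∘ f) * det B  ≈⟨ *-cong (det-cong λ r c → reflexive (row r c)) refl ⟨
      det A * det B        ∎
      where
      f : Fin n → Fin n
      f r = let (l , _) = unit r z≤n in l
      row : ∀ r c → A r c ≡ δ (f r) c
      row r c = let (_ , e) = unit r z≤n in ≡.cong (λ v → v c) e
    go (suc t) A unit with t ℕ.<? n
    ... | no t≮n = go t A λ r t≤r → contradiction (ℕ.≤-<-trans t≤r (Fin.toℕ<n r)) t≮n
    ... | yes t<n = begin
      det (A ⊡ B)
        -- Row `k`, which has number `t`, is the combination of the unit rows with coefficients
        -- `A k l`. Linearity is applied first to the product and then, in reverse, to `A` alone.
        ≈⟨ det-row-linear k (A ⊡ B) (λ l → setRow k l A ⊡ B) (A k)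
             (λ l r j r≢k → sum-cong-≋ λ i → *-cong (reflexive (≡.cong (λ v → v i) (setRow-other k l A r≢k))) refl)
             (λ j → sum-cong-≋ λ l → *-cong refl (sym (trans
               (sum-cong-≋ λ i → *-cong (reflexive (≡.cong (λ v → v i) (setRow-same k l A))) refl)
               (sum-δ l (λ i → B i j))))) ⟩
      sum (λ l → A k l * det (setRow k l A ⊡ B))
        ≈⟨ sum-cong-≋ (λ l → trans (*-cong refl (go t (setRow k l A) (unit′ l))) (sym (*-assoc _ _ _))) ⟩
      sum (λ l → A k l * det (setRow k l A) * det B)
        ≈⟨ *-distribʳ-sum (det B) (λ l → A k l * det (setRow k l A)) ⟨
      sum (λ l → A k l * det (setRow k l A)) * det B
        ≈⟨ *-cong (det-row-linear k A (λ l → setRow k l A) (A k)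
             (λ l r j r≢k → reflexive (≡.cong (λ v → v j) (setRow-other k l A r≢k)))
             (λ j → sym (trans (sum-cong-≋ λ l → *-cong refl (reflexive (≡.cong (λ v → v j) (setRow-same k l A))))
                               (sum-δʳ j (A k))))) refl ⟨
      det A * det B ∎
      where
      k = fromℕ< t<n
      unit′ : ∀ l r → t ℕ.≤ toℕ r → ∃ λ l′ → setRow k l A r ≡ δ l′
      unit′ l r t≤r with r Fin.≟ k
      ... | yes _  = l , ≡.refl
      ... | no r≢k = unit r (ℕ.≤∧≢⇒< t≤r λ t≡r → r≢k (Fin.toℕ-injective (≡.sym (≡.trans (Fin.toℕ-fromℕ< t<n) t≡r))))

-- Complementary minors

toℕ-punchIn-< : ∀ {n} (k : Fin (suc n)) (r : Fin n) → toℕ r ℕ.< toℕ k → toℕ (punchIn k r) ≡ toℕ r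
toℕ-punchIn-< (suc k) zero    _         = ≡.refl
toℕ-punchIn-< (suc k) (suc r) (s≤s r<k) = ≡.cong suc (toℕ-punchIn-< k r r<k)

toℕ-punchIn-≥ : ∀ {n} (k : Fin (suc n)) (r : Fin n) → toℕ k ℕ.≤ toℕ r → toℕ (punchIn k r) ≡ suc (toℕ r)
toℕ-punchIn-≥ zero    r       _         = ≡.refl
toℕ-punchIn-≥ (suc k) (suc r) (s≤s k≤r) = ≡.cong suc (toℕ-punchIn-≥ k r k≤r)

countAbove-applyUpTo-zero : ∀ ν n {j} → (∀ i → ν i ℕ.≤ j) → countAbove (applyUpTo ν n) j ≡ 0
countAbove-applyUpTo-zero ν zero    _ = ≡.refl
countAbove-applyUpTo-zero ν (suc n) b = ≡.trans
  (countAbove-reject (applyUpTo (ν ∘ suc) n) (ℕ.≤⇒≯ (b 0)))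
  (countAbove-applyUpTo-zero (ν ∘ suc) n (b ∘ suc))

antitone-≤ : ∀ {ν : ℕ → ℕ} → (∀ i → ν (suc i) ℕ.≤ ν i) → ∀ i → ν i ℕ.≤ ν 0
antitone-≤ d zero    = ℕ.≤-refl
antitone-≤ d (suc i) = ℕ.≤-trans (d i) (antitone-≤ d i)

exponents : (ℕ → ℕ) → (n : ℕ) → Fin n → ℕ
exponents ν n j = ν (toℕ j) ℕ.+ (n ℕ.∸ suc (toℕ j))

-- For a partition ν inside the n × m rectangle, the first n values of the
-- shuffle are ν_i + n - i and the last m values are the complementary numbers
-- n - 1 + j - ν′_j.
module _ {m : ℕ} where

  shuffle : ∀ n (ν : ℕ → ℕ) → (∀ i → ν i ℕ.≤ m) → Fin (n ℕ.+ m) → Fin (n ℕ.+ m)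
  shuffle zero    ν b r       = r
  shuffle (suc n) ν b zero    = fromℕ< (s≤s (ℕ.+-monoʳ-≤ n (b 0)))
  shuffle (suc n) ν b (suc r) = punchIn (shuffle (suc n) ν b zero) (shuffle n (ν ∘ suc) (b ∘ suc) r)

  toℕ-shuffle-zero : ∀ n ν b → toℕ (shuffle (suc n) ν b zero) ≡ n ℕ.+ ν 0
  toℕ-shuffle-zero n ν b = Fin.toℕ-fromℕ< (s≤s (ℕ.+-monoʳ-≤ n (b 0)))

  -- Later parts are no larger, so the later values lie below the inserted value n + ν₀ and
  -- `punchIn` does not move them.
  toℕ-shuffle-↑ˡ : ∀ n {ν} b → (∀ i → ν (suc i) ℕ.≤ ν i) →
    ∀ i → toℕ (shuffle n ν b (i ↑ˡ m)) ≡ exponents ν n i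
  toℕ-shuffle-↑ˡ (suc n) {ν} b d zero    = ≡.trans (toℕ-shuffle-zero n ν b) (ℕ.+-comm n (ν 0))
  toℕ-shuffle-↑ˡ (suc n) {ν} b d (suc i) = ≡.trans (toℕ-punchIn-< _ _ below) value
    where
    open ℕ.≤-Reasoning
    value = toℕ-shuffle-↑ˡ n (b ∘ suc) (d ∘ suc) i
    below : toℕ (shuffle n (ν ∘ suc) (b ∘ suc) (i ↑ˡ m)) ℕ.< toℕ (shuffle (suc n) ν b zero)
    below = begin-strict
      toℕ (shuffle n (ν ∘ suc) (b ∘ suc) (i ↑ˡ m))  ≡⟨ value ⟩
      ν (suc (toℕ i)) ℕ.+ (n ℕ.∸ suc (toℕ i))       ≤⟨ ℕ.+-monoˡ-≤ _ (antitone-≤ d (suc (toℕ i))) ⟩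
      ν 0 ℕ.+ (n ℕ.∸ suc (toℕ i))
        <⟨ ℕ.+-monoʳ-< (ν 0) (ℕ.≤-trans (ℕ.≤-reflexive (≡.sym (∸-toℕ i))) (ℕ.m∸n≤m n (toℕ i))) ⟩
      ν 0 ℕ.+ n                                     ≡⟨ ℕ.+-comm (ν 0) n ⟩
      n ℕ.+ ν 0                                     ≡⟨ toℕ-shuffle-zero n ν b ⟨
      toℕ (shuffle (suc n) ν b zero)                ∎

  -- `countAbove` at j is ν′_{j+1}. If ν₀ exceeds j, it is counted and the recursive value stays
  -- below the inserted one; otherwise no part is counted and `punchIn` moves the value up by one.
  toℕ-shuffle-↑ʳ : ∀ n {ν} b → (∀ i → ν (suc i) ℕ.≤ ν i) → (j : Fin m) →
    toℕ (shuffle n ν b (n ↑ʳ j)) ℕ.+ countAbove (applyUpTo ν n) (toℕ j) ≡ n ℕ.+ toℕ j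
  toℕ-shuffle-↑ʳ zero    b d j = ℕ.+-identityʳ _
  toℕ-shuffle-↑ʳ (suc n) {ν} b d j with toℕ j ℕ.<? ν 0
  ... | yes j<ν₀ = begin
    toℕ (punchIn k s) ℕ.+ countAbove (applyUpTo ν (suc n)) (toℕ j)
      ≡⟨ ≡.cong₂ ℕ._+_ (toℕ-punchIn-< k s below) (countAbove-accept (applyUpTo (ν ∘ suc) n) j<ν₀) ⟩
    toℕ s ℕ.+ suc t  ≡⟨ ℕ.+-suc (toℕ s) t ⟩
    suc (toℕ s ℕ.+ t)  ≡⟨ ≡.cong suc value ⟩
    suc n ℕ.+ toℕ j ∎
    where
    open ≡.≡-Reasoning
    k = shuffle (suc n) ν b zero
    s = shuffle n (ν ∘ suc) (b ∘ suc) (n ↑ʳ j)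
    t = countAbove (applyUpTo (ν ∘ suc) n) (toℕ j)
    value : toℕ s ℕ.+ t ≡ n ℕ.+ toℕ j
    value = toℕ-shuffle-↑ʳ n (b ∘ suc) (d ∘ suc) j
    below : toℕ s ℕ.< toℕ k
    below = ℕ.≤-<-trans (ℕ.≤-trans (ℕ.m≤m+n _ t) (ℕ.≤-reflexive value))
      (ℕ.<-≤-trans (ℕ.+-monoʳ-< n j<ν₀) (ℕ.≤-reflexive (≡.sym (toℕ-shuffle-zero n ν b))))
  ... | no j≮ν₀ = begin
    toℕ (punchIn k s) ℕ.+ countAbove (applyUpTo ν (suc n)) (toℕ j)
      ≡⟨ ≡.cong₂ ℕ._+_ (toℕ-punchIn-≥ k s above) (countAbove-applyUpTo-zero ν (suc n) bounded) ⟩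
    suc (toℕ s) ℕ.+ 0  ≡⟨ ℕ.+-identityʳ _ ⟩
    suc (toℕ s)        ≡⟨ ≡.cong suc value ⟩
    suc n ℕ.+ toℕ j    ∎
    where
    open ≡.≡-Reasoning
    k = shuffle (suc n) ν b zero
    s = shuffle n (ν ∘ suc) (b ∘ suc) (n ↑ʳ j)
    bounded : ∀ i → ν i ℕ.≤ toℕ j
    bounded i = ℕ.≤-trans (antitone-≤ d i) (ℕ.≮⇒≥ j≮ν₀)
    value : toℕ s ≡ n ℕ.+ toℕ j
    value = ≡.trans (≡.sym (≡.trans
      (≡.cong (toℕ s ℕ.+_) (countAbove-applyUpTo-zero (ν ∘ suc) n (bounded ∘ suc))) (ℕ.+-identityʳ _)))
      (toℕ-shuffle-↑ʳ n (b ∘ suc) (d ∘ suc) j)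
    above : toℕ k ℕ.≤ toℕ s
    above = ≡.subst₂ ℕ._≤_ (≡.sym (toℕ-shuffle-zero n ν b)) (≡.sym value) (ℕ.+-monoʳ-≤ n (ℕ.≮⇒≥ j≮ν₀))

module ComplementaryMinors {c ℓ : Level} (R : CommutativeRing c ℓ)
  (halve : ∀ {x} → CommutativeRing._≈_ R x (CommutativeRing.-_ R x) → CommutativeRing._≈_ R x (CommutativeRing.0# R)) where

  open CommutativeRing R hiding (zero)
  open Determinant R
  open LinearAlgebra R halve
  open SemiringSum semiring
  open RingProperties ring using (-‿distribˡ-*; -‿distribʳ-*)
  open AbelianGroupProperties +-abelianGroup using () renaming (⁻¹-involutive to -‿involutive)
  open SetoidReasoning setoid

  sgn : ℕ → Carrier
  sgn zero    = 1#
  sgn (suc k) = - sgn k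

  sgn-toℕ : ∀ {n} (i : Fin n) → sgn (toℕ i) ≡ sign i
  sgn-toℕ zero    = ≡.refl
  sgn-toℕ (suc i) = ≡.cong -_ (sgn-toℕ i)

  -x*-y≈x*y : ∀ x y → - x * - y ≈ x * y
  -x*-y≈x*y x y = trans (sym (-‿distribˡ-* x (- y))) (trans (-‿cong (sym (-‿distribʳ-* x y))) (-‿involutive _))

  sgn-square : ∀ k → sgn k * sgn k ≈ 1#
  sgn-square zero    = *-identityˡ 1#
  sgn-square (suc k) = trans (-x*-y≈x*y (sgn k) (sgn k)) (sgn-square k)

  product-square : ∀ {n} (t : Fin n → Carrier) → (∀ i → t i * t i ≈ 1#) → product t * product t ≈ 1#
  product-square {zero}  t e = *-identityˡ 1#
  product-square {suc n} t e = trans (interchange (t zero) _ (t zero) _)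
    (trans (*-cong (e zero) (product-square (t ∘ suc) (e ∘ suc))) (*-identityˡ 1#))
    where open CommutativeSemigroupProperties *-commutativeSemigroup using (interchange)

  module _ {m : ℕ} where

    sum-shuffle : ∀ n ν b (t : Fin (n ℕ.+ m) → Carrier) → sum (t ∘ shuffle n ν b) ≈ sum t
    sum-shuffle zero    ν b t = refl
    sum-shuffle (suc n) ν b t = trans
      (+-cong refl (sum-shuffle n (ν ∘ suc) (b ∘ suc) (t ∘ punchIn (shuffle (suc n) ν b zero))))
      (sym (sum-remove t))

    -- The shuffle is a succession of insertions, each contributing the sign of the inserted value
    -- ν_i + n - i.
    rowSign-shuffle : ∀ n ν b → RowSign (shuffle {m} n ν b) (product (sgn ∘ exponents ν n))
    rowSign-shuffle zero    ν b M = sym (*-identityˡ _)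
    rowSign-shuffle (suc n) ν b M = trans
      (rowSign-insert (shuffle (suc n) ν b zero) {f = shuffle (suc n) ν b} ≡.refl (λ r → ≡.refl)
        (rowSign-shuffle n (ν ∘ suc) (b ∘ suc)) M)
      (*-cong (*-cong (reflexive head) refl) refl)
      where
      head : sign (shuffle {m} (suc n) ν b zero) ≡ sgn (ν 0 ℕ.+ n)
      head = ≡.trans (≡.sym (sgn-toℕ (shuffle (suc n) ν b zero)))
        (≡.cong sgn (≡.trans (toℕ-shuffle-zero n ν b) (ℕ.+-comm n (ν 0))))

    δ-↑ʳ : ∀ n (i j : Fin m) → δ (n ↑ʳ i) (n ↑ʳ j) ≡ δ i j
    δ-↑ʳ zero    i j = ≡.refl
    δ-↑ʳ (suc n) i j = δ-↑ʳ n i j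

    δ-↑ʳ-↑ˡ : ∀ n (i : Fin m) (j : Fin n) → δ (n ↑ʳ i) (j ↑ˡ m) ≡ 0#
    δ-↑ʳ-↑ˡ (suc n) i zero    = ≡.refl
    δ-↑ʳ-↑ˡ (suc n) i (suc j) = δ-↑ʳ-↑ˡ n i j

    -- With π = shuffle n ν b, both sides are the determinant of the product of W,
    -- with rows P ∘ π and the last m unit rows, and complementMatrix ∘ π.
    module _ (n : ℕ) (P : Fin n → Fin (n ℕ.+ m) → Carrier) (D : Fin (n ℕ.+ m) → Fin m → Carrier)
      (orthogonal : ∀ l i → sum (λ κ → P l κ * D κ i) ≈ 0#) (α : Fin n → Fin (n ℕ.+ m)) where

      -- The unit columns at `α` complete `D` to a square matrix and select the columns `α` of `P`.
      -- The determinant does not involve ν, so one partition suffices to find it.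
      complementMatrix : Matrix (n ℕ.+ m)
      complementMatrix κ = (λ c → δ κ (α c)) Vector.++ D κ

      complementary-minors : ∀ ν b →
        det (λ l j → P l (shuffle n ν b (j ↑ˡ m))) * (product (sgn ∘ exponents ν n) * det complementMatrix)
        ≈ det (λ l j → P l (α j)) * det (λ j i → D (shuffle n ν b (n ↑ʳ j)) i)
      complementary-minors ν b = begin
        det Pα * (product (sgn ∘ exponents ν n) * det U)  ≈⟨ *-cong det-W (rowSign-shuffle n ν b U) ⟨
        det W * det (U ∘ π)                               ≈⟨ det-⊡ W (U ∘ π) ⟨
        det (W ⊡ (U ∘ π))                                 ≈⟨ det-ᵀ (W ⊡ (U ∘ π)) ⟨
        det ((W ⊡ (U ∘ π)) ᵀ)                             ≈⟨ det-block n ((W ⊡ (U ∘ π)) ᵀ) corner ⟩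
        det (λ j l → (W ⊡ (U ∘ π)) (l ↑ˡ m) (j ↑ˡ m)) * det (λ i j → (W ⊡ (U ∘ π)) (n ↑ʳ j) (n ↑ʳ i))
          ≈⟨ *-cong (trans (det-cong {M = λ j l → (W ⊡ (U ∘ π)) (l ↑ˡ m) (j ↑ˡ m)} {N = Pα₀ ᵀ} λ j l → upper l j) (det-ᵀ Pα₀))
                    (trans (det-cong {M = λ i j → (W ⊡ (U ∘ π)) (n ↑ʳ j) (n ↑ʳ i)} {N = Dβ ᵀ} λ i j → lower j i) (det-ᵀ Dβ)) ⟩
        det Pα₀ * det Dβ ∎
        where
        π = shuffle n ν b
        U = complementMatrix
        Pα Pα₀ : Matrix n
        Pα  l j = P l (π (j ↑ˡ m))
        Pα₀ l j = P l (α j)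
        Dβ : Matrix m
        Dβ j i = D (π (n ↑ʳ j)) i
        W : Matrix (n ℕ.+ m)
        W = (λ l t → P l (π t)) Vector.++ (λ j t → δ (n ↑ʳ j) t)
        W-↑ˡ : ∀ l t → W (l ↑ˡ m) t ≡ P l (π t)
        W-↑ˡ l t = ≡.cong (λ v → v t) (Vector.lookup-++ˡ (λ l t → P l (π t)) (λ j t → δ (n ↑ʳ j) t) l)
        W-↑ʳ : ∀ j t → W (n ↑ʳ j) t ≡ δ (n ↑ʳ j) t
        W-↑ʳ j t = ≡.cong (λ v → v t) (Vector.lookup-++ʳ (λ l t → P l (π t)) (λ j t → δ (n ↑ʳ j) t) j)
        U-↑ˡ : ∀ κ c → U κ (c ↑ˡ m) ≡ δ κ (α c)
        U-↑ˡ κ c = Vector.lookup-++ˡ (λ c → δ κ (α c)) (D κ) c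
        U-↑ʳ : ∀ κ i → U κ (n ↑ʳ i) ≡ D κ i
        U-↑ʳ κ i = Vector.lookup-++ʳ (λ c → δ κ (α c)) (D κ) i
        det-W : det W ≈ det Pα
        det-W = begin
          det W
            ≈⟨ det-block n W (λ i j → reflexive (≡.trans (W-↑ʳ i (j ↑ˡ m)) (δ-↑ʳ-↑ˡ n i j))) ⟩
          det (λ l j → W (l ↑ˡ m) (j ↑ˡ m)) * det (λ i j → W (n ↑ʳ i) (n ↑ʳ j))
            ≈⟨ *-cong (det-cong {M = λ l j → W (l ↑ˡ m) (j ↑ˡ m)} {N = Pα} λ l j → reflexive (W-↑ˡ l (j ↑ˡ m)))
                      (trans (det-cong {M = λ i j → W (n ↑ʳ i) (n ↑ʳ j)} {N = δ} λ i j →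
                               reflexive (≡.trans (W-↑ʳ i (n ↑ʳ j)) (δ-↑ʳ n i j))) (det-δ m)) ⟩
          det Pα * 1#
            ≈⟨ *-identityʳ _ ⟩
          det Pα ∎
        product-↑ˡ : ∀ l c → (W ⊡ (U ∘ π)) (l ↑ˡ m) c ≈ sum (λ κ → P l κ * U κ c)
        product-↑ˡ l c = trans (sum-cong-≋ λ t → *-cong (reflexive (W-↑ˡ l t)) refl)
          (sum-shuffle n ν b (λ κ → P l κ * U κ c))
        corner : ∀ i j → (W ⊡ (U ∘ π)) (j ↑ˡ m) (n ↑ʳ i) ≈ 0#
        corner i l = trans (product-↑ˡ l (n ↑ʳ i))
          (trans (sum-cong-≋ λ κ → *-cong refl (reflexive (U-↑ʳ κ i))) (orthogonal l i))
        upper : ∀ l j → (W ⊡ (U ∘ π)) (l ↑ˡ m) (j ↑ˡ m) ≈ P l (α j)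
        upper l j = trans (product-↑ˡ l (j ↑ˡ m))
          (trans (sum-cong-≋ λ κ → *-cong refl (reflexive (U-↑ˡ κ j))) (sum-δʳ (α j) (P l)))
        lower : ∀ j i → (W ⊡ (U ∘ π)) (n ↑ʳ j) (n ↑ʳ i) ≈ D (π (n ↑ʳ j)) i
        lower j i = trans (sum-cong-≋ λ t → *-cong (reflexive (W-↑ʳ j t)) refl)
          (trans (sum-δ (n ↑ʳ j) (λ t → U (π t) (n ↑ʳ i))) (reflexive (U-↑ʳ _ i)))

-- Jacobi–Trudi determinants

-- table M gen i r is the value at z^i f_r(z) of the linear functional that sends
-- f_0, …, f_{M-1} to 0 and f_{M+k} to gen k, where f_{r+1}(z) = (z - q r) f_r(z).
module Table {c ℓ : Level} (R : CommutativeRing c ℓ) (q : ℕ → CommutativeRing.Carrier R) where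

  open CommutativeRing R hiding (zero)
  open Determinant R

  initial : ℕ → (ℕ → Carrier) → ℕ → Carrier
  initial zero    gen r       = gen r
  initial (suc M) gen zero    = 0#
  initial (suc M) gen (suc r) = initial M gen r

  initial-< : ∀ M gen {r} → r ℕ.< M → initial M gen r ≡ 0#
  initial-< (suc M) gen {zero}  _         = ≡.refl
  initial-< (suc M) gen {suc r} (s≤s r<M) = initial-< M gen r<M

  initial-+ : ∀ M gen k → initial M gen (M ℕ.+ k) ≡ gen k
  initial-+ zero    gen k = ≡.refl
  initial-+ (suc M) gen k = initial-+ M gen k

  table : ℕ → (ℕ → Carrier) → ℕ → ℕ → Carrier
  table M gen zero    r = initial M gen r
  table M gen (suc i) r = table M gen i (suc r) + q r * table M gen i r

  -- For `q` = 0 and r_j = ν_j + M - j, counting from 0, the entries are c_{ν_j - j + i}: the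
  -- classical Jacobi-Trudi determinant of ν.
  jacobiTrudi : (M : ℕ) → (ℕ → Carrier) → (Fin (suc M) → ℕ) → Carrier
  jacobiTrudi M gen r = det (λ j i → table M gen (toℕ i) (r j))

  x≈0∧y≈0⇒x+z*y≈0 : ∀ {x y} z → x ≈ 0# → y ≈ 0# → x + z * y ≈ 0#
  x≈0∧y≈0⇒x+z*y≈0 z x≈0 y≈0 = trans (+-cong x≈0 (trans (*-cong refl y≈0) (zeroʳ z))) (+-identityˡ 0#)

  -- The polynomial z^i f_r has degree r + i, so it is a combination of the f_k with k < M, which
  -- the functional kills.
  table-below : ∀ M gen i {r} → r ℕ.+ i ℕ.< M → table M gen i r ≈ 0#
  table-below M gen zero    {r} r<M = reflexive (initial-< M gen (≡.subst (ℕ._< M) (ℕ.+-identityʳ r) r<M))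
  table-below M gen (suc i) {r} lt  = x≈0∧y≈0⇒x+z*y≈0 (q r)
    (table-below M gen i (≡.subst (ℕ._< M) (ℕ.+-suc r i) lt))
    (table-below M gen i (ℕ.<-trans (ℕ.+-monoʳ-< r (ℕ.n<1+n i)) lt))

  -- Here z^i f_r is f_M plus a combination of the f_k with k < M.
  table-antidiagonal : ∀ M gen → gen 0 ≈ 1# → ∀ i {r} → r ℕ.+ i ≡ M → table M gen i r ≈ 1#
  table-antidiagonal M gen g₀ zero    {r} ≡.refl = trans
    (reflexive (≡.trans (≡.cong (λ M → initial M gen r) (ℕ.+-identityʳ r))
      (≡.trans (≡.cong (initial r gen) (≡.sym (ℕ.+-identityʳ r))) (initial-+ r gen 0)))) g₀
  table-antidiagonal M gen g₀ (suc i) {r} r+1+i≡M = trans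
    (+-cong (table-antidiagonal M gen g₀ i (≡.trans (≡.sym (ℕ.+-suc r i)) r+1+i≡M))
      (trans (*-cong refl (table-below M gen i (ℕ.<-≤-trans (ℕ.+-monoʳ-< r (ℕ.n<1+n i)) (ℕ.≤-reflexive r+1+i≡M)))) (zeroʳ _)))
    (+-identityʳ 1#)

  -- The polynomial z^i f_r is a combination of f_r, ..., f_{r+i}.
  table-beyond : ∀ M gen N → (∀ r → N ℕ.≤ r → initial M gen r ≈ 0#) →
                 ∀ i r → N ℕ.≤ r → table M gen i r ≈ 0#
  table-beyond M gen N z zero    r N≤r = z r N≤r
  table-beyond M gen N z (suc i) r N≤r = x≈0∧y≈0⇒x+z*y≈0 (q r)
    (table-beyond M gen N z i (suc r) (ℕ.m≤n⇒m≤1+n N≤r)) (table-beyond M gen N z i r N≤r)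

module _ {c₁ ℓ₁ c₂ ℓ₂ : Level} (R : CommutativeRing c₁ ℓ₁) (S : CommutativeRing c₂ ℓ₂)
  (φ : CommutativeRing.Carrier R → CommutativeRing.Carrier S)
  (φ-hom : RingMorphisms.IsRingHomomorphism (CommutativeRing.rawRing R) (CommutativeRing.rawRing S) φ) where

  private
    module R = CommutativeRing R
    module S = CommutativeRing S
    module DR = Determinant R
    module DS = Determinant S
    module ΣR = SemiringSum R.semiring
    module ΣS = SemiringSum S.semiring
  open RingMorphisms.IsRingHomomorphism φ-hom

  hom-sum : ∀ {n} (t : Fin n → R.Carrier) → φ (ΣR.sum t) S.≈ ΣS.sum (φ ∘ t)
  hom-sum {zero}  t = 0#-homo
  hom-sum {suc n} t = S.trans (+-homo _ _) (S.+-cong S.refl (hom-sum (t ∘ suc)))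

  hom-sign : ∀ {n} (i : Fin n) → φ (DR.sign i) S.≈ DS.sign i
  hom-sign zero    = 1#-homo
  hom-sign (suc i) = S.trans (-‿homo _) (S.-‿cong (hom-sign i))

  hom-det : ∀ {n} (M : DR.Matrix n) → φ (DR.det M) S.≈ DS.det (λ r c → φ (M r c))
  hom-det {zero}  M = 1#-homo
  hom-det {suc n} M = S.trans (hom-sum (λ i → DR.sign i R.* (M i zero R.* DR.det (DR.minor i M))))
    (ΣS.sum-cong-≋ {suc n} λ i → S.trans (*-homo _ _)
      (S.*-cong (hom-sign i) (S.trans (*-homo _ _) (S.*-cong (S.refl {φ (M i zero)}) (hom-det (DR.minor i M))))))

  module _ (q : ℕ → R.Carrier) (q′ : ℕ → S.Carrier) (q↦q′ : ∀ r → φ (q r) S.≈ q′ r)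
    (M : ℕ) (gen : ℕ → R.Carrier) (gen′ : ℕ → S.Carrier) (gen↦gen′ : ∀ k → φ (gen k) S.≈ gen′ k) where

    private
      module TR = Table R q
      module TS = Table S q′

    hom-initial : ∀ M r → φ (TR.initial M gen r) S.≈ TS.initial M gen′ r
    hom-initial zero    r       = gen↦gen′ r
    hom-initial (suc M) zero    = 0#-homo
    hom-initial (suc M) (suc r) = hom-initial M r

    hom-table : ∀ i r → φ (TR.table M gen i r) S.≈ TS.table M gen′ i r
    hom-table zero    r = hom-initial M r
    hom-table (suc i) r = S.trans (+-homo _ _) (S.+-cong (hom-table i (suc r))
      (S.trans (*-homo _ _) (S.*-cong (q↦q′ r) (hom-table i r))))

    -- The determinant is built from `gen` and `q` by ring operations alone. This serves both for ω
    -- and for the passage from Λ to a component.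
    hom-jacobiTrudi : ∀ r → φ (TR.jacobiTrudi M gen r) S.≈ TS.jacobiTrudi M gen′ r
    hom-jacobiTrudi r = S.trans (hom-det (λ j i → TR.table M gen (toℕ i) (r j)))
      (DS.det-cong {M = λ j i → φ (TR.table M gen (toℕ i) (r j))} λ j i → hom-table (toℕ i) (r j))

module TableIdentities {c ℓ : Level} (R : CommutativeRing c ℓ)
  (halve : ∀ {x} → CommutativeRing._≈_ R x (CommutativeRing.-_ R x) → CommutativeRing._≈_ R x (CommutativeRing.0# R))
  (q : ℕ → CommutativeRing.Carrier R) (M : ℕ) (gen : ℕ → CommutativeRing.Carrier R) where

  open CommutativeRing R hiding (zero)
  open Determinant R
  open LinearAlgebra R halve
  open ComplementaryMinors R halve
  open Table R q
  open SemiringSum semiring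
  open RingProperties ring using (-‿distribˡ-*)
  open Solver commutativeSemiring using (solve; _:=_; _:+_; _:*_)
  open SetoidReasoning setoid

  emptyExponents : Fin (suc M) → ℕ
  emptyExponents = exponents (λ _ → 0) (suc M)

  -- The degree r_j + i of z^i f_{r_j} is M - j + i, so the matrix is unitriangular.
  jacobiTrudi-empty : gen 0 ≈ 1# → jacobiTrudi M gen emptyExponents ≈ 1#
  jacobiTrudi-empty g₀ = det-unitriangular (λ j i → table M gen (toℕ i) (emptyExponents j))
    (λ j i i<j → table-below M gen (toℕ i) (ℕ.<-≤-trans (ℕ.+-monoʳ-< (M ℕ.∸ toℕ j) i<j)
                   (ℕ.≤-reflexive (ℕ.m∸n+n≡m (ℕ.s≤s⁻¹ (Fin.toℕ<n j))))))
    (λ j → table-antidiagonal M gen g₀ (toℕ j) (ℕ.m∸n+n≡m (ℕ.s≤s⁻¹ (Fin.toℕ<n j))))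

  module _ (n : ℕ) (vanishing : ∀ {k} → n ℕ.< k → gen k ≈ 0#) where

    private
      N : ℕ
      N = n ℕ.+ suc M

    initial-beyond : ∀ r → N ℕ.≤ r → initial M gen r ≈ 0#
    initial-beyond r N≤r = trans (reflexive (≡.trans (≡.cong (initial M gen) (≡.sym (ℕ.m+[n∸m]≡n M≤r)))
        (initial-+ M gen (r ℕ.∸ M)))) (vanishing (ℕ.m+n≤o⇒m≤o∸n (suc n) (≡.subst (ℕ._≤ r) (ℕ.+-suc n M) N≤r)))
      where
      M≤r : M ℕ.≤ r
      M≤r = ℕ.≤-trans (ℕ.≤-trans (ℕ.n≤1+n M) (ℕ.m≤n+m (suc M) n)) N≤r

    module _ (z : Carrier) (p : ℕ → Carrier)
      (p-suc : ∀ κ → κ ℕ.< N → z * p κ + q (N ℕ.∸ suc κ) * p κ ≈ p (suc κ)) where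

      -- A polynomial in the basis p_κ, evaluated at `z`; its coefficients are signed table entries
      -- in reverse order.
      pairing : ℕ → Carrier
      pairing i = ∑[ κ < N ] (sgn (toℕ κ) * p (toℕ κ) * table M gen i (N ℕ.∸ suc (toℕ κ)))

      -- Summation by parts: the table recursion shifts κ by one, which flips the sign, and in z p_κ
      -- + q p_κ = p_{κ+1} the terms with q cancel.
      pairing-suc : ∀ i → i ℕ.< M → pairing (suc i) ≈ - z * pairing i
      pairing-suc i i<M = begin
        pairing (suc i)
          ≈⟨ sum-cong-≋ {N} (λ κ → trans (distribˡ _ _ _) (+-cong
               (*-cong refl (reflexive (≡.cong (table M gen i) (≡.sym (∸-toℕ κ))))) refl)) ⟩
        sum {N} (λ κ → v (toℕ κ) + w κ)
          ≈⟨ ∑-distrib-+ {N} (v ∘ toℕ) w ⟩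
        sum {N} (v ∘ toℕ) + sum w
          ≈⟨ +-cong shift refl ⟩
        sum {N} (λ κ → v (suc (toℕ κ))) + sum w
          ≈⟨ ∑-distrib-+ {N} (λ κ → v (suc (toℕ κ))) w ⟨
        sum {N} (λ κ → v (suc (toℕ κ)) + w κ)
          ≈⟨ sum-cong-≋ {N} combine ⟩
        sum {N} (λ κ → - z * (sgn (toℕ κ) * p (toℕ κ) * table M gen i (N ℕ.∸ suc (toℕ κ))))
          ≈⟨ *-distribˡ-sum {N} (- z) (λ κ → sgn (toℕ κ) * p (toℕ κ) * table M gen i (N ℕ.∸ suc (toℕ κ))) ⟨
        - z * pairing i ∎
        where
        v : ℕ → Carrier
        v κ = sgn κ * p κ * table M gen i (N ℕ.∸ κ)
        w : Fin N → Carrier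
        w κ = sgn (toℕ κ) * p (toℕ κ) * (q (N ℕ.∸ suc (toℕ κ)) * table M gen i (N ℕ.∸ suc (toℕ κ)))
        -- Both boundary terms of the shift vanish: index N lies beyond the support, and at index 0
        -- the degree i is below M.
        v-0 : v 0 ≈ 0#
        v-0 = trans (*-cong refl (table-beyond M gen N initial-beyond i N ℕ.≤-refl)) (zeroʳ _)
        v-N : v N ≈ 0#
        v-N = trans (*-cong refl (trans (reflexive (≡.cong (table M gen i) (ℕ.n∸n≡0 N)))
                (table-below M gen i i<M))) (zeroʳ _)
        shift : sum {N} (v ∘ toℕ) ≈ sum {N} (λ κ → v (suc (toℕ κ)))
        shift = begin
          sum {N} (v ∘ toℕ)                          ≈⟨ +-identityʳ _ ⟨
          sum {N} (v ∘ toℕ) + 0#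
            ≈⟨ +-cong (sum-cong-≋ {N} λ κ → reflexive (≡.cong v (≡.sym (Fin.toℕ-inject₁ κ))))
                      (trans (sym v-N) (reflexive (≡.cong v (≡.sym (Fin.toℕ-fromℕ N))))) ⟩
          sum {N} (v ∘ toℕ ∘ inject₁) + v (toℕ (fromℕ N))
            ≈⟨ sum-init-last {N} (v ∘ toℕ) ⟨
          v 0 + sum {N} (λ κ → v (suc (toℕ κ)))      ≈⟨ +-cong v-0 refl ⟩
          0# + sum {N} (λ κ → v (suc (toℕ κ)))       ≈⟨ +-identityˡ _ ⟩
          sum {N} (λ κ → v (suc (toℕ κ)))            ∎
        combine : ∀ κ → v (suc (toℕ κ)) + w κ
                        ≈ - z * (sgn (toℕ κ) * p (toℕ κ) * table M gen i (N ℕ.∸ suc (toℕ κ)))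
        combine κ = begin
          - s * p (suc k) * t + s * p k * (q r * t)
            ≈⟨ +-cong (*-cong (*-cong refl (p-suc k (Fin.toℕ<n κ))) refl) refl ⟨
          - s * (z * p k + q r * p k) * t + s * p k * (q r * t)
            ≈⟨ solve 6 (λ s s⁻ z p q t → s⁻ :* (z :* p :+ q :* p) :* t :+ s :* p :* (q :* t)
                 := s⁻ :* (z :* (p :* t)) :+ (s :+ s⁻) :* (q :* p :* t)) refl s (- s) z (p k) (q r) t ⟩
          - s * (z * (p k * t)) + (s + - s) * (q r * p k * t)
            ≈⟨ +-cong refl (trans (*-cong (-‿inverseʳ s) refl) (zeroˡ _)) ⟩
          - s * (z * (p k * t)) + 0#
            ≈⟨ +-identityʳ _ ⟩
          - s * (z * (p k * t))
            ≈⟨ -‿distribˡ-* s _ ⟨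
          - (s * (z * (p k * t)))
            ≈⟨ -‿cong (solve 4 (λ s z p t → s :* (z :* (p :* t)) := z :* (s :* p :* t)) refl s z (p k) t) ⟩
          - (z * (s * p k * t))
            ≈⟨ -‿distribˡ-* z _ ⟩
          - z * (s * p k * t) ∎
          where
          k = toℕ κ
          s = sgn k
          r = N ℕ.∸ suc k
          t = table M gen i r

      -- For i = 0 only the indices N - 1 - κ ≥ M survive, that is κ ≤ n, and there the entry is
      -- `gen (n - κ)`.
      pairing-zero : sum {suc n} (λ i → sgn (toℕ i) * p (toℕ i) * gen (n ℕ.∸ toℕ i)) ≈ 0# → pairing 0 ≈ 0#
      pairing-zero e = begin
        sum {n ℕ.+ suc M} (f ∘ toℕ)
          ≈⟨ reflexive (≡.cong (λ k → sum {k} (f ∘ toℕ)) (ℕ.+-suc n M)) ⟩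
        sum {suc n ℕ.+ M} (f ∘ toℕ)
          ≈⟨ sum-↑ (suc n) {M} (f ∘ toℕ) ⟩
        sum {suc n} (λ i → f (toℕ (i ↑ˡ M))) + sum {M} (λ j → f (toℕ (suc n ↑ʳ j)))
          ≈⟨ +-cong (trans (sum-cong-≋ {suc n} low) e) (sum-zero {M} high) ⟩
        0# + 0#
          ≈⟨ +-identityˡ 0# ⟩
        0# ∎
        where
        f : ℕ → Carrier
        f κ = sgn κ * p κ * initial M gen (N ℕ.∸ suc κ)
        N∸1+ : ∀ κ → N ℕ.∸ suc κ ≡ n ℕ.+ M ℕ.∸ κ
        N∸1+ κ = ≡.cong (ℕ._∸ suc κ) (ℕ.+-suc n M)
        low : ∀ i → f (toℕ (i ↑ˡ M)) ≈ sgn (toℕ i) * p (toℕ i) * gen (n ℕ.∸ toℕ i)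
        low i = trans (reflexive (≡.cong f (Fin.toℕ-↑ˡ i M))) (*-cong refl (reflexive
          (≡.trans (≡.cong (initial M gen) (≡.trans (N∸1+ (toℕ i))
            (≡.trans (≡.cong (ℕ._∸ toℕ i) (ℕ.+-comm n M)) (ℕ.+-∸-assoc M (ℕ.s≤s⁻¹ (Fin.toℕ<n i))))))
            (initial-+ M gen (n ℕ.∸ toℕ i)))))
        high : ∀ j → f (toℕ (suc n ↑ʳ j)) ≈ 0#
        high j = trans (*-cong refl (reflexive (≡.trans
          (≡.cong (initial M gen) (≡.trans (N∸1+ (toℕ (suc n ↑ʳ j))) (≡.trans (≡.cong (n ℕ.+ M ℕ.∸_)
            (≡.trans (Fin.toℕ-↑ʳ (suc n) j) (≡.sym (ℕ.+-suc n (toℕ j))))) (ℕ.[m+n]∸[m+o]≡n∸o n M (suc (toℕ j))))))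
          (initial-< M gen (ℕ.<-≤-trans (ℕ.≤-reflexive (≡.sym (∸-toℕ j))) (ℕ.m∸n≤m M (toℕ j))))))) (zeroʳ _)

      pairing-vanishes : pairing 0 ≈ 0# → ∀ i → i ℕ.≤ M → pairing i ≈ 0#
      pairing-vanishes e zero    _   = e
      pairing-vanishes e (suc i) i<M = trans (pairing-suc i i<M)
        (trans (*-cong refl (pairing-vanishes e i (ℕ.<⇒≤ i<M))) (zeroʳ _))

  -- f l r is f_r(y_l); multiplying f_r by z^i only changes the weights w l.
  module _ (f : Fin (suc M) → ℕ → Carrier) (y : Fin (suc M) → Carrier) (w : Fin (suc M) → Carrier) (Δ : Carrier)
    (f-suc : ∀ l r → y l * f l r ≈ f l (suc r) + q r * f l r)
    (expansion : ∀ r → Δ * initial M gen r ≈ sum (λ l → f l r * w l)) where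

    weight : ℕ → Fin (suc M) → Carrier
    weight zero    l = w l
    weight (suc i) l = y l * weight i l

    table-expansion : ∀ i r → Δ * table M gen i r ≈ sum (λ l → f l r * weight i l)
    table-expansion zero    r = expansion r
    table-expansion (suc i) r = begin
      Δ * (table M gen i (suc r) + q r * table M gen i r)
        ≈⟨ solve 4 (λ d t q t′ → d :* (t :+ q :* t′) := d :* t :+ q :* (d :* t′)) refl
             Δ (table M gen i (suc r)) (q r) (table M gen i r) ⟩
      Δ * table M gen i (suc r) + q r * (Δ * table M gen i r)
        ≈⟨ +-cong (table-expansion i (suc r)) (trans (*-cong refl (table-expansion i r))
             (*-distribˡ-sum (q r) (λ l → f l r * weight i l))) ⟩
      sum (λ l → f l (suc r) * weight i l) + sum (λ l → q r * (f l r * weight i l))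
        ≈⟨ ∑-distrib-+ (λ l → f l (suc r) * weight i l) (λ l → q r * (f l r * weight i l)) ⟨
      sum (λ l → f l (suc r) * weight i l + q r * (f l r * weight i l))
        ≈⟨ sum-cong-≋ {suc M} (λ l → begin
             f l (suc r) * weight i l + q r * (f l r * weight i l)
               ≈⟨ solve 4 (λ a b q x → a :* x :+ q :* (b :* x) := (a :+ q :* b) :* x) refl
                    (f l (suc r)) (f l r) (q r) (weight i l) ⟩
             (f l (suc r) + q r * f l r) * weight i l
               ≈⟨ *-cong (f-suc l r) refl ⟨
             y l * f l r * weight i l
               ≈⟨ solve 3 (λ y a x → y :* a :* x := a :* (y :* x)) refl (y l) (f l r) (weight i l) ⟩
             f l r * (y l * weight i l) ∎) ⟩
      sum (λ l → f l r * weight (suc i) l) ∎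

    -- The scaled matrix is a product of values f_{r_j}(y_l) and weights y_l^i w_l. Only the first
    -- factor involves `r`, so a known case determines the second.
    jacobiTrudi-expansion : ∀ (r : Fin (suc M) → ℕ) →
      product {suc M} (λ _ → Δ) * jacobiTrudi M gen r
      ≈ det (λ l j → f l (r j)) * det (λ l i → weight (toℕ i) l)
    jacobiTrudi-expansion r = begin
      product {suc M} (λ _ → Δ) * jacobiTrudi M gen r
        ≈⟨ det-scale (λ _ → Δ) (λ j i → table M gen (toℕ i) (r j)) ⟨
      det (λ j i → Δ * table M gen (toℕ i) (r j))
        ≈⟨ det-cong {M = λ j i → Δ * table M gen (toℕ i) (r j)} {N = F ᵀ ⊡ G}
             (λ j i → table-expansion (toℕ i) (r j)) ⟩
      det (F ᵀ ⊡ G)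
        ≈⟨ det-⊡ (F ᵀ) G ⟩
      det (F ᵀ) * det G
        ≈⟨ *-cong (det-ᵀ F) refl ⟩
      det F * det G ∎
      where
      F G : Matrix (suc M)
      F l j = f l (r j)
      G l i = weight (toℕ i) l

-- Double Schur functions

open import Defs

private
  module ℚ[a] = CommutativeRing ℚ[a]

-- Parts of a partition and of its conjugate

nth-decreasing : ∀ {ms} → Linked ℕ._≥_ ms → ∀ i → nth ms (suc i) ℕ.≤ nth ms i
nth-decreasing []          i       = z≤n
nth-decreasing [-]         i       = z≤n
nth-decreasing (m≥n ∷ ms≥) zero    = m≥n
nth-decreasing (m≥n ∷ ms≥) (suc i) = nth-decreasing ms≥ i

nth-replicate-< : ∀ {k i} → i ℕ.< k → nth (replicate k 1) i ≡ 1
nth-replicate-< {suc k} {zero}  _         = ≡.refl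
nth-replicate-< {suc k} {suc i} (s≤s i<k) = nth-replicate-< i<k

nth-applyUpTo-< : ∀ f {n i} → i ℕ.< n → nth (applyUpTo f n) i ≡ f i
nth-applyUpTo-< f {suc n} {zero}  _         = ≡.refl
nth-applyUpTo-< f {suc n} {suc i} (s≤s i<n) = nth-applyUpTo-< (f ∘ suc) i<n

countAbove-nth : ∀ ms n j → length ms ℕ.≤ n → countAbove (applyUpTo (nth ms) n) j ≡ countAbove ms j
countAbove-nth []       n       j _ = countAbove-applyUpTo-zero (λ _ → 0) n (λ _ → z≤n)
countAbove-nth (m ∷ ms) (suc n) j (s≤s len) with j ℕ.<? m
... | yes j<m = ≡.trans (countAbove-accept (applyUpTo (nth ms) n) j<m)
  (≡.trans (≡.cong suc (countAbove-nth ms n j len)) (≡.sym (countAbove-accept ms j<m)))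
... | no j≮m = ≡.trans (countAbove-reject (applyUpTo (nth ms) n) j≮m)
  (≡.trans (countAbove-nth ms n j len) (≡.sym (countAbove-reject ms j≮m)))

module _ (μ : Partition) where
  open Partition

  part-antitone : ∀ i → part μ (suc i) ℕ.≤ part μ i
  part-antitone = nth-decreasing (decreasing μ)

  part-≤ : ∀ {m} → part μ 0 ℕ.≤ m → ∀ i → part μ i ℕ.≤ m
  part-≤ μ₀≤m i = ℕ.≤-trans (antitone-≤ part-antitone i) μ₀≤m

  part-conjugate : ∀ n → ℓ μ ℕ.≤ n → ∀ j → part (conjugate μ) j ≡ countAbove (applyUpTo (part μ) n) j
  part-conjugate n ℓ≤n j with j ℕ.<? part μ 0
  ... | yes j<μ₀ = ≡.trans (nth-applyUpTo-< (countAbove (parts μ)) j<μ₀) (≡.sym (countAbove-nth (parts μ) n j ℓ≤n))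
  ... | no j≮μ₀ = ≡.trans
    (nth-beyond (applyUpTo (countAbove (parts μ)) (part μ 0))
      (ℕ.≤-trans (ℕ.≤-reflexive (List.length-applyUpTo (countAbove (parts μ)) (part μ 0))) (ℕ.≮⇒≥ j≮μ₀)))
    (≡.sym (countAbove-applyUpTo-zero (part μ) n (part-≤ (ℕ.≮⇒≥ j≮μ₀))))

∅ : Partition
∅ = row 0

-- Shifted indices and generalised powers

descend : ℤ → ℕ → ℤ
descend i zero    = i
descend i (suc r) = descend (ℤ.pred i) r

descend-≡ : ∀ i r → descend i r ≡ i ℤ.- + r
descend-≡ i zero    = ≡.sym (ℤ.+-identityʳ i)
descend-≡ i (suc r) = ≡.trans (descend-≡ (ℤ.pred i) r)
  (solve 2 (λ i r → (con (ℤ.- 1ℤ) :+ i) :- r := i :- (con 1ℤ :+ r)) ≡.refl i (+ r))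
  where open +-*-Solver

-- It yields a′_{m-r} = -a_{n-κ}: up to sign, the constants of (z‖a′)^r in m variables are those of
-- (z‖a)^κ in n variables in reverse order.
reflect-descend : ∀ m n {r κ} → suc (r ℕ.+ κ) ≡ n ℕ.+ m →
  ℤ.- descend (+ m) r ℤ.+ 1ℤ ≡ descend (+ n) κ
reflect-descend m n {r} {κ} e = begin
  ℤ.- descend (+ m) r ℤ.+ 1ℤ        ≡⟨ ≡.cong (λ i → ℤ.- i ℤ.+ 1ℤ) (descend-≡ (+ m) r) ⟩
  ℤ.- (+ m ℤ.- + r) ℤ.+ 1ℤ
    ≡⟨ solve 3 (λ m r κ → :- (m :- r) :+ con 1ℤ := (con 1ℤ :+ (r :+ κ)) :- m :- κ) ≡.refl (+ m) (+ r) (+ κ) ⟩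
  + suc (r ℕ.+ κ) ℤ.- + m ℤ.- + κ   ≡⟨ ≡.cong (λ k → + k ℤ.- + m ℤ.- + κ) e ⟩
  + n ℤ.+ + m ℤ.- + m ℤ.- + κ
    ≡⟨ solve 3 (λ n m κ → n :+ m :- m :- κ := n :- κ) ≡.refl (+ n) (+ m) (+ κ) ⟩
  + n ℤ.- + κ                       ≡⟨ descend-≡ (+ n) κ ⟨
  descend (+ n) κ                   ∎
  where
  open ≡.≡-Reasoning
  open +-*-Solver

module _ {X : Set} where
  private
    module P = CommutativeRing (polyRing X)
  open AbelianGroupProperties P.+-abelianGroup using (inverseˡ-unique)
  open SetoidReasoning P.setoid

  con-neg : ∀ c → con {X} (ℚ[a].- c) ≃ ⊖ con c
  con-neg c = inverseˡ-unique _ _ (≃-trans (≃-sym (con-+ _ _)) (con-cong (ℚ[a].-‿inverseˡ c)))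

  degree-0 : ∀ {d} {p : Poly X} → Degree≤ d p → d ≡ 0 → ∃ λ c → p ≃ con c
  degree-0 (deg-con {a = c}) _ = c , ≃-refl
  degree-0 (deg-⊕ u v) d≡0 =
    let (c , p≃c) = degree-0 u d≡0 ; (d , q≃d) = degree-0 v d≡0 in
    c ℚ[a].+ d , ≃-trans (⊕-cong p≃c q≃d) (≃-sym (con-+ c d))
  degree-0 (deg-⊗ {d₁ = d₁} u v le) ≡.refl =
    let (c , p≃c) = degree-0 u (ℕ.n≤0⇒n≡0 (ℕ.m+n≤o⇒m≤o d₁ le))
        (d , q≃d) = degree-0 v (ℕ.n≤0⇒n≡0 (ℕ.m+n≤o⇒n≤o d₁ le)) in
    c ℚ[a].* d , ≃-trans (⊗-cong p≃c q≃d) (≃-sym (con-* c d))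
  degree-0 (deg-⊖ u) d≡0 =
    let (c , p≃c) = degree-0 u d≡0 in ℚ[a].- c , ≃-trans (⊖-cong p≃c) (≃-sym (con-neg c))
  degree-0 (deg-resp p≃q u) d≡0 =
    let (c , p≃c) = degree-0 u d≡0 in c , ≃-trans (≃-sym p≃q) p≃c

  module _ (b : Sequence) where

    power-suc : ∀ i r (p : Poly X) → power b i (suc r) p ≃ power b i r p ⊗ (p ⊕ ⊖ con (b (descend i r)))
    power-suc i zero    p = ⊗-comm _ _
    power-suc i (suc r) p = ≃-trans (⊗-cong ≃-refl (power-suc (ℤ.pred i) r p)) (≃-sym (⊗-assoc _ _ _))

    -- This is the recursion underlying `table`, with q_r = b_{i-r}.
    x⊗power : ∀ i r (p : Poly X) → p ⊗ power b i r p ≃ power b i (suc r) p ⊕ con (b (descend i r)) ⊗ power b i r p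
    x⊗power i r p = ≃-sym (begin
      power b i (suc r) p ⊕ c ⊗ f    ≈⟨ ⊕-cong (power-suc i r p) ≃-refl ⟩
      f ⊗ (p ⊕ ⊖ c) ⊕ c ⊗ f          ≈⟨ ⊕-cong ≃-refl (⊗-comm c f) ⟩
      f ⊗ (p ⊕ ⊖ c) ⊕ f ⊗ c          ≈⟨ ⊗-distribˡ-⊕ _ _ _ ⟨
      f ⊗ (p ⊕ ⊖ c ⊕ c)              ≈⟨ ⊗-cong ≃-refl (≃-trans (⊕-assoc _ _ _)
                                          (≃-trans (⊕-cong ≃-refl (⊖-inverseˡ c)) (P.+-identityʳ p))) ⟩
      f ⊗ p                          ≈⟨ ⊗-comm f p ⟩
      p ⊗ f                          ∎)
      where
      f = power b i r p
      c = con (b (descend i r))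

Vandermonde : ∀ n → Poly (Fin n)
Vandermonde n = vandermonde {Fin n} {n} var

module _ (b : Sequence) where

  -- The degree bound 0 makes the polynomial a constant, and stability equates it with the constant
  -- in one variable fewer. Renaming by `suc` carries that equation back to `suc n` variables.
  schurPoly-∅ : ∀ n → schurPoly b ∅ n ≃ con ℚ[a].1#
  schurPoly-∅ zero    = ≃-trans (≃-sym (⊗-identityˡ _)) (≃-sym (schurPoly-exact b ∅ 0 z≤n))
  schurPoly-∅ (suc n) = ≃-trans p≃c (subst-cong {X = Fin n} (var ∘ suc)
    (≃-trans (≃-sym (subst-cong (var ▹ con (b (+ suc n))) p≃c)) (≃-trans (schurPoly-stable b n ∅) (schurPoly-∅ n))))
    where
    constant = degree-0 (schurPoly-degree b ∅ (suc n)) ≡.refl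
    p≃c = let (_ , e) = constant in e

  det-schurMatrix-∅ : ∀ n → det (schurMatrix b ∅ n) ≃ Vandermonde n
  det-schurMatrix-∅ n = ≃-trans (schurPoly-exact b ∅ n z≤n)
    (≃-trans (⊗-cong ≃-refl (schurPoly-∅ n)) (CommutativeRing.*-identityʳ (polyRing (Fin n)) _))

regular-product : ∀ {X n} (u : Fin n → Poly X) → (∀ i → Regular (u i)) → Regular (product u)
regular-product {n = zero}  u r = regular-1
regular-product {n = suc n} u r = regular-⊗ (r zero) (regular-product (u ∘ suc) (r ∘ suc))

coefficients : ∀ {X} → Sequence → ℕ → ℕ → Poly X
coefficients b m r = con (b (descend (+ m) r))

-- The Jacobi-Trudi formula in the h_k

module _ (b : Sequence) (M : ℕ) where

  private
    m = suc M
    R = polyRing (Fin m)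
    Δ = Vandermonde m

    h-poly : ℕ → Poly (Fin m)
    h-poly k = schurPoly b (row k) m

    f : Fin m → ℕ → Poly (Fin m)
    f l r = power b (+ m) r (var l)

    leading : ℕ → Fin m → ℕ
    leading r zero    = r
    leading r (suc j) = M ℕ.∸ suc (toℕ j)

    -- The first-column cofactors of the alternant with exponents r, M - 1, ..., 0, for any r; they
    -- equal Δ / ∏_{k≠l} (y_l - y_k).
    w : Fin m → Poly (Fin m)
    w l = sign l ⊗ det (λ r c → f (punchIn l r) (M ℕ.∸ suc (toℕ c)))

  open CommutativeRing R using (setoid; reflexive; zeroʳ; *-commutativeSemigroup)
  open CommutativeSemigroupProperties *-commutativeSemigroup using (x∙yz≈y∙xz)
  open SemiringSum (CommutativeRing.semiring R) using (sum; sum-cong-≋)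
  open Table R (coefficients b m)
  open TableIdentities R halve (coefficients b m) M h-poly
  open LinearAlgebra R halve using (det-equal-rows; det-ᵀ)
  open SetoidReasoning setoid

  private
    exponent-row : ∀ k j → exponent b (row k) m j ≡ leading (M ℕ.+ k) j
    exponent-row zero    zero    = ≡.sym (ℕ.+-identityʳ M)
    exponent-row (suc k) zero    = ℕ.+-comm (suc k) M
    exponent-row zero    (suc j) = ≡.refl
    exponent-row (suc k) (suc j) = ≡.refl

    ℓ-row : ∀ k → ℓ (row k) ℕ.≤ m
    ℓ-row zero    = z≤n
    ℓ-row (suc k) = s≤s z≤n

    -- For r ≥ M the right side is the alternant of h_{r-M}; for r < M the exponent r occurs in two
    -- columns.
    det-leading : ∀ r → Δ ⊗ initial M h-poly r ≃ det (λ l j → f l (leading r j))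
    det-leading r with r ℕ.<? M
    ... | yes r<M = begin
      Δ ⊗ initial M h-poly r                 ≈⟨ ⊗-cong ≃-refl (reflexive (initial-< M h-poly r<M)) ⟩
      Δ ⊗ con ℚ[a].0#                        ≈⟨ zeroʳ Δ ⟩
      con ℚ[a].0#
        -- Column `suc j` has exponent M - 1 - j, which is r for j = M - 1 - r.
        ≈⟨ det-equal-rows (λ j l → f l (leading r j)) {zero} {suc (fromℕ< M∸1+r<M)} (λ ())
             (λ l → reflexive (≡.cong (f l) (≡.sym repeated))) ⟨
      det (λ j l → f l (leading r j))        ≈⟨ det-ᵀ (λ l j → f l (leading r j)) ⟩
      det (λ l j → f l (leading r j))        ∎
      where
      M∸1+r<M : M ℕ.∸ suc r ℕ.< M
      M∸1+r<M = ℕ.≤-trans (ℕ.≤-reflexive (≡.sym (ℕ.+-∸-assoc 1 r<M))) (ℕ.m∸n≤m M r)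
      repeated : M ℕ.∸ suc (toℕ (fromℕ< M∸1+r<M)) ≡ r
      repeated = ≡.trans (≡.cong (λ k → M ℕ.∸ suc k) (Fin.toℕ-fromℕ< M∸1+r<M))
        (≡.trans (≡.cong (M ℕ.∸_) (≡.sym (ℕ.+-∸-assoc 1 r<M))) (ℕ.m∸[m∸n]≡n (ℕ.<⇒≤ r<M)))
    ... | no r≮M = begin
      Δ ⊗ initial M h-poly r
        ≈⟨ ⊗-cong ≃-refl (reflexive (≡.trans (≡.cong (initial M h-poly) (≡.sym r≡)) (initial-+ M h-poly k))) ⟩
      Δ ⊗ h-poly k                           ≈⟨ schurPoly-exact b (row k) m (ℓ-row k) ⟨
      det (schurMatrix b (row k) m)
        ≈⟨ det-cong {M = schurMatrix b (row k) m} {N = λ l j → f l (leading r j)} (λ l j → reflexive (≡.cong (f l)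
             (≡.trans (exponent-row k j) (≡.cong (λ r → leading r j) r≡)))) ⟩
      det (λ l j → f l (leading r j))        ∎
      where
      k = r ℕ.∸ M
      r≡ : M ℕ.+ k ≡ r
      r≡ = ℕ.m+[n∸m]≡n (ℕ.≮⇒≥ r≮M)

    expansion : ∀ r → Δ ⊗ initial M h-poly r ≃ sum (λ l → f l r ⊗ w l)
    expansion r = ≃-trans (det-leading r) (sum-cong-≋ {m} λ l → x∙yz≈y∙xz (sign l) (f l r) (det (minor l (λ l j → f l (leading r j)))))

    f-suc : ∀ l r → var l ⊗ f l r ≃ f l (suc r) ⊕ coefficients b m r ⊗ f l r
    f-suc l r = x⊗power b (+ m) r (var l)

  -- The factor `G` is the same for all partitions. The empty one, whose determinant is 1, gives Δ G
  -- = Δᵐ, and Δ Δᵐ cancels.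
  schurPoly-h : ∀ μ → ℓ μ ℕ.≤ m → schurPoly b μ m ≃ jacobiTrudi M h-poly (exponent b μ m)
  schurPoly-h μ ℓ≤m = ≃-sym (regular-cancelˡ (regular-⊗ vandermonde-regular
    (regular-product {n = m} (λ _ → Δ) (λ _ → vandermonde-regular))) (begin
      Δ ⊗ Δᵐ ⊗ jacobiTrudi M h-poly (exponent b μ m)
        ≈⟨ ⊗-assoc _ _ _ ⟩
      Δ ⊗ (Δᵐ ⊗ jacobiTrudi M h-poly (exponent b μ m))
        ≈⟨ ⊗-cong ≃-refl (jacobiTrudi-expansion f var w Δ f-suc expansion (exponent b μ m)) ⟩
      Δ ⊗ (det (schurMatrix b μ m) ⊗ G)
        ≈⟨ x∙yz≈y∙xz Δ _ G ⟩
      det (schurMatrix b μ m) ⊗ (Δ ⊗ G)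
        ≈⟨ ⊗-cong (schurPoly-exact b μ m ℓ≤m) Δ⊗G ⟩
      Δ ⊗ schurPoly b μ m ⊗ Δᵐ
        ≈⟨ ≃-trans (⊗-assoc _ _ _) (≃-trans (⊗-cong ≃-refl (⊗-comm _ _)) (≃-sym (⊗-assoc _ _ _))) ⟩
      Δ ⊗ Δᵐ ⊗ schurPoly b μ m ∎))
    where
    Δᵐ = product {n = m} (λ _ → Δ)
    G = det (λ l i → weight f var w Δ f-suc expansion (toℕ i) l)
    Δ⊗G : Δ ⊗ G ≃ Δᵐ
    Δ⊗G = begin
      Δ ⊗ G                                        ≈⟨ ⊗-cong (det-schurMatrix-∅ b m) ≃-refl ⟨
      det (schurMatrix b ∅ m) ⊗ G                  ≈⟨ jacobiTrudi-expansion f var w Δ f-suc expansion (exponent b ∅ m) ⟨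
      Δᵐ ⊗ jacobiTrudi M h-poly (exponent b ∅ m)     ≈⟨ ⊗-cong ≃-refl (jacobiTrudi-empty (schurPoly-∅ b m)) ⟩
      Δᵐ ⊗ con ℚ[a].1#                             ≈⟨ CommutativeRing.*-identityʳ R Δᵐ ⟩
      Δᵐ                                           ∎

-- The dual Jacobi-Trudi formula in the e_k

module _ (n M : ℕ) where

  private
    m = suc M
    N = n ℕ.+ m
    R = polyRing (Fin n)
    Δ = Vandermonde n
    q = coefficients {Fin n} a′ m

    e-poly : ℕ → Poly (Fin n)
    e-poly k = schurPoly a (column k) n

    p : Fin n → ℕ → Poly (Fin n)
    p l κ = power a (+ n) κ (var l)

  open CommutativeRing R using (setoid; reflexive; zeroʳ; *-commutativeSemigroup)
  open CommutativeSemigroupProperties *-commutativeSemigroup using (interchange)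
  open SemiringSum (CommutativeRing.semiring R) using (sum; sum-cong-≋; *-distribˡ-sum; sum-permute)
  open RingProperties (CommutativeRing.ring R) using (-‿distribˡ-*)
  open Table R q
  open TableIdentities R halve q M e-poly
  open LinearAlgebra R halve
  open ComplementaryMinors R halve
  open Solver (CommutativeRing.commutativeSemiring R) using (solve; _:=_; _:*_)
  open SetoidReasoning setoid

  private
    sgn-∸ : ∀ {j k} → j ℕ.≤ k → sgn (k ℕ.∸ j) ≃ sgn k ⊗ sgn j
    sgn-∸ {zero}  {k}     _         = ≃-sym (CommutativeRing.*-identityʳ R _)
    sgn-∸ {suc j} {suc k} (s≤s j≤k) = ≃-trans (sgn-∸ j≤k) (≃-sym (-x*-y≈x*y (sgn k) (sgn j)))

    -- The alternant of e_j has the exponents n, ..., 0 with n - j left out, so it is a maximal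
    -- minor of one n × (n + 1) matrix.
    exponent-column : ∀ (j : Fin (suc n)) (c : Fin n) → exponent a (column (toℕ j)) n c ≡ n ℕ.∸ toℕ (punchIn j c)
    exponent-column j c with toℕ c ℕ.<? toℕ j
    ... | yes c<j = ≡.trans (≡.cong (ℕ._+ (n ℕ.∸ suc (toℕ c))) (nth-replicate-< c<j))
      (≡.trans (≡.sym (∸-toℕ c)) (≡.cong (n ℕ.∸_) (≡.sym (toℕ-punchIn-< j c c<j))))
    ... | no c≮j = ≡.trans (≡.cong (ℕ._+ (n ℕ.∸ suc (toℕ c)))
        (nth-beyond (replicate (toℕ j) 1) (ℕ.≤-trans (ℕ.≤-reflexive (List.length-replicate (toℕ j))) (ℕ.≮⇒≥ c≮j))))
      (≡.cong (n ℕ.∸_) (≡.sym (toℕ-punchIn-≥ j c (ℕ.≮⇒≥ c≮j))))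

    -- x_l is a root of ∏ (z - x_i): expand along its first row the alternant of
    -- x_l, x_1, …, x_n in the columns p_n, …, p_0.
    characteristic : ∀ l → sum {suc n} (λ j → sign j ⊗ (p l (n ℕ.∸ toℕ j) ⊗ e-poly (toℕ j))) ≃ con ℚ[a].0#
    characteristic l = vandermonde-regular _ (begin
      Δ ⊗ sum {suc n} (λ j → sign j ⊗ (p l (n ℕ.∸ toℕ j) ⊗ e-poly (toℕ j)))
        ≈⟨ *-distribˡ-sum {suc n} Δ (λ j → sign j ⊗ (p l (n ℕ.∸ toℕ j) ⊗ e-poly (toℕ j))) ⟩
      sum {suc n} (λ j → Δ ⊗ (sign j ⊗ (p l (n ℕ.∸ toℕ j) ⊗ e-poly (toℕ j))))
        ≈⟨ sum-cong-≋ {suc n} (λ j → begin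
             Δ ⊗ (sign j ⊗ (p l (n ℕ.∸ toℕ j) ⊗ e-poly (toℕ j)))
               ≈⟨ solve 4 (λ d s p e → d :* (s :* (p :* e)) := s :* (p :* (d :* e))) ≃-refl
                    Δ (sign j) (p l (n ℕ.∸ toℕ j)) (e-poly (toℕ j)) ⟩
             sign j ⊗ (p l (n ℕ.∸ toℕ j) ⊗ (Δ ⊗ e-poly (toℕ j)))
               ≈⟨ ⊗-cong ≃-refl (⊗-cong ≃-refl (≃-sym (minor-e j))) ⟩
             sign j ⊗ (Q zero j ⊗ det (submatrix zero j Q)) ∎) ⟩
      sum {suc n} (λ j → sign j ⊗ (Q zero j ⊗ det (submatrix zero j Q)))
        ≈⟨ det-first-row Q ⟨
      det Q
        ≈⟨ det-equal-rows Q {zero} {suc l} (λ ()) (λ c → ≃-refl) ⟩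
      con ℚ[a].0# ∎)
      where
      Q : Matrix {Fin n} (suc n)
      Q zero    c = p l (n ℕ.∸ toℕ c)
      Q (suc r) c = p r (n ℕ.∸ toℕ c)
      minor-e : ∀ j → det (submatrix zero j Q) ≃ Δ ⊗ e-poly (toℕ j)
      minor-e j = ≃-trans
        (det-cong {M = submatrix zero j Q} {N = schurMatrix a (column (toℕ j)) n}
          λ r c → reflexive (≡.cong (p r) (≡.sym (exponent-column j c))))
        (schurPoly-exact a (column (toℕ j)) n
          (ℕ.≤-trans (ℕ.≤-reflexive (List.length-replicate (toℕ j))) (ℕ.s≤s⁻¹ (Fin.toℕ<n j))))

    -- The reversal j ↦ n - j gives the form required by `pairing-zero`, at the cost of a common
    -- sign.
    characteristic′ : ∀ l → sum {suc n} (λ i → sgn (toℕ i) ⊗ p l (toℕ i) ⊗ e-poly (n ℕ.∸ toℕ i)) ≃ con ℚ[a].0#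
    characteristic′ l = begin
      sum {suc n} t
        ≈⟨ sum-permute {suc n} {suc n} t Perm.reverse ⟩
      sum {suc n} (t ∘ Fin.opposite)
        ≈⟨ sum-cong-≋ {suc n} reversed ⟩
      sum {suc n} (λ j → sgn n ⊗ (sign j ⊗ (p l (n ℕ.∸ toℕ j) ⊗ e-poly (toℕ j))))
        ≈⟨ *-distribˡ-sum {suc n} (sgn n) (λ j → sign j ⊗ (p l (n ℕ.∸ toℕ j) ⊗ e-poly (toℕ j))) ⟨
      sgn n ⊗ sum {suc n} (λ j → sign j ⊗ (p l (n ℕ.∸ toℕ j) ⊗ e-poly (toℕ j)))
        ≈⟨ ≃-trans (⊗-cong ≃-refl (characteristic l)) (zeroʳ _) ⟩
      con ℚ[a].0# ∎
      where
      t : Fin (suc n) → Poly (Fin n)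
      t i = sgn (toℕ i) ⊗ p l (toℕ i) ⊗ e-poly (n ℕ.∸ toℕ i)
      reversed : ∀ j → t (Fin.opposite j) ≃ sgn n ⊗ (sign j ⊗ (p l (n ℕ.∸ toℕ j) ⊗ e-poly (toℕ j)))
      reversed j = begin
        t (Fin.opposite j)
          ≡⟨ ≡.cong (λ i → sgn i ⊗ p l i ⊗ e-poly (n ℕ.∸ i)) (Fin.opposite-prop j) ⟩
        sgn (n ℕ.∸ k) ⊗ p l (n ℕ.∸ k) ⊗ e-poly (n ℕ.∸ (n ℕ.∸ k))
          ≈⟨ ⊗-cong (⊗-cong (sgn-∸ k≤n) ≃-refl) (reflexive (≡.cong e-poly (ℕ.m∸[m∸n]≡n k≤n))) ⟩
        sgn n ⊗ sgn k ⊗ p l (n ℕ.∸ k) ⊗ e-poly k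
          ≈⟨ solve 4 (λ s t p e → s :* t :* p :* e := s :* (t :* (p :* e))) ≃-refl
               (sgn n) (sgn k) (p l (n ℕ.∸ k)) (e-poly k) ⟩
        sgn n ⊗ (sgn k ⊗ (p l (n ℕ.∸ k) ⊗ e-poly k))
          ≈⟨ ⊗-cong ≃-refl (⊗-cong (reflexive (sgn-toℕ j)) ≃-refl) ⟩
        sgn n ⊗ (sign j ⊗ (p l (n ℕ.∸ k) ⊗ e-poly k)) ∎
        where
        k = toℕ j
        k≤n : k ℕ.≤ n
        k≤n = ℕ.s≤s⁻¹ (Fin.toℕ<n j)

    e-vanishes : ∀ {k} → n ℕ.< k → e-poly k ≃ con ℚ[a].0#
    e-vanishes {k} n<k = reflexive (schurPoly-zero a (column k) n
      (ℕ.<-≤-trans n<k (ℕ.≤-reflexive (≡.sym (List.length-replicate k)))))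

    -- By the definition of a′, q_{N-1-κ} = -a_{n-κ}, so x_l + q_{N-1-κ} is the next factor of
    -- (x_l‖a)^{κ+1}.
    p-suc : ∀ l κ → κ ℕ.< N → var l ⊗ p l κ ⊕ q (N ℕ.∸ suc κ) ⊗ p l κ ≃ p l (suc κ)
    p-suc l κ κ<N = begin
      var l ⊗ p l κ ⊕ q r ⊗ p l κ
        ≈⟨ ⊕-cong (x⊗power a (+ n) κ (var l)) (⊗-cong opposite ≃-refl) ⟩
      p l (suc κ) ⊕ c ⊗ p l κ ⊕ ⊖ c ⊗ p l κ
        ≈⟨ ⊕-assoc _ _ _ ⟩
      p l (suc κ) ⊕ (c ⊗ p l κ ⊕ ⊖ c ⊗ p l κ)
        ≈⟨ ⊕-cong ≃-refl (≃-trans (⊕-cong ≃-refl (≃-sym (-‿distribˡ-* c (p l κ))))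
             (CommutativeRing.-‿inverseʳ R (c ⊗ p l κ))) ⟩
      p l (suc κ) ⊕ con ℚ[a].0#
        ≈⟨ CommutativeRing.+-identityʳ R _ ⟩
      p l (suc κ) ∎
      where
      r = N ℕ.∸ suc κ
      c = con (a (descend (+ n) κ))
      opposite : q r ≃ ⊖ c
      opposite = ≃-trans (con-neg _) (⊖-cong (reflexive (≡.cong (con ∘ a)
        (reflect-descend m n {r} {κ} (≡.trans (≡.sym (ℕ.+-suc r κ)) (ℕ.m∸n+n≡m κ<N))))))

    P : Fin n → Fin N → Poly (Fin n)
    P l κ = sgn (toℕ κ) ⊗ p l (toℕ κ)

    D : Fin N → Fin m → Poly (Fin n)
    D κ i = table M e-poly (toℕ i) (N ℕ.∸ suc (toℕ κ))

    orthogonal : ∀ l i → sum {N} (λ κ → P l κ ⊗ D κ i) ≃ con ℚ[a].0#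
    orthogonal l i = pairing-vanishes n e-vanishes (var l) (p l) (p-suc l)
      (pairing-zero n e-vanishes (var l) (p l) (p-suc l) (characteristic′ l)) (toℕ i) (ℕ.s≤s⁻¹ (Fin.toℕ<n i))

    signs : (ℕ → ℕ) → Poly (Fin n)
    signs ν = product (sgn ∘ exponents ν n)

    signs-square : ∀ ν → signs ν ⊗ signs ν ≃ con ℚ[a].1#
    signs-square ν = product-square (sgn ∘ exponents ν n) (λ i → sgn-square (exponents ν n i))

    -- The columns n - 1, ..., 0 that belong to the empty partition.
    α : Fin n → Fin N
    α c = shuffle n (part ∅) (part-≤ ∅ {m} z≤n) (c ↑ˡ m)

    U : Poly (Fin n)
    U = det (complementMatrix n P D orthogonal α)

    det-P : ∀ μ μ₀≤m → det (λ l j → P l (shuffle n (part μ) (part-≤ μ {m} μ₀≤m) (j ↑ˡ m)))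
                       ≃ signs (part μ) ⊗ det (schurMatrix a μ n)
    det-P μ μ₀≤m = ≃-trans
      (det-cong {M = λ l j → P l (shuffle n (part μ) (part-≤ μ {m} μ₀≤m) (j ↑ˡ m))}
        λ l j → reflexive (≡.cong (λ κ → sgn κ ⊗ p l κ) (toℕ-shuffle-↑ˡ n (part-≤ μ μ₀≤m) (part-antitone μ) j)))
      (det-scale-columns (sgn ∘ exponents (part μ) n) (schurMatrix a μ n))

    -- With j counted from 0, the complementary number is n + j - μ′_{j+1}, and κ ↦ N - 1 - κ turns
    -- it into μ′_{j+1} + m - 1 - j.
    complementary-exponent : ∀ μ μ₀≤m → ℓ μ ℕ.≤ n → ∀ j →
      N ℕ.∸ suc (toℕ (shuffle n (part μ) (part-≤ μ {m} μ₀≤m) (n ↑ʳ j))) ≡ exponent a (conjugate μ) m j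
    complementary-exponent μ μ₀≤m ℓ≤n j = ≡.trans (≡.cong (ℕ._∸ suc t) total)
      (≡.trans (ℕ.m+n∸m≡n (suc t) (c ℕ.+ d)) (≡.cong (ℕ._+ d) (≡.sym (part-conjugate μ n ℓ≤n (toℕ j)))))
      where
      t = toℕ (shuffle n (part μ) (part-≤ μ {m} μ₀≤m) (n ↑ʳ j))
      c = countAbove (applyUpTo (part μ) n) (toℕ j)
      d = m ℕ.∸ suc (toℕ j)
      total : N ≡ suc t ℕ.+ (c ℕ.+ d)
      total = ≡.trans (≡.cong (n ℕ.+_) (≡.sym (ℕ.m+[n∸m]≡n (Fin.toℕ<n j))))
        (≡.trans (ℕ.+-suc n (toℕ j ℕ.+ d)) (≡.cong suc (≡.trans (≡.sym (ℕ.+-assoc n (toℕ j) d))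
          (≡.trans (≡.cong (ℕ._+ d) (≡.sym (toℕ-shuffle-↑ʳ n (part-≤ μ μ₀≤m) (part-antitone μ) j)))
            (ℕ.+-assoc t c d)))))

    complement : ∀ μ → part μ 0 ℕ.≤ m → ℓ μ ℕ.≤ n → det (schurMatrix a μ n) ⊗ U
      ≃ det (λ l j → P l (α j)) ⊗ jacobiTrudi M e-poly (exponent a (conjugate μ) m)
    complement μ μ₀≤m ℓ≤n = begin
      S ⊗ U                                          ≈⟨ ⊗-identityˡ _ ⟨
      con ℚ[a].1# ⊗ (S ⊗ U)                          ≈⟨ ⊗-cong (≃-sym (signs-square (part μ))) ≃-refl ⟩
      signs (part μ) ⊗ signs (part μ) ⊗ (S ⊗ U)      ≈⟨ interchange (signs (part μ)) (signs (part μ)) S U ⟩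
      signs (part μ) ⊗ S ⊗ (signs (part μ) ⊗ U)      ≈⟨ ⊗-cong (det-P μ μ₀≤m) ≃-refl ⟨
      det (λ l j → P l (π (j ↑ˡ m))) ⊗ (signs (part μ) ⊗ U)
        ≈⟨ complementary-minors n P D orthogonal α (part μ) (part-≤ μ μ₀≤m) ⟩
      det (λ l j → P l (α j)) ⊗ det (λ j i → D (π (n ↑ʳ j)) i)
        ≈⟨ ⊗-cong ≃-refl (det-cong {M = λ j i → D (π (n ↑ʳ j)) i} λ j i →
             reflexive (≡.cong (table M e-poly (toℕ i)) (complementary-exponent μ μ₀≤m ℓ≤n j))) ⟩
      det (λ l j → P l (α j)) ⊗ jacobiTrudi M e-poly (exponent a (conjugate μ) m) ∎
      where
      S = det (schurMatrix a μ n)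
      π = shuffle n (part μ) (part-≤ μ {m} μ₀≤m)

    det-Pα : det (λ l j → P l (α j)) ≃ signs (λ _ → 0) ⊗ Δ
    det-Pα = ≃-trans (det-P ∅ z≤n) (⊗-cong ≃-refl (det-schurMatrix-∅ a n))

    -- In `complement` for the empty partition every factor but `U` is known.
    U-sign : U ≃ signs (λ _ → 0)
    U-sign = regular-cancelˡ vandermonde-regular (begin
      Δ ⊗ U                                  ≈⟨ ⊗-cong (det-schurMatrix-∅ a n) ≃-refl ⟨
      det (schurMatrix a ∅ n) ⊗ U            ≈⟨ complement ∅ z≤n z≤n ⟩
      det (λ l j → P l (α j)) ⊗ jacobiTrudi M e-poly (exponent a ∅ m)
        ≈⟨ ⊗-cong det-Pα (jacobiTrudi-empty (schurPoly-∅ a n)) ⟩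
      signs (λ _ → 0) ⊗ Δ ⊗ con ℚ[a].1#      ≈⟨ CommutativeRing.*-identityʳ R _ ⟩
      signs (λ _ → 0) ⊗ Δ                    ≈⟨ ⊗-comm _ _ ⟩
      Δ ⊗ signs (λ _ → 0)                    ∎)

  schurPoly-e : ∀ μ → part μ 0 ℕ.≤ m → ℓ μ ℕ.≤ n →
    schurPoly a μ n ≃ jacobiTrudi M e-poly (exponent a (conjugate μ) m)
  schurPoly-e μ μ₀≤m ℓ≤n = regular-cancelˡ vandermonde-regular (begin
    Δ ⊗ schurPoly a μ n                ≈⟨ schurPoly-exact a μ n ℓ≤n ⟨
    S                                  ≈⟨ CommutativeRing.*-identityʳ R S ⟨
    S ⊗ con ℚ[a].1#                    ≈⟨ ⊗-cong ≃-refl (signs-square (λ _ → 0)) ⟨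
    S ⊗ (ε ⊗ ε)                        ≈⟨ ⊗-assoc _ _ _ ⟨
    S ⊗ ε ⊗ ε                          ≈⟨ ⊗-cong (⊗-cong ≃-refl U-sign) ≃-refl ⟨
    S ⊗ U ⊗ ε                          ≈⟨ ⊗-cong (complement μ μ₀≤m ℓ≤n) ≃-refl ⟩
    det (λ l j → P l (α j)) ⊗ J ⊗ ε    ≈⟨ ⊗-cong (⊗-cong det-Pα ≃-refl) ≃-refl ⟩
    ε ⊗ Δ ⊗ J ⊗ ε
      ≈⟨ solve 3 (λ e d j → e :* d :* j :* e := e :* e :* (d :* j)) ≃-refl ε Δ J ⟩
    ε ⊗ ε ⊗ (Δ ⊗ J)                    ≈⟨ ⊗-cong (signs-square (λ _ → 0)) ≃-refl ⟩
    con ℚ[a].1# ⊗ (Δ ⊗ J)              ≈⟨ ⊗-identityˡ _ ⟩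
    Δ ⊗ J                              ∎)
    where
    S = det (schurMatrix a μ n)
    ε = signs (λ _ → 0)
    J = jacobiTrudi M e-poly (exponent a (conjugate μ) m)

-- From components to Λ, and the action of ω

module _ (b : Sequence) where
  open ΛElement

  -- Specialising the last variable recovers each component from the next, so large numbers of
  -- variables decide.
  ≋-descend : ∀ {P Q : ΛElement b} k → (∀ n → k ℕ.≤ n → component P n ≃ component Q n) → P ≋ Q
  ≋-descend {P} {Q} k e n = go k (e (k ℕ.+ n) (ℕ.m≤m+n k n))
    where
    go : ∀ k → component P (k ℕ.+ n) ≃ component Q (k ℕ.+ n) → component P n ≃ component Q n
    go zero    e = e
    go (suc k) e = go k (≃-trans (≃-sym (stable P (k ℕ.+ n)))
      (≃-trans (subst-cong (var ▹ con (b (+ suc (k ℕ.+ n)))) e) (stable Q (k ℕ.+ n))))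

  component-isRingHomomorphism : ∀ n → RingMorphisms.IsRingHomomorphism
    (CommutativeRing.rawRing (Λ b)) (CommutativeRing.rawRing (polyRing (Fin n))) (λ P → component P n)
  component-isRingHomomorphism n = record
    { isSemiringHomomorphism = record
      { isNearSemiringHomomorphism = record
        { +-isMonoidHomomorphism = record
          { isMagmaHomomorphism = record
            { isRelHomomorphism = record { cong = λ e → e n }
            ; homo = λ P Q → ≃-refl
            }
          ; ε-homo = ≃-refl
          }
        ; *-homo = λ P Q → ≃-refl
        }
      ; 1#-homo = ≃-refl
      }
    ; -‿homo = λ P → ≃-refl
    }

  scalars : ℕ → ℕ → ΛElement b
  scalars m r = a′ (descend (+ m) r) · CommutativeRing.1# (Λ b)

  component-jacobiTrudi : ∀ M gen r n →
    component (Table.jacobiTrudi (Λ b) (scalars (suc M)) M gen r) n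
    ≃ Table.jacobiTrudi (polyRing (Fin n)) (coefficients a′ (suc M)) M (λ k → component (gen k) n) r
  component-jacobiTrudi M gen r n = hom-jacobiTrudi (Λ b) (polyRing (Fin n)) (λ P → component P n)
    (component-isRingHomomorphism n) (scalars (suc M)) (coefficients a′ (suc M))
    (λ r → CommutativeRing.*-identityʳ (polyRing (Fin n)) _) M gen (λ k → component (gen k) n) (λ k → ≃-refl) r

-- The determinant is formed in Λ itself, where ω can be applied to it.
s-jacobiTrudi : ∀ μ M → part μ 0 ℕ.≤ suc M →
  s a μ ≋ Table.jacobiTrudi (Λ a) (scalars a (suc M)) M (e a) (exponent a (conjugate μ) (suc M))
s-jacobiTrudi μ M μ₀≤m = ≋-descend a {s a μ} {J} (ℓ μ) λ n ℓ≤n → ≃-trans (schurPoly-e n M μ μ₀≤m ℓ≤n)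
  (≃-sym (component-jacobiTrudi a M (e a) (exponent a (conjugate μ) (suc M)) n))
  where
  J = Table.jacobiTrudi (Λ a) (scalars a (suc M)) M (e a) (exponent a (conjugate μ) (suc M))

corollary2p7 : (ω : ΛElement a → ΛElement a′) →
    RingMorphisms.IsRingIsomorphism
    (CommutativeRing.rawRing (Λ a)) (CommutativeRing.rawRing (Λ a′)) ω →
    ((c : CommutativeRing.Carrier ℚ[a]) (P : ΛElement a) → ω (c · P) ≋ c · ω P) →
    ((k : ℕ) → 1 ≤ k → ω (e a k) ≋ h a′ k) →
    (μ : Partition) → ω (s a μ) ≋ s a′ (conjugate μ)
corollary2p7 ω ω-iso ω-linear ω-e μ = ≋-descend a′ {ω (s a μ)} {s a′ (conjugate μ)} (suc (part μ 0)) large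
  where
  open RingMorphisms.IsRingIsomorphism ω-iso using (⟦⟧-cong; 1#-homo; isRingHomomorphism)
  open ΛElement
  module Λa = CommutativeRing (Λ a)
  module Λa′ = CommutativeRing (Λ a′)

  generators : ∀ k → ω (e a k) ≋ h a′ k
  generators (suc k) = ω-e (suc k) (s≤s z≤n)
  -- The assumption on ω starts at k = 1; for k = 0 both elements are the unit.
  generators zero n = ≃-trans (⟦⟧-cong {e a 0} {Λa.1#} (schurPoly-∅ a) n)
    (≃-trans (1#-homo n) (≃-sym (schurPoly-∅ a′ n)))

  -- The number of variables on the side of a′ serves as the size m of the determinant; it is at
  -- least 1 and at least μ₀, the length of the conjugate.
  large : ∀ n → suc (part μ 0) ℕ.≤ n → component (ω (s a μ)) n ≃ component (s a′ (conjugate μ)) n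
  large (suc M) (s≤s μ₀≤M) = begin
    component (ω (s a μ)) m
      ≈⟨ ⟦⟧-cong {s a μ} {Ja} (s-jacobiTrudi μ M (ℕ.m≤n⇒m≤1+n μ₀≤M)) m ⟩
    component (ω Ja) m
      ≈⟨ hom-jacobiTrudi (Λ a) (Λ a′) ω isRingHomomorphism (scalars a m) (scalars a′ m)
           -- Linearity and ω(1) = 1 show that ω keeps the constants a′_{m-r} in the table.
           (λ r n → ≃-trans (ω-linear (a′ (descend (+ m) r)) Λa.1# n) (⊗-cong ≃-refl (1#-homo n)))
           M (e a) (h a′) generators r m ⟩
    component (Table.jacobiTrudi (Λ a′) (scalars a′ m) M (h a′) r) m
      ≈⟨ component-jacobiTrudi a′ M (h a′) r m ⟩
    Table.jacobiTrudi (polyRing (Fin m)) (coefficients a′ m) M (λ k → schurPoly a′ (row k) m) r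
      ≈⟨ schurPoly-h a′ M (conjugate μ) (ℕ.≤-trans (ℕ.≤-reflexive
           (List.length-applyUpTo (countAbove (Partition.parts μ)) (part μ 0))) (ℕ.m≤n⇒m≤1+n μ₀≤M)) ⟨
    schurPoly a′ (conjugate μ) m ∎
    where
    m = suc M
    r = exponent a (conjugate μ) m
    Ja = Table.jacobiTrudi (Λ a) (scalars a m) M (e a) r
    open SetoidReasoning (CommutativeRing.setoid (polyRing (Fin m)))
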